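{- Let $\Pi=\{1243,1324,3124,4321\}$ and let $n\ge 1$. Then $$Q_n(\Pi)=\sum_\lambda f^{\overline{\lambda}}s_\lambda$$ where the sum is over all partitions $\lambda\in\mathcal{H}_{n,3}$ with $\ell(\lambda)\le 3$, and $\overline{\lambda}$ is $\lambda$ with $\lambda_1$ replaced by $\min\{\lambda_1,2\}$. In particular, for $n\ge 6$ we have $$Q_n(\Pi)=s_n+2s_{n-1,1}+2s_{n-2,2}+3s_{n-2,1,1}+5s_{n-3,2,1}+5s_{n-4,2,2}.$$
   Context: $\mathfrak{S}_n$ is the set of permutations of $[n]$ in one-line notation. A permutation $\sigma$ contains $\pi$ as a pattern if some (not necessarily consecutive) subsequence of $\sigma$ is order-isomorphic to $\pi$; otherwise it avoids $\pi$. $\mathfrak{S}_n(\Pi)$ is the set of $\sigma\in\mathfrak{S}_n$ avoiding every $\pi\in\Pi$. $\mathrm{Des}\,\sigma=\{i\mid\sigma_i>\sigma_{i+1}\}\subseteq[n-1]$. For $S\subseteq[n-1]$, $F_S=\sum x_{i_1}\cdots x_{i_n}$ over all $i_1\le\dots\le i_n$ with $i_s<i_{s+1}$ whenever $s\in S$. $Q_n(\Pi)=\sum_{\sigma\in\mathfrak{S}_n(\Pi)}F_{\mathrm{Des}\,\sigma}$. $s_\lambda$ is the Schur function (parentheses around subscript partitions omitted), $f^\mu$ is the number of standard Young tableaux of shape $\mu$, and $\ell(\lambda)$ is the number of parts of $\lambda$. $\mathcal{H}_{n,j}$ is the set of partitions $\lambda$ of $n$ whose Young diagram does not contain the box in row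 $2$ and column $j$ (i.e. with $\lambda_2<j$). -}

module Defs where

open import Data.Nat using (ℕ; zero; suc; _+_; _*_; _∸_; _⊓_; _≤_; _≥_; _<_; _>_)
open import Data.Nat.Properties using (_≟_; _≤?_; _≥?_; _<?_; _>?_)
open import Data.Fin using (Fin; cast)
import Data.Fin.Properties as Fin
open import Data.List using (List; []; _∷_; map; concat; concatMap; filter; length; lookup; upTo; cartesianProductWith)
open import Data.Nat.ListAction using (sum)
open import Data.List.Properties using (≡-dec)
open import Data.List.Relation.Unary.All using (All; all?)
open import Data.List.Relation.Unary.Linked using (Linked; linked?)
open import Data.List.Relation.Unary.Unique.Propositional using (Unique)
open import Data.List.Relation.Unary.Unique.DecPropositional _≟_ using (unique?)
open import Data.List.Relation.Binary.Prefix.Heterogeneous using (Prefix)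
open import Data.List.Relation.Binary.Prefix.Heterogeneous.Properties using (prefix?)
open import Data.List.Relation.Binary.Sublist.Propositional using (_⊆_; []; _∷_; _∷ʳ_)
open import Data.Product using (Σ; ∃; _×_; _,_; proj₁; proj₂)
open import Data.Sum using (_⊎_; inj₁; inj₂)
open import Function using (_∘_)
open import Function.Bundles using (_⇔_; mk⇔; Equivalence)
open import Relation.Binary.PropositionalEquality using (_≡_; refl)
open import Relation.Nullary using (Dec; yes; no; ¬_)
open import Relation.Nullary.Decidable using (_×-dec_; _⊎-dec_; _→-dec_; ¬?; map′)
open import Relation.Unary using (Decidable)

------------------------------------------------------------------------
-- Words

[1…_] : ℕ → List ℕ
[1… n ] = map suc (upTo n)

-- Entries are indexed from 1; out-of-range entries are 0.
_!_ : List ℕ → ℕ → ℕ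
[]       ! _             = 0
(x ∷ xs) ! zero          = 0
(x ∷ xs) ! suc zero      = x
(x ∷ xs) ! suc (suc i)   = xs ! suc i

infix 9 _!_

-- All words of length n over the alphabet A.
words : List ℕ → ℕ → List (List ℕ)
words A zero    = [] ∷ []
words A (suc n) = cartesianProductWith _∷_ A (words A n)

------------------------------------------------------------------------
-- Formal power series in x₁, x₂, x₃, …

-- The exponent list a₁ ∷ … ∷ aₖ ∷ [] stands for the monomial x₁^a₁ ⋯ xₖ^aₖ.
-- Lists differing only by trailing zeros denote the same monomial.
Monomial : Set
Monomial = List ℕ

-- A series is given by its coefficients.  All series considered here have
-- coefficients in ℕ.
Series : Set
Series = Monomial → ℕ

infix  4 _≈_
infixl 6 _⊕_
infixr 7 _·_

_≈_ : Series → Series → Set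
f ≈ g = ∀ α → f α ≡ g α

_⊕_ : Series → Series → Series
(f ⊕ g) α = f α + g α

_·_ : ℕ → Series → Series
(c · f) α = c * f α

∑ : {A : Set} → List A → (A → Series) → Series
∑ xs f α = sum (map (λ x → f x α) xs)

syntax ∑ xs (λ x → e) = ∑[ x ∈ xs ] e

multiplicity : ℕ → List ℕ → ℕ
multiplicity i w = length (filter (i ≟_) w)

-- The word i₁ … iₙ, with letters in [k], has x_{i₁} ⋯ x_{iₙ} equal to the
-- monomial with exponent list  content k w.
content : ℕ → List ℕ → List ℕ
content k w = map (λ i → multiplicity i w) [1… k ]

------------------------------------------------------------------------
-- Permutations and pattern avoidance

𝔖 : ℕ → List (List ℕ)
𝔖 n = filter unique? (words [1… n ] n)

OrderIsomorphic : List ℕ → List ℕ → Set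
OrderIsomorphic τ π =
  Σ (length τ ≡ length π) λ eq → ∀ (i j : Fin (length τ)) →
    (lookup τ i < lookup τ j) ⇔ (lookup π (cast eq i) < lookup π (cast eq j))

Contains : List ℕ → List ℕ → Set
Contains σ π = ∃ λ τ → τ ⊆ σ × OrderIsomorphic τ π

Avoids : List (List ℕ) → List ℕ → Set
Avoids Π σ = All (λ π → ¬ Contains σ π) Π

_⇔-dec_ : {A B : Set} → Dec A → Dec B → Dec (A ⇔ B)
a? ⇔-dec b? = map′ (λ p → mk⇔ (proj₁ p) (proj₂ p))
                   (λ e → Equivalence.to e , Equivalence.from e)
                   ((a? →-dec b?) ×-dec (b? →-dec a?))

orderIsomorphic? : ∀ τ π → Dec (OrderIsomorphic τ π)
orderIsomorphic? τ π with length τ ≟ length π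
... | no  neq = no (neq ∘ proj₁)
... | yes eq  = map′ (eq ,_) proj₂
  (Fin.all? λ i → Fin.all? λ j →
    (lookup τ i <? lookup τ j) ⇔-dec (lookup π (cast eq i) <? lookup π (cast eq j)))

∃-sublist? : {P : List ℕ → Set} → Decidable P → ∀ σ → Dec (∃ λ τ → τ ⊆ σ × P τ)
∃-sublist? P? []      = map′ (λ p → [] , [] , p) (λ where (.[] , [] , p) → p) (P? [])
∃-sublist? {P} P? (x ∷ σ) =
  map′ to from (∃-sublist? P? σ ⊎-dec ∃-sublist? (P? ∘ (x ∷_)) σ)
  where
  to : (∃ λ τ → τ ⊆ σ × P τ) ⊎ (∃ λ τ → τ ⊆ σ × P (x ∷ τ)) → ∃ λ τ → τ ⊆ x ∷ σ × P τ
  to (inj₁ (τ , s , p)) = τ , x ∷ʳ s , p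
  to (inj₂ (τ , s , p)) = x ∷ τ , refl ∷ s , p

  from : (∃ λ τ → τ ⊆ x ∷ σ × P τ) → (∃ λ τ → τ ⊆ σ × P τ) ⊎ (∃ λ τ → τ ⊆ σ × P (x ∷ τ))
  from (τ     , .x ∷ʳ s  , p) = inj₁ (τ , s , p)
  from (_ ∷ τ , refl ∷ s , p) = inj₂ (τ , s , p)

contains? : ∀ σ π → Dec (Contains σ π)
contains? σ π = ∃-sublist? (λ τ → orderIsomorphic? τ π) σ

avoids? : ∀ Π → Decidable (Avoids Π)
avoids? Π σ = all? (λ π → ¬? (contains? σ π)) Π

𝔖-avoiding : ℕ → List (List ℕ) → List (List ℕ)
𝔖-avoiding n Π = filter (avoids? Π) (𝔖 n)

------------------------------------------------------------------------
-- Fundamental quasisymmetric functions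

Des : List ℕ → List ℕ
Des σ = filter (λ i → σ ! i >? σ ! suc i) [1… length σ ∸ 1 ]

Compatible : List ℕ → List ℕ → Set
Compatible S w = Linked _≤_ w × All (λ s → w ! s < w ! suc s) S

compatible? : ∀ S → Decidable (Compatible S)
compatible? S w = linked? _≤?_ w ×-dec all? (λ s → w ! s <? w ! suc s) S

-- F n S is F_S for S ⊆ [n-1].  The coefficient of α counts the index sequences
-- i₁ ≤ ⋯ ≤ iₙ with monomial α; these only involve x₁, …, x_{length α}.
F : ℕ → List ℕ → Series
F n S α = length (filter (λ w → compatible? S w ×-dec ≡-dec _≟_ (content k w) α)
                         (words [1… k ] n))
  where k = length α

Q : ℕ → List (List ℕ) → Series
Q n Π = ∑[ σ ∈ 𝔖-avoiding n Π ] F n (Des σ)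

------------------------------------------------------------------------
-- Partitions

WeaklyDecreasing : List ℕ → Set
WeaklyDecreasing = Linked _≥_

-- A partition of n has at most n parts, each in [n].
partitions : ℕ → List (List ℕ)
partitions n = filter (λ μ → linked? _≥?_ μ ×-dec (sum μ ≟ n))
                      (concatMap (words [1… n ]) (upTo (suc n)))

-- The Young diagram omits the box in row 2 and column j.
ℋ : ℕ → ℕ → List (List ℕ)
ℋ n j = filter (λ μ → μ ! 2 <? j) (partitions n)

overline : List ℕ → List ℕ
overline []      = []
overline (a ∷ μ) = a ⊓ 2 ∷ μ

------------------------------------------------------------------------
-- Tableaux and Schur functions

-- A tableau is the list of its rows, top row first (English notation).
Tableau : Set
Tableau = List (List ℕ)

-- All fillings of the diagram with row lengths μ by elements of A.
fillings : List ℕ → List ℕ → List Tableau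
fillings A []      = [] ∷ []
fillings A (r ∷ μ) = cartesianProductWith _∷_ (words A r) (fillings A μ)

-- The entries of each row exceed the entries directly above them.
ColumnStrict : Tableau → Set
ColumnStrict = Linked (λ upper lower → Prefix _>_ lower upper)

columnStrict? : Decidable ColumnStrict
columnStrict? = linked? (λ upper lower → prefix? _>?_ lower upper)

Semistandard : Tableau → Set
Semistandard T = All (Linked _≤_) T × ColumnStrict T

semistandard? : Decidable Semistandard
semistandard? T = all? (linked? _≤?_) T ×-dec columnStrict? T

-- For a filling by elements of [n], n the number of boxes, distinct entries mean
-- that each element of [n] occurs exactly once.
Standard : Tableau → Set
Standard T = All (Linked _<_) T × ColumnStrict T × Unique (concat T)

standard? : Decidable Standard
standard? T = all? (linked? _<?_) T ×-dec columnStrict? T ×-dec unique? (concat T)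

#SYT : List ℕ → ℕ
#SYT μ = length (filter standard? (fillings [1… sum μ ] μ))

-- The generating function of semistandard tableaux T of shape μ, each weighted
-- by the product of x_i over its entries i.
s : List ℕ → Series
s μ α = length (filter (λ T → semistandard? T ×-dec ≡-dec _≟_ (content k (concat T)) α)
                       (fillings [1… k ] μ))
  where k = length α

------------------------------------------------------------------------

Π₀ : List (List ℕ)
Π₀ = (1 ∷ 2 ∷ 4 ∷ 3 ∷ [])
   ∷ (1 ∷ 3 ∷ 2 ∷ 4 ∷ [])
   ∷ (3 ∷ 1 ∷ 2 ∷ 4 ∷ [])
   ∷ (4 ∷ 3 ∷ 2 ∷ 1 ∷ [])
   ∷ []

{-# OPTIONS --safe #-}

-- The coefficient of x^α on either side counts objects built along the sorted word w of
-- content α.  On the left these are the avoiding permutations that increase wherever w is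
-- constant, built by inserting last entries; on the right they are semistandard tableaux,
-- built by adding the letters of w in the order of standardisation.
--
-- Whether a permutation may be extended at a cut (a gap between its values) is updated by an
-- insertion through a few Booleans per cut, since three of the patterns arise by inserting a 3
-- into 124 outside its proper place.  So the generating tree of the avoiders has finitely many
-- states, and so has that of the shapes with λ₂ ≤ 2 and at most three rows, once λ₁ is capped
-- at 2.  Each capped shape is matched with a multiset of as many states as it has standard
-- tableaux, in such a way that the two trees branch alike; this is a finite check.
module Submission where

open import Defs
open import Data.Bool using (Bool; true; false; T; not; _∨_; if_then_else_)
import Data.Bool.Properties as Bool
open import Data.Empty using (⊥; ⊥-elim)
open import Data.Fin using (Fin; zero; suc; cast)
open import Data.List using (List; []; _∷_; _++_; _∷ʳ_; _ʳ++_; applyUpTo; concat; concatMap; drop; filter; foldr; length; lookup; map; replicate; reverse; upTo)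
open import Data.List.Membership.Propositional using (_∈_; _∉_; find; lose)
open import Data.List.Membership.Propositional.Properties
open import Data.List.Membership.Propositional.Properties.WithK using (unique∧set⇒bag)
open import Data.List.Properties
open import Data.List.Relation.Binary.BagAndSetEquality using (∼bag⇒↭)
open import Data.List.Relation.Binary.Permutation.Propositional using (_↭_; ↭-prep; ↭-refl; ↭-reflexive; ↭-sym; ↭-trans; ↭⇒↭ₛ; module PermutationReasoning)
open import Data.List.Relation.Binary.Permutation.Propositional.Properties using (All-resp-↭; map⁺; shift; ++-comm; ++⁺; ++⁺ˡ; ↭-length; ↭-reverse)
import Data.List.Relation.Binary.Permutation.Setoid.Properties as PermS
open import Data.List.Relation.Binary.Prefix.Heterogeneous using (Prefix; []; _∷_)
import Data.List.Relation.Binary.Prefix.Heterogeneous.Properties as PrefixP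
import Data.List.Relation.Binary.Sublist.Heterogeneous.Properties as Sublist
open import Data.List.Relation.Binary.Sublist.Propositional using (_⊆_; []; _∷_; minimum) renaming (_∷ʳ_ to _skip_)
open import Data.List.Relation.Unary.All as All using (All; []; _∷_)
import Data.List.Relation.Unary.All.Properties as AllP
open import Data.List.Relation.Unary.AllPairs as AllPairs using (AllPairs; []; _∷_)
import Data.List.Relation.Unary.AllPairs.Properties as AllPairsP
open import Data.List.Relation.Unary.Any using (here; there; any?)
open import Data.List.Relation.Unary.Linked as Linked using (Linked; []; [-]; _∷_; linked?)
import Data.List.Relation.Unary.Linked.Properties as LinkedP
open import Data.List.Relation.Unary.Unique.Propositional using (Unique)
import Data.List.Relation.Unary.Unique.Propositional.Properties as Uniq
open import Data.Maybe as Maybe using (Maybe; just; nothing; is-just; to-witness-T)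
open import Data.Nat
open import Data.Nat.ListAction using (sum)
open import Data.Nat.ListAction.Properties using (sum-↭)
open import Data.Nat.Properties
open import Data.Product using (∃; _×_; _,_; proj₁; proj₂)
open import Data.Product.Properties using () renaming (≡-dec to ×-≡-dec)
open import Data.Sum as Sum using (_⊎_; inj₁; inj₂)
open import Data.Unit using (⊤; tt)
import Data.Unit.Properties as Unit
open import Data.Vec using (Vec; []; _∷_; toList)
open import Function using (_∘_; id)
open import Function.Bundles using (mk⇔; Equivalence)
open import Relation.Binary.Definitions using (DecidableEquality; tri<; tri≈; tri>)
open import Relation.Binary.PropositionalEquality using (_≡_; _≢_; refl; sym; trans; cong; cong₂; subst; subst₂; setoid; module ≡-Reasoning)
open import Relation.Nullary
open import Relation.Nullary.Decidable using (True; toWitness; _×-dec_; _⊎-dec_)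
open import Relation.Nullary.Reflects using (_⊎-reflects_; ¬-reflects)
open import Relation.Unary using (Decidable)
open import Algebra.Properties.CommutativeSemigroup +-commutativeSemigroup using (x∙yz≈y∙xz)
open import Data.List.Membership.DecPropositional _≟_ using (_∈?_)
open import Data.List.Relation.Unary.Unique.DecPropositional _≟_ using (unique?)

-- Both trees see the word only through the Booleans that say whether a letter exceeds its
-- predecessor. At a strict step every site, and every row that keeps a shape, is available. At an
-- equal letter only the sites above the last entry remain, since the others create a descent, and
-- only the rows weakly above that of the last box, since standardisation numbers equal letters from
-- left to right, hence from bottom to top. No bijection between avoiders and tableaux is built. A
-- single state need not branch like a shape; what is checked is that the children of the whole
-- multiset `matching x`, taken together, rearrange the multisets attached to the children of `x`.
-- After the last letter the coefficient of `s μ` is then the size of the multiset at the final row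
-- state. The cap at 2, and with it the overlined shape, comes from the bound on the second row:
-- once the first row has two boxes, its length no longer restricts where a box may go.

private variable
  A B C D K : Set

-- Words and their contents

-- Counts are compared through this: instead of an explicit bijection, two duplicate-free
-- enumerations are shown to have the same members.
unique-set-↭ : {xs ys : List A} → Unique xs → Unique ys →
  (∀ {z} → z ∈ xs → z ∈ ys) → (∀ {z} → z ∈ ys → z ∈ xs) → xs ↭ ys
unique-set-↭ u v f g = ∼bag⇒↭ (unique∧set⇒bag u v (mk⇔ f g))

∈[1…]⁻ : ∀ {x n} → x ∈ [1… n ] → 1 ≤ x × x ≤ n
∈[1…]⁻ p with i , q , refl ← ∈-map⁻ suc p = s≤s z≤n , ∈-upTo⁻ q

∈[1…]⁺ : ∀ {x n} → 1 ≤ x → x ≤ n → x ∈ [1… n ]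
∈[1…]⁺ {suc x} _ q = ∈-map⁺ suc (∈-upTo⁺ q)

[1…]-unique : ∀ n → Unique [1… n ]
[1…]-unique n = Uniq.map⁺ suc-injective (Uniq.upTo⁺ n)

words-unique : ∀ {A} n → Unique A → Unique (words A n)
words-unique zero    u = [] ∷ []
words-unique (suc n) u = Uniq.cartesianProductWith⁺ _∷_ ∷-injective u (words-unique n u)

∈-words⁻ : ∀ {A} n {w} → w ∈ words A n → length w ≡ n × All (_∈ A) w
∈-words⁻ zero (here refl) = refl , []
∈-words⁻ {A} (suc n) p
  with x , w , x∈ , w∈ , refl ← ∈-cartesianProductWith⁻ _∷_ A (words A n) p
  with l , a ← ∈-words⁻ n w∈ = cong suc l , x∈ ∷ a

∈-words⁺ : ∀ {A} n {w} → length w ≡ n → All (_∈ A) w → w ∈ words A n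
∈-words⁺ _ refl [] = here refl
∈-words⁺ _ refl (x∈ ∷ a) = ∈-cartesianProductWith⁺ _∷_ x∈ (∈-words⁺ _ refl a)

multiplicity-∷-≡ : ∀ i w → multiplicity i (i ∷ w) ≡ suc (multiplicity i w)
multiplicity-∷-≡ i w = cong length (filter-accept (i ≟_) refl)

multiplicity-∷-≢ : ∀ {i x} w → i ≢ x → multiplicity i (x ∷ w) ≡ multiplicity i w
multiplicity-∷-≢ {i} w i≢x = cong length (filter-reject (i ≟_) i≢x)

multiplicity-++ : ∀ i u v → multiplicity i (u ++ v) ≡ multiplicity i u + multiplicity i v
multiplicity-++ i u v = trans (cong length (filter-++ (i ≟_) u v)) (length-++ (filter (i ≟_) u))

multiplicity>0⇒∈ : ∀ {i} w → 0 < multiplicity i w → i ∈ w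
multiplicity>0⇒∈ {i} (x ∷ w) p with i ≟ x
... | yes refl = here refl
... | no i≢x = there (multiplicity>0⇒∈ w (subst (0 <_) (multiplicity-∷-≢ w i≢x) p))

∈⇒multiplicity>0 : ∀ {i w} → i ∈ w → 0 < multiplicity i w
∈⇒multiplicity>0 {i} {x ∷ w} (here refl) = subst (0 <_) (sym (multiplicity-∷-≡ i w)) (s≤s z≤n)
∈⇒multiplicity>0 {i} {x ∷ w} (there p) with i ≟ x
... | yes refl = subst (0 <_) (sym (multiplicity-∷-≡ i w)) (s≤s z≤n)
... | no i≢x = subst (0 <_) (sym (multiplicity-∷-≢ w i≢x)) (∈⇒multiplicity>0 p)

∉⇒multiplicity≡0 : ∀ {i} w → i ∉ w → multiplicity i w ≡ 0
∉⇒multiplicity≡0 {i} w i∉ with multiplicity i w in eq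
... | zero = refl
... | suc _ = ⊥-elim (i∉ (multiplicity>0⇒∈ w (subst (0 <_) (sym eq) (s≤s z≤n))))

multiplicity-∷-cancel : ∀ i x u v → multiplicity i (x ∷ u) ≡ multiplicity i (x ∷ v) →
    multiplicity i u ≡ multiplicity i v
multiplicity-∷-cancel i x u v e with i ≟ x
... | yes refl = suc-injective (trans (sym (multiplicity-∷-≡ i u)) (trans e (multiplicity-∷-≡ i v)))
... | no i≢x = trans (sym (multiplicity-∷-≢ u i≢x)) (trans e (multiplicity-∷-≢ v i≢x))

Increasing : List ℕ → Set
Increasing = Linked _≤_

increasing-head : ∀ {x w} → Increasing (x ∷ w) → All (x ≤_) w
increasing-head p with a ∷ _ ← LinkedP.Linked⇒AllPairs ≤-trans p = a

increasing-∷ : ∀ {x w} → All (x ≤_) w → Increasing w → Increasing (x ∷ w)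
increasing-∷ [] [] = [-]
increasing-∷ (p ∷ _) l = p ∷ l

increasing-head-∈ : ∀ {x y w} → Increasing (x ∷ w) → y ∈ x ∷ w → x ≤ y
increasing-head-∈ l (here refl) = ≤-refl
increasing-head-∈ l (there p) = All.lookup (increasing-head l) p

-- Each head is the least letter of its word, and the letters agree, so the heads agree and can be
-- cancelled.
increasing-≡ : ∀ {u v} → Increasing u → Increasing v →
  (∀ i → multiplicity i u ≡ multiplicity i v) → u ≡ v
increasing-≡ {[]} {[]} _ _ _ = refl
increasing-≡ {[]} {y ∷ v} _ _ e with () ← trans (e y) (multiplicity-∷-≡ y v)
increasing-≡ {x ∷ u} {[]} _ _ e with () ← trans (sym (e x)) (multiplicity-∷-≡ x u)
increasing-≡ {x ∷ u} {y ∷ v} lu lv e = go (≤-antisym x≤y y≤x)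
  where
  x≤y : x ≤ y
  x≤y = increasing-head-∈ lu (multiplicity>0⇒∈ (x ∷ u)
      (subst (0 <_) (sym (e y)) (∈⇒multiplicity>0 {w = y ∷ v} (here refl))))
  y≤x : y ≤ x
  y≤x = increasing-head-∈ lv (multiplicity>0⇒∈ (y ∷ v)
      (subst (0 <_) (e x) (∈⇒multiplicity>0 {w = x ∷ u} (here refl))))
  go : x ≡ y → x ∷ u ≡ y ∷ v
  go refl = cong (x ∷_) (increasing-≡ (Linked.tail lu) (Linked.tail lv) λ i → multiplicity-∷-cancel i x u v (e i))

-- The unique weakly increasing word with content α, over the letters j, j + 1, ….
wordFrom : ℕ → List ℕ → List ℕ
wordFrom j []      = []
wordFrom j (a ∷ α) = replicate a j ++ wordFrom (suc j) α

range : ℕ → ℕ → List ℕ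
range j zero    = []
range j (suc k) = j ∷ range (suc j) k

range-∈ : ∀ {i} j k → i ∈ range j k → j ≤ i × i < j + k
range-∈ j (suc k) (here refl) = ≤-refl , m<m+n j (s≤s z≤n)
range-∈ {i} j (suc k) (there p) with a , b ← range-∈ (suc j) k p = <⇒≤ a , subst (i <_) (sym (+-suc j k)) b

[1…]≡range : ∀ n → [1… n ] ≡ range 1 n
[1…]≡range n = trans (map-upTo suc n) (go 1 n)
  where
  go : ∀ j n → applyUpTo (j +_) n ≡ range j n
  go j zero = refl
  go j (suc n) = cong₂ _∷_ (+-identityʳ j)
    (trans (applyUpTo-cong n) (go (suc j) n))
    where
    applyUpTo-cong : ∀ n → applyUpTo (λ x → j + suc x) n ≡ applyUpTo (suc j +_) n
    applyUpTo-cong n = trans (sym (map-upTo _ n)) (trans (map-cong (+-suc j) (upTo n)) (map-upTo _ n))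

wordFrom-≥ : ∀ j α → All (j ≤_) (wordFrom j α)
wordFrom-≥ j [] = []
wordFrom-≥ j (a ∷ α) = AllP.++⁺ (AllP.replicate⁺ a ≤-refl) (All.map <⇒≤ (wordFrom-≥ (suc j) α))

wordFrom-< : ∀ j α → All (_< j + length α) (wordFrom j α)
wordFrom-< j [] = []
wordFrom-< j (a ∷ α) = AllP.++⁺ (AllP.replicate⁺ a (m<m+n j (s≤s z≤n)))
  (subst (λ m → All (_< m) (wordFrom (suc j) α)) (sym (+-suc j (length α))) (wordFrom-< (suc j) α))

wordFrom-increasing : ∀ j α → Increasing (wordFrom j α)
wordFrom-increasing j [] = []
wordFrom-increasing j (a ∷ α) = go a
  where
  go : ∀ a → Increasing (replicate a j ++ wordFrom (suc j) α)
  go zero = wordFrom-increasing (suc j) α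
  go (suc a) = increasing-∷ (AllP.++⁺ (AllP.replicate⁺ a ≤-refl) (All.map <⇒≤ (wordFrom-≥ (suc j) α))) (go a)

wordFrom-length : ∀ j α → length (wordFrom j α) ≡ sum α
wordFrom-length j [] = refl
wordFrom-length j (a ∷ α) = trans (length-++ (replicate a j))
    (cong₂ _+_ (length-replicate a) (wordFrom-length (suc j) α))

multiplicity-replicate : ∀ i a → multiplicity i (replicate a i) ≡ a
multiplicity-replicate i zero = refl
multiplicity-replicate i (suc a) = trans (multiplicity-∷-≡ i _) (cong suc (multiplicity-replicate i a))

wordFrom-content : ∀ j α → map (λ i → multiplicity i (wordFrom j α)) (range j (length α)) ≡ α
wordFrom-content j [] = refl
wordFrom-content j (a ∷ α) = cong₂ _∷_ hd
    (trans (map-cong-local (All.tabulate tl)) (wordFrom-content (suc j) α))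
  where
  hd : multiplicity j (replicate a j ++ wordFrom (suc j) α) ≡ a
  hd = trans (multiplicity-++ j (replicate a j) _)
      (trans (cong₂ _+_ (multiplicity-replicate j a)
               (∉⇒multiplicity≡0 _ λ p → <-irrefl refl (All.lookup (wordFrom-≥ (suc j) α) p)))
             (+-identityʳ a))
  tl : ∀ {i} → i ∈ range (suc j) (length α) →
    multiplicity i (replicate a j ++ wordFrom (suc j) α) ≡ multiplicity i (wordFrom (suc j) α)
  tl {i} p = trans (multiplicity-++ i (replicate a j) _) (cong (_+ multiplicity i (wordFrom (suc j) α))
    (∉⇒multiplicity≡0 (replicate a j) λ q →
      <⇒≢ (proj₁ (range-∈ (suc j) (length α) p)) (sym (All.lookup (AllP.replicate⁺ {P = _≡ j} a refl) q))))

wordOf : List ℕ → List ℕ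
wordOf = wordFrom 1

wordOf-letters : ∀ α → All (_∈ [1… length α ]) (wordOf α)
wordOf-letters α = All.zipWith (λ (p , q) → ∈[1…]⁺ p (s≤s⁻¹ q)) (wordFrom-≥ 1 α , wordFrom-< 1 α)

content-wordOf : ∀ α → content (length α) (wordOf α) ≡ α
content-wordOf α = trans (cong (map (λ i → multiplicity i (wordOf α))) ([1…]≡range (length α))) (wordFrom-content 1 α)

content-≡⁻ : ∀ k u v → content k u ≡ content k v → ∀ {i} → i ∈ [1… k ] → multiplicity i u ≡ multiplicity i v
content-≡⁻ k u v e = go [1… k ] e
  where
  go : ∀ is → map (λ i → multiplicity i u) is ≡ map (λ i → multiplicity i v) is →
    ∀ {i} → i ∈ is → multiplicity i u ≡ multiplicity i v
  go (_ ∷ is) e (here refl) = ∷-injectiveˡ e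
  go (_ ∷ is) e (there p) = go is (∷-injectiveʳ e) p

content⇒multiplicity : ∀ α {w} → All (_∈ [1… length α ]) w → content (length α) w ≡ α →
  ∀ i → multiplicity i w ≡ multiplicity i (wordOf α)
content⇒multiplicity α {w} a e i with 1 ≤? i ×-dec i ≤? length α
... | yes (p , q) = content-≡⁻ (length α) w (wordOf α) (trans e (sym (content-wordOf α))) (∈[1…]⁺ p q)
... | no ¬p = trans (∉⇒multiplicity≡0 w (λ q → ¬p (∈[1…]⁻ (All.lookup a q))))
                    (sym (∉⇒multiplicity≡0 (wordOf α) (λ q → ¬p (∈[1…]⁻ (All.lookup (wordOf-letters α) q)))))

multiplicity⇒content : ∀ α {w} → (∀ i → multiplicity i w ≡ multiplicity i (wordOf α)) →
  content (length α) w ≡ α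
multiplicity⇒content α e = trans (map-cong e [1… length α ]) (content-wordOf α)

-- The count is 0 or 1. Writing it as a filter of a singleton, with the remaining condition `Q?`,
-- lets a sum of such counts be turned into one filter by `sum-filter-singleton`.
length-filter-singleton : ∀ {P : A → Set} (P? : Decidable P) {Q : A → Set} (Q? : Decidable Q) {xs : List A}
    {x : A} → Unique xs →
  (∀ {z} → z ∈ xs → P z → z ≡ x × Q x) → (Q x → x ∈ xs × P x) →
  length (filter P? xs) ≡ length (filter Q? (x ∷ []))
length-filter-singleton P? Q? {xs} {x} u f g = ↭-length
    (unique-set-↭ (Uniq.filter⁺ P? u) (Uniq.filter⁺ Q? ([] ∷ [])) to from)
  where
  to : ∀ {z} → z ∈ filter P? xs → z ∈ filter Q? (x ∷ [])
  to p with z∈ , pz ← ∈-filter⁻ P? p with refl , q ← f z∈ pz = ∈-filter⁺ Q? (here refl) q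
  from : ∀ {z} → z ∈ filter Q? (x ∷ []) → z ∈ filter P? xs
  from p with ∈-filter⁻ Q? p
  ... | here refl , q with x∈ , px ← g q = ∈-filter⁺ P? x∈ px

-- The generating trees of avoiders and of tableaux, as finite automata

-- All that an insertion needs to know about a cut: whether no value lies below it, whether none
-- lies above it, whether the values above it contain a pattern 21, and whether those below it
-- contain a 12.
record Label : Set where
  constructor label
  field
    isFirst isLast hasDesc hasAsc : Bool

open Label public

_≟ᴸ_ : DecidableEquality Label
label f l d a ≟ᴸ label f′ l′ d′ a′ with f Bool.≟ f′ | l Bool.≟ l′ | d Bool.≟ d′ | a Bool.≟ a′
... | yes refl | yes refl | yes refl | yes refl = yes refl
... | no p | _ | _ | _ = no λ where refl → p refl
... | yes _ | no p | _ | _ = no λ where refl → p refl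
... | yes _ | yes _ | no p | _ = no λ where refl → p refl
... | yes _ | yes _ | yes _ | no p = no λ where refl → p refl

Site : Set → Set
Site C = C × Label

-- The sites below and above the last entry: inserting at one of the former creates a descent.
Zipper : Set → Set
Zipper C = List (Site C) × List (Site C)

-- The label of a site s after an insertion at the site v, if it ends up below the new entry
-- (loweredLabel) or above it (raisedLabel).
loweredLabel : Label → Label → Label
loweredLabel v s = label (isFirst s) false (hasDesc s ∨ not (isLast v)) (hasAsc s)

raisedLabel : Label → Label → Label
raisedLabel v s = label false (isLast s) (hasDesc s) (hasAsc s ∨ not (isFirst v))

lowered : Site C → Site C → Site C
lowered (_ , v) (c , s) = c , loweredLabel v s

raised : (C → C) → Site C → Site C → Site C
raised up (_ , v) (c , s) = up c , raisedLabel v s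

descending? : (s : Site C) → Dec (hasAsc (proj₂ s) ≡ false)
descending? s = hasAsc (proj₂ s) Bool.≟ false

-- The new entry threatens a cut below it in two ways only: after a 21 above the chosen site it ends
-- a 321, which an entry at the cut would complete to 4321; after a 12 below the cut it ends the 124
-- of a 1243. The site `v` itself takes part, since an insertion splits its gap in two.
childLow : List (Site C) → Site C → List (Site C)
childLow pre v = if hasDesc (proj₂ v) then [] else map (lowered v) (filter descending? (pre ∷ʳ v))

-- For a cut above the new entry the danger is a value below that entry together with one between it
-- and the cut: in either order the three form a 132 or a 312, which an entry at the cut completes
-- to 1324 or 3124. There is no such pair exactly when the chosen site is the lowest cut, or the cut
-- is the upper half of the split gap.
childHigh : (C → C) → Site C → List (Site C) → List (Site C)
childHigh up v post = raised up v v ∷ (if isFirst (proj₂ v) then map (raised up v) post else [])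

picks : List A → List A → List (List A × A × List A)
picks pre []         = []
picks pre (v ∷ post) = (pre , v , post) ∷ picks (pre ∷ʳ v) post

choices : Bool → Zipper C → List (List (Site C) × Site C × List (Site C))
choices true  (ls , rs) = picks [] (ls ++ rs)
choices false (ls , rs) = picks ls rs

child : (C → C) → List (Site C) × Site C × List (Site C) → Zipper C
child up (pre , v , post) = childLow pre v , childHigh up v post

moves : (C → C) → Bool → Zipper C → List (Zipper C)
moves up b z = map (child up) (choices b z)

module _ (f : A → B) where
  mapPick : List A × A × List A → List B × B × List B
  mapPick (pre , v , post) = map f pre , f v , map f post

  map-picks : ∀ pre post → map mapPick (picks pre post) ≡ picks (map f pre) (map f post)
  map-picks pre [] = refl
  map-picks pre (v ∷ post) = cong₂ _∷_ refl
    (trans (map-picks (pre ∷ʳ v) post) (cong (λ p → picks p (map f post)) (map-++ f pre (v ∷ []))))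

module _ (h : C → D) (up : C → C) (up′ : D → D) (h-up : ∀ c → h (up c) ≡ up′ (h c)) where

  mapSite : Site C → Site D
  mapSite (c , l) = h c , l

  mapZipper : Zipper C → Zipper D
  mapZipper (ls , rs) = map mapSite ls , map mapSite rs

  map-raised : ∀ v s → mapSite (raised up v s) ≡ raised up′ (mapSite v) (mapSite s)
  map-raised v (c , s) = cong (_, _) (h-up c)

  map-filter : ∀ ss → map mapSite (filter descending? ss) ≡ filter descending? (map mapSite ss)
  map-filter [] = refl
  map-filter (s ∷ ss) with descending? s
  ... | yes p = cong (mapSite s ∷_) (map-filter ss)
  ... | no ¬p = map-filter ss

  map-childLow : ∀ pre v → map mapSite (childLow pre v) ≡ childLow (map mapSite pre) (mapSite v)
  map-childLow pre v with hasDesc (proj₂ v)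
  ... | true = refl
  ... | false = begin
    map mapSite (map (lowered v) (filter descending? (pre ∷ʳ v))) ≡⟨ map-∘ _ ⟨
    map (mapSite ∘ lowered v) (filter descending? (pre ∷ʳ v)) ≡⟨ map-∘ _ ⟩
    map (lowered (mapSite v)) (map mapSite (filter descending? (pre ∷ʳ v)))
      ≡⟨ cong (map (lowered (mapSite v))) (trans (map-filter (pre ∷ʳ v))
          (cong (filter descending?) (map-++ mapSite pre (v ∷ [])))) ⟩
    map (lowered (mapSite v)) (filter descending? (map mapSite pre ∷ʳ mapSite v)) ∎
    where open ≡-Reasoning

  map-childHigh : ∀ v post → map mapSite (childHigh up v post) ≡ childHigh up′ (mapSite v) (map mapSite post)
  map-childHigh v post = cong₂ _∷_ (map-raised v v) (go (isFirst (proj₂ v)))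
    where
    go : ∀ b → map mapSite (if b then map (raised up v) post else []) ≡
        (if b then map (raised up′ (mapSite v)) (map mapSite post) else [])
    go false = refl
    go true = trans (sym (map-∘ post)) (trans (map-cong (map-raised v) post) (map-∘ post))

  map-child : ∀ p → mapZipper (child up p) ≡ child up′ (mapPick mapSite p)
  map-child (pre , v , post) = cong₂ _,_ (map-childLow pre v) (map-childHigh v post)

  map-choices : ∀ b z → map (mapPick mapSite) (choices b z) ≡ choices b (mapZipper z)
  map-choices true (ls , rs) = trans (map-picks mapSite [] (ls ++ rs)) (cong (picks []) (map-++ mapSite ls rs))
  map-choices false (ls , rs) = map-picks mapSite ls rs

  -- Branching reads labels and never cuts. Applied to forgetting the cuts, this passes from the
  -- zippers of actual permutations to the states of the automaton.
  map-moves : ∀ b z → map mapZipper (moves up b z) ≡ moves up′ b (mapZipper z)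
  map-moves b z = begin
    map mapZipper (map (child up) (choices b z)) ≡⟨ map-∘ _ ⟨
    map (mapZipper ∘ child up) (choices b z) ≡⟨ map-cong map-child _ ⟩
    map (child up′ ∘ mapPick mapSite) (choices b z) ≡⟨ map-∘ _ ⟩
    map (child up′) (map (mapPick mapSite) (choices b z)) ≡⟨ cong (map (child up′)) (map-choices b z) ⟩
    map (child up′) (choices b (mapZipper z)) ∎
    where open ≡-Reasoning

State : Set
State = Zipper ⊤

_≟ˢ_ : DecidableEquality State
_≟ˢ_ = ×-≡-dec (≡-dec site≟) (≡-dec site≟)
  where
  site≟ : DecidableEquality (Site ⊤)
  site≟ = ×-≡-dec Unit._≟_ _≟ᴸ_

step : Bool → State → List State
step = moves id

root : State
root = [] , (tt , label true true false false) ∷ []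

run : (Bool → A → List A) → List Bool → List A → List A
run next []       l = l
run next (b ∷ bs) l = run next bs (concatMap (next b) l)

-- The automaton of capped shapes, and its matching with states

data Row : Set where
  top middle bottom : Row

-- The row lengths λ₁ ⊓ 2, λ₂, λ₃ and the row of the last box.
RowState : Set
RowState = ℕ × ℕ × ℕ × ℕ

origin : RowState
origin = 0 , 0 , 0 , 0

-- Equal letters enter from bottom to top, so the box above a new box, once filled, holds a smaller
-- letter; column strictness thus reduces to comparing row lengths. The bound `m₂ < 2` keeps the
-- shape in `ℋ n 3` and makes the comparison with the capped `m₁` exact.
Open : Bool → RowState → Row → Set
Open b (m₁ , m₂ , m₃ , r) top    = ⊤
Open b (m₁ , m₂ , m₃ , r) middle = m₂ < m₁ × m₂ < 2 × (T b ⊎ 1 ≤ r)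
Open b (m₁ , m₂ , m₃ , r) bottom = m₃ < m₂ × (T b ⊎ 2 ≤ r)

open? : ∀ b x → Decidable (Open b x)
open? b (m₁ , m₂ , m₃ , r) top    = yes tt
open? b (m₁ , m₂ , m₃ , r) middle = m₂ <? m₁ ×-dec m₂ <? 2 ×-dec (Bool.T? b ⊎-dec 1 ≤? r)
open? b (m₁ , m₂ , m₃ , r) bottom = m₃ <? m₂ ×-dec (Bool.T? b ⊎-dec 2 ≤? r)

push : RowState → Row → RowState
push (m₁ , m₂ , m₃ , r) top    = suc m₁ ⊓ 2 , m₂ , m₃ , 0
push (m₁ , m₂ , m₃ , r) middle = m₁ , suc m₂ , m₃ , 1
push (m₁ , m₂ , m₃ , r) bottom = m₁ , m₂ , suc m₃ , 2

openRows : Bool → RowState → List Row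
openRows b x = filter (open? b x) (top ∷ middle ∷ bottom ∷ [])

rowStep : Bool → RowState → List RowState
rowStep b x = map (push x) (openRows b x)

finals : List Bool → RowState → List RowState
finals []       x = x ∷ []
finals (b ∷ bs) x = concatMap (finals bs ∘ push x) (openRows b x)

-- Closed under `rowStep`; this is the second half of `Compatibleˢ`, and it lets the finite check
-- serve words of any length.
reachable : List RowState
reachable = (0 , 0 , 0 , 0) ∷ (1 , 0 , 0 , 0) ∷ (2 , 0 , 0 , 0) ∷ (1 , 1 , 0 , 1)
          ∷ (2 , 1 , 0 , 1) ∷ (2 , 1 , 0 , 0) ∷ (1 , 1 , 1 , 2) ∷ (2 , 2 , 0 , 1)
          ∷ (2 , 2 , 0 , 0) ∷ (2 , 1 , 1 , 2) ∷ (2 , 1 , 1 , 0) ∷ (2 , 2 , 1 , 2)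
          ∷ (2 , 2 , 1 , 1) ∷ (2 , 2 , 1 , 0) ∷ (2 , 2 , 2 , 2) ∷ (2 , 2 , 2 , 0) ∷ []

private
  pattern ℓ₁ = tt , label true false false false
  pattern ℓ₂ = tt , label true false true false
  pattern ℓ₃ = tt , label false false false false
  pattern ℓ₄ = tt , label false false true false
  pattern ℓ₅ = tt , label false false false true
  pattern ℓ₆ = tt , label false false true true
  pattern ℓ₇ = tt , label false true false false
  pattern ℓ₈ = tt , label false true false true

  -- The pairs `z₆`, `z₇`; `z₉`, `z₁₁`; `z₁₀`, `z₁₂`; `z₁₄`, `z₁₅` have the same sites and differ
  -- only in the position of the last entry, which matters when the next letter is equal. `z₈` is
  -- absorbing: its single site lies above the last entry, and its only child is `z₈` again.
  z₁ z₂ z₃ z₄ z₅ z₆ z₇ z₈ z₉ z₁₀ z₁₁ z₁₂ z₁₃ z₁₄ z₁₅ : State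
  z₁  = ℓ₁ ∷ [] , ℓ₇ ∷ []
  z₂  = ℓ₂ ∷ [] , ℓ₃ ∷ ℓ₇ ∷ []
  z₃  = ℓ₁ ∷ ℓ₃ ∷ [] , ℓ₈ ∷ []
  z₄  = [] , ℓ₄ ∷ ℓ₃ ∷ ℓ₇ ∷ []
  z₅  = ℓ₂ ∷ ℓ₄ ∷ [] , ℓ₅ ∷ []
  z₆  = ℓ₂ ∷ ℓ₃ ∷ ℓ₃ ∷ [] , ℓ₈ ∷ []
  z₇  = ℓ₂ ∷ [] , ℓ₃ ∷ ℓ₃ ∷ ℓ₈ ∷ []
  z₈  = [] , ℓ₆ ∷ []
  z₉  = ℓ₄ ∷ ℓ₄ ∷ [] , ℓ₅ ∷ []
  z₁₀ = ℓ₄ ∷ ℓ₃ ∷ ℓ₃ ∷ [] , ℓ₈ ∷ []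
  z₁₁ = [] , ℓ₄ ∷ ℓ₄ ∷ ℓ₅ ∷ []
  z₁₂ = [] , ℓ₄ ∷ ℓ₃ ∷ ℓ₃ ∷ ℓ₈ ∷ []
  z₁₃ = ℓ₂ ∷ ℓ₄ ∷ ℓ₄ ∷ [] , ℓ₅ ∷ []
  z₁₄ = ℓ₄ ∷ ℓ₄ ∷ ℓ₄ ∷ [] , ℓ₅ ∷ []
  z₁₅ = [] , ℓ₄ ∷ ℓ₄ ∷ ℓ₄ ∷ ℓ₅ ∷ []

-- The row of the last box selects between states that differ in the position of the last entry. At
-- `(2 , 2 , 2)` only the first row can still grow, which agrees with five copies of the absorbing
-- `z₈`. The final clause covers tuples outside `reachable`.
matching : RowState → List State
matching (0 , 0 , 0 , _) = root ∷ []
matching (1 , 0 , 0 , _) = z₁ ∷ []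
matching (2 , 0 , 0 , _) = z₃ ∷ []
matching (1 , 1 , 0 , _) = z₂ ∷ []
matching (1 , 1 , 1 , _) = z₄ ∷ []
matching (2 , 1 , 0 , 0) = z₅ ∷ z₆ ∷ []
matching (2 , 1 , 0 , _) = z₅ ∷ z₇ ∷ []
matching (2 , 2 , 0 , _) = z₅ ∷ z₁₃ ∷ []
matching (2 , 1 , 1 , 0) = z₈ ∷ z₉ ∷ z₁₀ ∷ []
matching (2 , 1 , 1 , _) = z₈ ∷ z₁₁ ∷ z₁₂ ∷ []
matching (2 , 2 , 1 , 2) = z₈ ∷ z₈ ∷ z₈ ∷ z₁₁ ∷ z₁₅ ∷ []
matching (2 , 2 , 1 , _) = z₈ ∷ z₈ ∷ z₈ ∷ z₉ ∷ z₁₄ ∷ []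
matching (2 , 2 , 2 , _) = z₈ ∷ z₈ ∷ z₈ ∷ z₈ ∷ z₈ ∷ []
matching _               = []

module _ (_≟ᴬ_ : DecidableEquality A) where
  -- A greedy search: each element of `xs` is removed from `ys` at its first occurrence. A `just`
  -- carries the certificate that the finite check extracts.
  permutation? : (xs ys : List A) → Maybe (xs ↭ ys)
  permutation? [] []      = just ↭-refl
  permutation? [] (_ ∷ _) = nothing
  permutation? (x ∷ xs) ys with any? (x ≟ᴬ_) ys
  ... | no _  = nothing
  ... | yes p with as , bs , refl ← ∈-∃++ p =
    Maybe.map (λ q → ↭-trans (↭-prep x q) (↭-sym (shift x as bs))) (permutation? xs (as ++ bs))

Compatibleˢ : RowState → Bool → Set
Compatibleˢ x b = T (is-just (permutation? _≟ˢ_ (concatMap (step b) (matching x)) (concatMap matching (rowStep b x))))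
                × All (_∈ reachable) (rowStep b x)

compatibleˢ? : ∀ x b → Dec (Compatibleˢ x b)
compatibleˢ? x b = Bool.T? _ ×-dec All.all? (λ y → any? (×-≡-dec _≟_ (×-≡-dec _≟_ (×-≡-dec _≟_ _≟_)) y) reachable) _

abstract
  -- Thirty-two instances, sixteen row states with two Booleans each, are settled by evaluation;
  -- `abstract` keeps this evaluation from being unfolded later.
  reachable-compatible : All (λ x → All (Compatibleˢ x) (true ∷ false ∷ [])) reachable
  reachable-compatible = toWitness {a? = All.all? (λ x → All.all? (compatibleˢ? x) (true ∷ false ∷ [])) reachable} tt

shape : RowState → List ℕ
shape (m₁ , m₂ , m₃ , _) = filter (0 <?_) (m₁ ∷ m₂ ∷ m₃ ∷ [])

abstract
  -- This is where the coefficients come from: each final row state contributes as many avoiders as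
  -- its capped shape has standard tableaux.
  length-matching : All (λ x → length (matching x) ≡ #SYT (shape x)) reachable
  length-matching = toWitness {a? = All.all? (λ x → length (matching x) ≟ #SYT (shape x)) reachable} tt

-- From the finite check to words of any length

concatMap-↭ : (f : A → List B) {xs ys : List A} → xs ↭ ys → concatMap f xs ↭ concatMap f ys
concatMap-↭ f _↭_.refl = ↭-refl
concatMap-↭ f (_↭_.prep x p) = ++⁺ˡ (f x) (concatMap-↭ f p)
concatMap-↭ f (_↭_.swap {xs} x y p) = ↭-trans (↭-reflexive (sym (++-assoc (f x) (f y) _)))
  (↭-trans (++⁺ (++-comm (f x) (f y)) (concatMap-↭ f p)) (↭-reflexive (++-assoc (f y) (f x) _)))
concatMap-↭ f (_↭_.trans p q) = ↭-trans (concatMap-↭ f p) (concatMap-↭ f q)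

concatMap-cong-↭ : {f g : A → List B} {xs : List A} → All (λ x → f x ↭ g x) xs → concatMap f xs ↭ concatMap g xs
concatMap-cong-↭ [] = ↭-refl
concatMap-cong-↭ (p ∷ ps) = ++⁺ p (concatMap-cong-↭ ps)

concatMap-concatMap : (g : B → List C) (f : A → List B) (xs : List A) →
  concatMap g (concatMap f xs) ≡ concatMap (concatMap g ∘ f) xs
concatMap-concatMap g f [] = refl
concatMap-concatMap g f (x ∷ xs) = trans (concatMap-++ g (f x) _)
    (cong (concatMap g (f x) ++_) (concatMap-concatMap g f xs))

length-concatMap : (f : A → List B) (xs : List A) → length (concatMap f xs) ≡ sum (map (length ∘ f) xs)
length-concatMap f [] = refl
length-concatMap f (x ∷ xs) = trans (length-++ (f x)) (cong (length (f x) +_) (length-concatMap f xs))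

module _ (next : Bool → A → List A) where
  run-[] : ∀ bs → run next bs [] ≡ []
  run-[] [] = refl
  run-[] (b ∷ bs) = run-[] bs

  run-++ : ∀ bs xs ys → run next bs (xs ++ ys) ≡ run next bs xs ++ run next bs ys
  run-++ [] xs ys = refl
  run-++ (b ∷ bs) xs ys = trans (cong (run next bs) (concatMap-++ (next b) xs ys)) (run-++ bs _ _)

  run-concatMap : ∀ bs (f : B → List A) xs → run next bs (concatMap f xs) ≡ concatMap (run next bs ∘ f) xs
  run-concatMap bs f [] = run-[] bs
  run-concatMap bs f (x ∷ xs) = trans (run-++ bs (f x) _) (cong (run next bs (f x) ++_) (run-concatMap bs f xs))

  run-↭ : ∀ bs {xs ys} → xs ↭ ys → run next bs xs ↭ run next bs ys
  run-↭ [] p = p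
  run-↭ (b ∷ bs) p = run-↭ bs (concatMap-↭ (next b) p)

compatible : ∀ {x} → x ∈ reachable → ∀ b → Compatibleˢ x b
compatible x∈ b with All.lookup reachable-compatible x∈
compatible x∈ true  | p ∷ _ ∷ [] = p
compatible x∈ false | _ ∷ p ∷ [] = p

step-matching : ∀ {x} → x ∈ reachable → ∀ b → concatMap (step b) (matching x) ↭ concatMap matching (rowStep b x)
step-matching x∈ b = to-witness-T _ (proj₁ (compatible x∈ b))

push-reachable : ∀ {x} → x ∈ reachable → ∀ b → All (λ q → push x q ∈ reachable) (openRows b x)
push-reachable x∈ b = AllP.map⁻ (proj₂ (compatible x∈ b))

finals-reachable : ∀ bs {x} → x ∈ reachable → All (_∈ reachable) (finals bs x)
finals-reachable [] x∈ = x∈ ∷ []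
finals-reachable (b ∷ bs) {x} x∈ = AllP.concat⁺ (AllP.map⁺ (All.map (finals-reachable bs) (push-reachable x∈ b)))

-- Induction on the Booleans. The check rearranges the first generation only as a multiset, hence
-- `run-↭`; afterwards the run splits over the open rows and the hypothesis applies to each.
run-matching : ∀ bs {x} → x ∈ reachable → run step bs (matching x) ↭ concatMap matching (finals bs x)
run-matching [] {x} x∈ = ↭-reflexive (sym (++-identityʳ (matching x)))
run-matching (b ∷ bs) {x} x∈ = begin
  run step bs (concatMap (step b) (matching x)) ↭⟨ run-↭ step bs (step-matching x∈ b) ⟩
  run step bs (concatMap matching (rowStep b x)) ≡⟨ run-concatMap step bs matching (rowStep b x) ⟩
  concatMap (run step bs ∘ matching) (map (push x) (openRows b x)) ≡⟨ concatMap-map _ (push x) (openRows b x) ⟩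
  concatMap (run step bs ∘ matching ∘ push x) (openRows b x)
    ↭⟨ concatMap-cong-↭ (All.map (run-matching bs) (push-reachable x∈ b)) ⟩
  concatMap (concatMap matching ∘ finals bs ∘ push x) (openRows b x)
    ≡⟨ concatMap-concatMap matching (finals bs ∘ push x) (openRows b x) ⟨
  concatMap matching (concatMap (finals bs ∘ push x) (openRows b x)) ∎
  where open PermutationReasoning

length-run : ∀ bs → length (run step bs (root ∷ [])) ≡ sum (map (#SYT ∘ shape) (finals bs origin))
length-run bs = trans (↭-length (run-matching bs (here refl)))
  (trans (length-concatMap matching (finals bs origin))
    (cong sum (map-cong-local (All.map (All.lookup length-matching) (finals-reachable bs (here refl))))))

-- Inserting a last entry

raise : ℕ → ℕ → ℕ
raise v x with x <? v
... | yes _ = x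
... | no _  = suc x

raise-< : ∀ {v x} → x < v → raise v x ≡ x
raise-< {v} {x} p with x <? v
... | yes _ = refl
... | no ¬p = ⊥-elim (¬p p)

raise-≥ : ∀ {v x} → v ≤ x → raise v x ≡ suc x
raise-≥ {v} {x} p with x <? v
... | yes q = ⊥-elim (<⇒≱ q p)
... | no _ = refl

raise-mono-< : ∀ v {x y} → x < y → raise v x < raise v y
raise-mono-< v {x} {y} p with x <? v | y <? v
... | yes _ | yes _ = p
... | yes _ | no _  = m<n⇒m<1+n p
... | no ¬q | yes q = ⊥-elim (¬q (<-trans p q))
... | no _  | no _  = s<s p

raise-cancel-< : ∀ v {x y} → raise v x < raise v y → x < y
raise-cancel-< v {x} {y} p with <-cmp x y
... | tri< q _ _ = q
... | tri≈ _ refl _ = ⊥-elim (<-irrefl refl p)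
... | tri> _ _ q = ⊥-elim (<-asym p (raise-mono-< v q))

raise-injective : ∀ v {x y} → raise v x ≡ raise v y → x ≡ y
raise-injective v {x} {y} e with <-cmp x y
... | tri< q _ _ = ⊥-elim (<⇒≢ (raise-mono-< v q) e)
... | tri≈ _ q _ = q
... | tri> _ _ q = ⊥-elim (<⇒≢ (raise-mono-< v q) (sym e))

raise-≢ : ∀ v x → raise v x ≢ v
raise-≢ v x with x <? v
... | yes q = <⇒≢ q
... | no ¬q = >⇒≢ (s≤s (≮⇒≥ ¬q))

-- An insertion at `v` leaves every cut `c ≤ v` at its number and moves every cut `c ≥ v` to
-- `suc c`; the cut `v` does both. This module and the next compare values with cuts of the two
-- kinds.
module _ {v c} (c≤v : c ≤ v) where
  raise-<-low⁺ : ∀ {x} → x < c → raise v x < c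
  raise-<-low⁺ p = subst (_< c) (sym (raise-< (<-≤-trans p c≤v))) p

  raise-≥-low⁺ : ∀ {x} → c ≤ x → c ≤ raise v x
  raise-≥-low⁺ {x} p with x <? v
  ... | yes _ = p
  ... | no _ = m≤n⇒m≤1+n p

  raise-<-low⁻ : ∀ {x} → raise v x < c → x < c
  raise-<-low⁻ {x} p with x <? c
  ... | yes q = q
  ... | no ¬q = ⊥-elim (<⇒≱ p (raise-≥-low⁺ (≮⇒≥ ¬q)))

  raise-≥-low⁻ : ∀ {x} → c ≤ raise v x → c ≤ x
  raise-≥-low⁻ {x} p with x <? c
  ... | yes q = ⊥-elim (<⇒≱ (raise-<-low⁺ q) p)
  ... | no ¬q = ≮⇒≥ ¬q

module _ {v c} (v≤c : v ≤ c) where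
  raise-<-high⁺ : ∀ {x} → x < c → raise v x < suc c
  raise-<-high⁺ {x} p with x <? v
  ... | yes _ = m<n⇒m<1+n p
  ... | no _ = s<s p

  raise-≥-high⁺ : ∀ {x} → c ≤ x → suc c ≤ raise v x
  raise-≥-high⁺ p = subst (suc c ≤_) (sym (raise-≥ (≤-trans v≤c p))) (s≤s p)

  raise-<-high⁻ : ∀ {x} → raise v x < suc c → x < c
  raise-<-high⁻ {x} p with x <? c
  ... | yes q = q
  ... | no ¬q = ⊥-elim (<⇒≱ p (raise-≥-high⁺ (≮⇒≥ ¬q)))

  raise-≥-high⁻ : ∀ {x} → suc c ≤ raise v x → c ≤ x
  raise-≥-high⁻ {x} p with x <? c
  ... | yes q = ⊥-elim (<⇒≱ (raise-<-high⁺ q) p)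
  ... | no ¬q = ≮⇒≥ ¬q

Rel : ℕ → Set₁
Rel zero    = Set
Rel (suc k) = ℕ → Rel k

-- Occurrences are defined by recursion rather than through sublists, so that consing a new entry
-- splits them by computation into those that use it and those in the old entries.
Has : ∀ k → Rel k → List ℕ → Set
Has zero    R xs       = R
Has (suc k) R []       = ⊥
Has (suc k) R (x ∷ xs) = Has k (R x) xs ⊎ Has (suc k) R xs

Preserves Reflected : ∀ k → (ℕ → ℕ) → Rel k → Rel k → Set
Preserves zero    f R S = R → S
Preserves (suc k) f R S = ∀ x → Preserves k f (R x) (S (f x))
Reflected zero    f R S = S → R
Reflected (suc k) f R S = ∀ x → Reflected k f (R x) (S (f x))

has-map⁺ : ∀ k {R S} f xs → Preserves k f R S → Has k R xs → Has k S (map f xs)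
has-map⁺ zero    f xs i h = i h
has-map⁺ (suc k) f (x ∷ xs) i (inj₁ h) = inj₁ (has-map⁺ k f xs (i x) h)
has-map⁺ (suc k) f (x ∷ xs) i (inj₂ h) = inj₂ (has-map⁺ (suc k) f xs i h)

has-map⁻ : ∀ k {R S} f xs → Reflected k f R S → Has k S (map f xs) → Has k R xs
has-map⁻ zero    f xs i h = i h
has-map⁻ (suc k) f (x ∷ xs) i (inj₁ h) = inj₁ (has-map⁻ k f xs (i x) h)
has-map⁻ (suc k) f (x ∷ xs) i (inj₂ h) = inj₂ (has-map⁻ (suc k) f xs i h)

has₁⁺ : ∀ {R : Rel 1} {x xs} → x ∈ xs → R x → Has 1 R xs
has₁⁺ (here refl) r = inj₁ r
has₁⁺ (there p) r = inj₂ (has₁⁺ p r)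

has₁⁻ : ∀ {R : Rel 1} xs → Has 1 R xs → ∃ λ x → x ∈ xs × R x
has₁⁻ (x ∷ xs) (inj₁ r) = x , here refl , r
has₁⁻ (x ∷ xs) (inj₂ h) with y , y∈ , r ← has₁⁻ xs h = y , there y∈ , r

has₂⁺ : ∀ {R : Rel 2} {x y xs} → x ∈ xs → y ∈ xs → x ≢ y → R x y → R y x → Has 2 R xs
has₂⁺ (here refl) (here refl) n r s = ⊥-elim (n refl)
has₂⁺ (here refl) (there q) n r s = inj₁ (has₁⁺ q r)
has₂⁺ (there p) (here refl) n r s = inj₁ (has₁⁺ p s)
has₂⁺ (there p) (there q) n r s = inj₂ (has₂⁺ p q n r s)

has₂⁻ : ∀ {R : Rel 2} xs → Has 2 R xs → ∃ λ x → ∃ λ y → x ∈ xs × y ∈ xs × R x y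
has₂⁻ (x ∷ xs) (inj₁ h) with y , y∈ , r ← has₁⁻ xs h = x , y , here refl , there y∈ , r
has₂⁻ (x ∷ xs) (inj₂ h) with a , b , a∈ , b∈ , r ← has₂⁻ xs h = a , b , there a∈ , there b∈ , r

has₁-⊎ : ∀ {R S : Rel 1} xs → Has 1 (λ x → R x ⊎ S x) xs → Has 1 R xs ⊎ Has 1 S xs
has₁-⊎ (x ∷ xs) (inj₁ h) = Sum.map inj₁ inj₁ h
has₁-⊎ (x ∷ xs) (inj₂ h) = Sum.map inj₂ inj₂ (has₁-⊎ xs h)

has₂-⊎ : ∀ {R S : Rel 2} xs → Has 2 (λ x y → R x y ⊎ S x y) xs → Has 2 R xs ⊎ Has 2 S xs
has₂-⊎ (x ∷ xs) (inj₁ h) = Sum.map inj₁ inj₁ (has₁-⊎ xs h)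
has₂-⊎ (x ∷ xs) (inj₂ h) = Sum.map inj₂ inj₂ (has₂-⊎ xs h)

-- Permutations are kept reversed, so that inserting a new last entry is a cons
-- and the arguments of a relation are the entries of a pattern from right to left.
insert : ℕ → List ℕ → List ℕ
insert v ρ = v ∷ map (raise v) ρ

-- With `d` the last entry, the four alternatives are 1243, 1324, 3124 and 4321, each written as a
-- chain of values from smallest to largest.
pattern₄ : Rel 4
pattern₄ d c b a = (a < b × b < d × d < c) ⊎ (a < c × c < b × b < d) ⊎ (b < c × c < a × a < d) ⊎
    (d < c × c < b × b < a)

-- The three entries that complete a pattern₄ when a last entry is inserted at the cut c,
-- that is, above the entries < c and below the entries ≥ c.
forbidden : ℕ → Rel 3
forbidden c z y x = (x < y × y < c × c ≤ z) ⊎ (x < z × z < y × y < c) ⊎ (y < z × z < x × x < c) ⊎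
    (c ≤ z × z < y × y < x)

descent : ℕ → Rel 2
descent c y x = c ≤ y × y < x

ascent : ℕ → Rel 2
ascent c y x = x < y × y < c

Forbidden Descent Ascent : List ℕ → ℕ → Set
Forbidden ρ c = Has 3 (forbidden c) ρ
Descent ρ c = Has 2 (descent c) ρ
Ascent ρ c = Has 2 (ascent c) ρ

module _ (v : ℕ) where
  private
    r⁺ : ∀ {x y} → x < y → raise v x < raise v y
    r⁺ = raise-mono-< v
    r⁻ : ∀ {x y} → raise v x < raise v y → x < y
    r⁻ = raise-cancel-< v
    mono⁺ : ∀ {w x y z t u} → w < x × y < z × t < u →
      raise v w < raise v x × raise v y < raise v z × raise v t < raise v u
    mono⁺ (p , q , s) = r⁺ p , r⁺ q , r⁺ s
    mono⁻ : ∀ {w x y z t u} → raise v w < raise v x × raise v y < raise v z × raise v t < raise v u →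
      w < x × y < z × t < u
    mono⁻ (p , q , s) = r⁻ p , r⁻ q , r⁻ s

  pattern-insert⁺ : ∀ ρ → Forbidden ρ v ⊎ Has 4 pattern₄ ρ → Has 4 pattern₄ (insert v ρ)
  pattern-insert⁺ ρ (inj₁ h) = inj₁ (has-map⁺ 3 (raise v) ρ (λ z y x → λ where
    (inj₁ (a , b , c)) → inj₁ (r⁺ a , raise-<-low⁺ ≤-refl b , raise-≥-high⁺ ≤-refl c)
    (inj₂ (inj₁ (a , b , c))) → inj₂ (inj₁ (r⁺ a , r⁺ b , raise-<-low⁺ ≤-refl c))
    (inj₂ (inj₂ (inj₁ (a , b , c)))) → inj₂ (inj₂ (inj₁ (r⁺ a , r⁺ b , raise-<-low⁺ ≤-refl c)))
    (inj₂ (inj₂ (inj₂ (a , b , c)))) → inj₂ (inj₂ (inj₂ (raise-≥-high⁺ ≤-refl a , r⁺ b , r⁺ c)))) h)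
  pattern-insert⁺ ρ (inj₂ h) = inj₂ (has-map⁺ 4 (raise v) ρ (λ d c b a →
      Sum.map mono⁺ (Sum.map mono⁺ (Sum.map mono⁺ mono⁺))) h)

  pattern-insert⁻ : ∀ ρ → Has 4 pattern₄ (insert v ρ) → Forbidden ρ v ⊎ Has 4 pattern₄ ρ
  pattern-insert⁻ ρ (inj₁ h) = inj₁ (has-map⁻ 3 (raise v) ρ (λ z y x → λ where
    (inj₁ (a , b , c)) → inj₁ (r⁻ a , raise-<-low⁻ ≤-refl b , raise-≥-high⁻ ≤-refl c)
    (inj₂ (inj₁ (a , b , c))) → inj₂ (inj₁ (r⁻ a , r⁻ b , raise-<-low⁻ ≤-refl c))
    (inj₂ (inj₂ (inj₁ (a , b , c)))) → inj₂ (inj₂ (inj₁ (r⁻ a , r⁻ b , raise-<-low⁻ ≤-refl c)))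
    (inj₂ (inj₂ (inj₂ (a , b , c)))) → inj₂ (inj₂ (inj₂ (raise-≥-high⁻ ≤-refl a , r⁻ b , r⁻ c)))) h)
  pattern-insert⁻ ρ (inj₂ h) = inj₂ (has-map⁻ 4 (raise v) ρ (λ d c b a →
      Sum.map mono⁻ (Sum.map mono⁻ (Sum.map mono⁻ mono⁻))) h)

  module Low {c} (c≤v : c ≤ v) where
    private
      l⁺ : ∀ {x} → x < c → raise v x < c
      l⁺ = raise-<-low⁺ c≤v
      l⁻ : ∀ {x} → raise v x < c → x < c
      l⁻ = raise-<-low⁻ c≤v
      g⁺ : ∀ {x} → c ≤ x → c ≤ raise v x
      g⁺ = raise-≥-low⁺ c≤v
      g⁻ : ∀ {x} → c ≤ raise v x → c ≤ x
      g⁻ = raise-≥-low⁻ c≤v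

    forbidden⁺ : ∀ ρ → Forbidden ρ c ⊎ Descent ρ v ⊎ Ascent ρ c → Forbidden (insert v ρ) c
    forbidden⁺ ρ (inj₁ h) = inj₂ (has-map⁺ 3 (raise v) ρ (λ z y x →
      Sum.map (λ (p , q , s) → r⁺ p , l⁺ q , g⁺ s) (Sum.map (λ (p , q , s) → r⁺ p , r⁺ q , l⁺ s)
        (Sum.map (λ (p , q , s) → r⁺ p , r⁺ q , l⁺ s) (λ (p , q , s) → g⁺ p , r⁺ q , r⁺ s)))) h)
    forbidden⁺ ρ (inj₂ (inj₁ h)) = inj₁ (has-map⁺ 2 (raise v) ρ (λ y x (p , q) →
      inj₂ (inj₂ (inj₂ (c≤v , raise-≥-high⁺ ≤-refl p , r⁺ q)))) h)
    forbidden⁺ ρ (inj₂ (inj₂ h)) = inj₁ (has-map⁺ 2 (raise v) ρ (λ y x (p , q) →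
      inj₁ (r⁺ p , l⁺ q , c≤v)) h)

    forbidden⁻ : ∀ ρ → Forbidden (insert v ρ) c → Forbidden ρ c ⊎ Descent ρ v ⊎ Ascent ρ c
    forbidden⁻ ρ (inj₁ h) = inj₂ (has₂-⊎ ρ (has-map⁻ 2 (raise v) ρ (λ y x → λ where
      (inj₁ (p , q , s)) → inj₂ (r⁻ p , l⁻ q)
      -- In a 132 or a 312 below `c` the last entry lies below `c`, but here the last entry is `v`
      -- itself.
      (inj₂ (inj₁ (p , q , s))) → ⊥-elim (<-asym q (<-≤-trans s c≤v))
      (inj₂ (inj₂ (inj₁ (p , q , s)))) → ⊥-elim (<-asym q (<-≤-trans s c≤v))
      (inj₂ (inj₂ (inj₂ (p , q , s)))) → inj₁ (raise-≥-high⁻ ≤-refl q , r⁻ s)) h))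
    forbidden⁻ ρ (inj₂ h) = inj₁ (has-map⁻ 3 (raise v) ρ (λ z y x →
      Sum.map (λ (p , q , s) → r⁻ p , l⁻ q , g⁻ s) (Sum.map (λ (p , q , s) → r⁻ p , r⁻ q , l⁻ s)
        (Sum.map (λ (p , q , s) → r⁻ p , r⁻ q , l⁻ s) (λ (p , q , s) → g⁻ p , r⁻ q , r⁻ s)))) h)

    descent⁺ : ∀ ρ → Descent ρ c ⊎ (∃ λ x → x ∈ ρ × v ≤ x) → Descent (insert v ρ) c
    descent⁺ ρ (inj₁ h) = inj₂ (has-map⁺ 2 (raise v) ρ (λ y x (p , q) → g⁺ p , r⁺ q) h)
    descent⁺ ρ (inj₂ (x , x∈ , v≤x)) = inj₁ (has₁⁺ (∈-map⁺ (raise v) x∈) (c≤v , raise-≥-high⁺ ≤-refl v≤x))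

    descent⁻ : ∀ ρ → Descent (insert v ρ) c → Descent ρ c ⊎ (∃ λ x → x ∈ ρ × v ≤ x)
    descent⁻ ρ (inj₁ h) with y , y∈ , p , q ← has₁⁻ (map (raise v) ρ) h with x , x∈ , refl ← ∈-map⁻ (raise v) y∈ =
      inj₂ (x , x∈ , raise-≥-high⁻ ≤-refl q)
    descent⁻ ρ (inj₂ h) = inj₁ (has-map⁻ 2 (raise v) ρ (λ y x (p , q) → g⁻ p , r⁻ q) h)

    ascent⁺ : ∀ ρ → Ascent ρ c → Ascent (insert v ρ) c
    ascent⁺ ρ h = inj₂ (has-map⁺ 2 (raise v) ρ (λ y x (p , q) → r⁺ p , l⁺ q) h)

    ascent⁻ : ∀ ρ → Ascent (insert v ρ) c → Ascent ρ c
    ascent⁻ ρ (inj₁ h) with y , y∈ , p , q ← has₁⁻ (map (raise v) ρ) h = ⊥-elim (<⇒≱ q c≤v)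
    ascent⁻ ρ (inj₂ h) = has-map⁻ 2 (raise v) ρ (λ y x (p , q) → r⁻ p , l⁻ q) h

  module High {c} (v≤c : v ≤ c) where
    private
      l⁺ : ∀ {x} → x < c → raise v x < suc c
      l⁺ = raise-<-high⁺ v≤c
      l⁻ : ∀ {x} → raise v x < suc c → x < c
      l⁻ = raise-<-high⁻ v≤c
      g⁺ : ∀ {x} → c ≤ x → suc c ≤ raise v x
      g⁺ = raise-≥-high⁺ v≤c
      g⁻ : ∀ {x} → suc c ≤ raise v x → c ≤ x
      g⁻ = raise-≥-high⁻ v≤c

    Straddle : List ℕ → Set
    Straddle ρ = (∃ λ x → x ∈ ρ × x < v) × (∃ λ y → y ∈ ρ × v ≤ y × y < c)

    forbidden⁺ : ∀ ρ → Forbidden ρ c ⊎ Straddle ρ → Forbidden (insert v ρ) (suc c)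
    forbidden⁺ ρ (inj₁ h) = inj₂ (has-map⁺ 3 (raise v) ρ (λ z y x →
      Sum.map (λ (p , q , s) → r⁺ p , l⁺ q , g⁺ s) (Sum.map (λ (p , q , s) → r⁺ p , r⁺ q , l⁺ s)
        (Sum.map (λ (p , q , s) → r⁺ p , r⁺ q , l⁺ s) (λ (p , q , s) → g⁺ p , r⁺ q , r⁺ s)))) h)
    -- It is unknown which of `x` and `y` comes first: one order gives a 312 with the new entry, the
    -- other a 132, and both are forbidden.
    forbidden⁺ ρ (inj₂ ((x , x∈ , x<v) , y , y∈ , v≤y , y<c)) =
      inj₁ (has₂⁺ (∈-map⁺ (raise v) x∈) (∈-map⁺ (raise v) y∈) (λ e → <⇒≢ (<-≤-trans x<v v≤y) (raise-injective v e))
        (inj₂ (inj₂ (inj₁ (raise-<-low⁺ ≤-refl x<v , raise-≥-high⁺ ≤-refl v≤y , l⁺ y<c))))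
        (inj₂ (inj₁ (raise-<-low⁺ ≤-refl x<v , raise-≥-high⁺ ≤-refl v≤y , l⁺ y<c))))

    forbidden⁻ : ∀ ρ → Forbidden (insert v ρ) (suc c) → Forbidden ρ c ⊎ Straddle ρ
    forbidden⁻ ρ (inj₁ h) with has₂⁻ (map (raise v) ρ) h
    ... | _ , _ , a∈ , b∈ , i with x , x∈ , refl ← ∈-map⁻ (raise v) a∈ | y , y∈ , refl ← ∈-map⁻ (raise v) b∈ with i
    ... | inj₁ (p , q , s) = ⊥-elim (<⇒≱ s v≤c)
    ... | inj₂ (inj₁ (p , q , s)) = inj₂ ((y , y∈ , raise-<-low⁻ ≤-refl p) , x , x∈ , raise-≥-high⁻ ≤-refl q , l⁻ s)
    ... | inj₂ (inj₂ (inj₁ (p , q , s))) = inj₂ ((x , x∈ , raise-<-low⁻ ≤-refl p) , y , y∈ ,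
        raise-≥-high⁻ ≤-refl q , l⁻ s)
    ... | inj₂ (inj₂ (inj₂ (p , q , s))) = ⊥-elim (<⇒≱ p v≤c)
    forbidden⁻ ρ (inj₂ h) = inj₁ (has-map⁻ 3 (raise v) ρ (λ z y x →
      Sum.map (λ (p , q , s) → r⁻ p , l⁻ q , g⁻ s) (Sum.map (λ (p , q , s) → r⁻ p , r⁻ q , l⁻ s)
        (Sum.map (λ (p , q , s) → r⁻ p , r⁻ q , l⁻ s) (λ (p , q , s) → g⁻ p , r⁻ q , r⁻ s)))) h)

    descent⁺ : ∀ ρ → Descent ρ c → Descent (insert v ρ) (suc c)
    descent⁺ ρ h = inj₂ (has-map⁺ 2 (raise v) ρ (λ y x (p , q) → g⁺ p , r⁺ q) h)

    descent⁻ : ∀ ρ → Descent (insert v ρ) (suc c) → Descent ρ c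
    descent⁻ ρ (inj₁ h) with y , y∈ , p , q ← has₁⁻ (map (raise v) ρ) h = ⊥-elim (<⇒≱ p v≤c)
    descent⁻ ρ (inj₂ h) = has-map⁻ 2 (raise v) ρ (λ y x (p , q) → g⁻ p , r⁻ q) h

    ascent⁺ : ∀ ρ → Ascent ρ c ⊎ (∃ λ x → x ∈ ρ × x < v) → Ascent (insert v ρ) (suc c)
    ascent⁺ ρ (inj₁ h) = inj₂ (has-map⁺ 2 (raise v) ρ (λ y x (p , q) → r⁺ p , l⁺ q) h)
    ascent⁺ ρ (inj₂ (x , x∈ , x<v)) = inj₁ (has₁⁺ (∈-map⁺ (raise v) x∈) (raise-<-low⁺ ≤-refl x<v , s≤s v≤c))

    ascent⁻ : ∀ ρ → Ascent (insert v ρ) (suc c) → Ascent ρ c ⊎ (∃ λ x → x ∈ ρ × x < v)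
    ascent⁻ ρ (inj₁ h) with y , y∈ , p , q ← has₁⁻ (map (raise v) ρ) h with x , x∈ , refl ← ∈-map⁻ (raise v) y∈ =
      inj₂ (x , x∈ , raise-<-low⁻ ≤-refl p)
    ascent⁻ ρ (inj₂ h) = inj₁ (has-map⁻ 2 (raise v) ρ (λ y x (p , q) → r⁻ p , l⁻ q) h)

-- The sites of a permutation

-- Two blocks with a common image under `g` would have equal keys. Keys and images are separate
-- functions because the nodes of the tree are told apart by their permutations alone.
unique-concatMap : (k : A → K) (g : B → C) (f : A → List B) (xs : List A) →
  Unique (map k xs) → All (λ x → Unique (map g (f x))) xs →
  (∀ {x y b c} → x ∈ xs → y ∈ xs → b ∈ f x → c ∈ f y → g b ≡ g c → k x ≡ k y) →
  Unique (map g (concatMap f xs))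
unique-concatMap k g f [] _ _ _ = []
unique-concatMap k g f (x ∷ xs) (k∉ ∷ ks) (u ∷ us) sep =
  subst Unique (sym (map-++ g (f x) (concatMap f xs)))
    (Uniq.++⁺ u (unique-concatMap k g f xs ks us (λ p q → sep (there p) (there q))) disjoint)
  where
  disjoint : ∀ {z} → ¬ (z ∈ map g (f x) × z ∈ map g (concatMap f xs))
  disjoint (p , q) with b , b∈ , refl ← ∈-map⁻ g p | c , c∈ , e ← ∈-map⁻ g q
    with y , y∈ , c∈y ← find (∈-concatMap⁻ f {xs = xs} c∈) =
    All.lookup k∉ (∈-map⁺ k y∈) (sep (here refl) (there y∈) b∈ c∈y e)

reflects-cong : ∀ {P Q : Set} {b} → (P → Q) → (Q → P) → Reflects P b → Reflects Q b
reflects-cong f g (ofʸ p) = ofʸ (f p)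
reflects-cong f g (ofⁿ ¬p) = ofⁿ (¬p ∘ g)

reflects-true⁻ : ∀ {P : Set} {b} → Reflects P b → b ≡ true → P
reflects-true⁻ (ofʸ p) _ = p

reflects-false⁻ : ∀ {P : Set} {b} → Reflects P b → b ≡ false → ¬ P
reflects-false⁻ (ofⁿ ¬p) _ = ¬p

reflects-true⁺ : ∀ {P : Set} {b} → Reflects P b → P → b ≡ true
reflects-true⁺ (ofʸ _) _ = refl
reflects-true⁺ (ofⁿ ¬p) p = ⊥-elim (¬p p)

reflects-false⁺ : ∀ {P : Set} {b} → Reflects P b → ¬ P → b ≡ false
reflects-false⁺ (ofʸ p) ¬p = ⊥-elim (¬p p)
reflects-false⁺ (ofⁿ _) _ = refl

cut : Site ℕ → ℕ
cut = proj₁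

InRange : List ℕ → Set
InRange ρ = All (λ x → 1 ≤ x × x ≤ length ρ) ρ

-- Carried along as the permutation grows, instead of being derived by a pigeonhole argument from
-- `InRange` and uniqueness.
Full : List ℕ → Set
Full ρ = ∀ {x} → 1 ≤ x → x ≤ length ρ → x ∈ ρ

record Valid (ρ : List ℕ) (s : Site ℕ) : Set where
  constructor valid
  field
    cut≥1    : 1 ≤ cut s
    cut≤     : cut s ≤ suc (length ρ)
    allowed  : ¬ Forbidden ρ (cut s)
    reflects-first   : Reflects (cut s ≡ 1) (isFirst (proj₂ s))
    reflects-last    : Reflects (cut s ≡ suc (length ρ)) (isLast (proj₂ s))
    reflects-descent : Reflects (Descent ρ (cut s)) (hasDesc (proj₂ s))
    reflects-ascent  : Reflects (Ascent ρ (cut s)) (hasAsc (proj₂ s))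

open Valid

length-insert : ∀ v ρ → length (insert v ρ) ≡ suc (length ρ)
length-insert v ρ = cong suc (length-map (raise v) ρ)

module _ {ρ} (range : InRange ρ) (full : Full ρ) {v} (V : Valid ρ v) where
  private
    n = length ρ

    above⁺ : ∃ (λ x → x ∈ ρ × cut v ≤ x) → cut v ≢ suc n
    above⁺ (x , x∈ , p) e = <⇒≱ (≤-<-trans (proj₂ (All.lookup range x∈)) (n<1+n n)) (subst (_≤ x) e p)

    above⁻ : cut v ≢ suc n → ∃ (λ x → x ∈ ρ × cut v ≤ x)
    above⁻ ne = cut v , full (cut≥1 V) (s≤s⁻¹ (≤∧≢⇒< (cut≤ V) ne)) , ≤-refl

    below⁺ : ∃ (λ x → x ∈ ρ × x < cut v) → cut v ≢ 1
    below⁺ (x , x∈ , p) e = <⇒≱ (subst (x <_) e p) (proj₁ (All.lookup range x∈))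

    below⁻ : cut v ≢ 1 → ∃ (λ x → x ∈ ρ × x < cut v)
    below⁻ ne = 1 , full ≤-refl (s≤s⁻¹ (≤-trans 1<c (cut≤ V))) , 1<c
      where
      1<c : 1 < cut v
      1<c = ≤∧≢⇒< (cut≥1 V) (ne ∘ sym)

  valid-lowered : ∀ {s} → Valid ρ s → cut s ≤ cut v → hasDesc (proj₂ v) ≡ false → hasAsc (proj₂ s) ≡ false →
    Valid (insert (cut v) ρ) (lowered v s)
  valid-lowered {s} S s≤v ¬d ¬a = record
    { cut≥1 = cut≥1 S
    ; cut≤ = subst (cut s ≤_) (sym 1+n′) (m≤n⇒m≤1+n (cut≤ S))
    ; allowed = λ h → Sum.[ allowed S , Sum.[ reflects-false⁻ (reflects-descent V) ¬d ,
        reflects-false⁻ (reflects-ascent S) ¬a ]′ ]′ (L.forbidden⁻ ρ h)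
    ; reflects-first = reflects-first S
    ; reflects-last = ofⁿ λ e → <⇒≢ (s≤s (cut≤ S)) (trans e 1+n′)
    ; reflects-descent = reflects-cong (L.descent⁺ ρ ∘ Sum.map₂ above⁻) (Sum.map₂ above⁺ ∘ L.descent⁻ ρ)
        (reflects-descent S ⊎-reflects ¬-reflects (reflects-last V))
    ; reflects-ascent = reflects-cong (L.ascent⁺ ρ) (L.ascent⁻ ρ) (reflects-ascent S)
    }
    where
    module L = Low (cut v) s≤v
    1+n′ : suc (length (insert (cut v) ρ)) ≡ suc (suc n)
    1+n′ = cong suc (length-insert (cut v) ρ)

  allowed-lowered : ∀ {c} → c ≤ cut v → ¬ Forbidden (insert (cut v) ρ) c →
    ¬ Forbidden ρ c × hasDesc (proj₂ v) ≡ false × ¬ Ascent ρ c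
  allowed-lowered c≤v ¬f = ¬f ∘ L.forbidden⁺ ρ ∘ inj₁ ,
      reflects-false⁺ (reflects-descent V) (¬f ∘ L.forbidden⁺ ρ ∘ inj₂ ∘ inj₁) ,
      ¬f ∘ L.forbidden⁺ ρ ∘ inj₂ ∘ inj₂
    where module L = Low (cut v) c≤v

  valid-raised : ∀ {s} → Valid ρ s → cut v ≤ cut s → isFirst (proj₂ v) ≡ true ⊎ cut v ≡ cut s →
    Valid (insert (cut v) ρ) (raised suc v s)
  valid-raised {s} S v≤s near = record
    { cut≥1 = s≤s z≤n
    ; cut≤ = subst (suc (cut s) ≤_) (sym 1+n′) (s≤s (cut≤ S))
    ; allowed = λ h → Sum.[ allowed S , noStraddle ]′ (H.forbidden⁻ ρ h)
    ; reflects-first = ofⁿ λ e → <⇒≢ (cut≥1 S) (sym (suc-injective e))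
    ; reflects-last = reflects-cong (λ e → trans (cong suc e) (sym 1+n′)) (λ e → suc-injective (trans e 1+n′))
        (reflects-last S)
    ; reflects-descent = reflects-cong (H.descent⁺ ρ) (H.descent⁻ ρ) (reflects-descent S)
    ; reflects-ascent = reflects-cong (H.ascent⁺ ρ ∘ Sum.map₂ below⁻) (Sum.map₂ below⁺ ∘ H.ascent⁻ ρ)
        (reflects-ascent S ⊎-reflects ¬-reflects (reflects-first V))
    }
    where
    module H = High (cut v) v≤s
    1+n′ : suc (length (insert (cut v) ρ)) ≡ suc (suc n)
    1+n′ = cong suc (length-insert (cut v) ρ)
    noStraddle : ¬ H.Straddle ρ
    noStraddle (b , y , _ , v≤y , y<s) =
      Sum.[ below⁺ b ∘ reflects-true⁻ (reflects-first V) , (λ e → <⇒≱ y<s (subst (_≤ y) e v≤y)) ]′ near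

  -- If the new entry is neither lowest nor at `c`, the values 1 and `cut v` themselves straddle it
  -- and forbid the cut.
  allowed-raised : ∀ {c} → cut v ≤ c → c ≤ suc n → ¬ Forbidden (insert (cut v) ρ) (suc c) →
    ¬ Forbidden ρ c × (isFirst (proj₂ v) ≡ true ⊎ cut v ≡ c)
  allowed-raised {c} v≤c c≤ ¬f = ¬f ∘ H.forbidden⁺ ρ ∘ inj₁ , near
    where
    module H = High (cut v) v≤c
    near : isFirst (proj₂ v) ≡ true ⊎ cut v ≡ c
    near with cut v ≟ 1 | cut v ≟ c
    ... | yes p | _ = inj₁ (reflects-true⁺ (reflects-first V) p)
    ... | no _ | yes q = inj₂ q
    ... | no p | no q = ⊥-elim (¬f (H.forbidden⁺ ρ (inj₂
      (below⁻ p , cut v , full (cut≥1 V) (s≤s⁻¹ (<-≤-trans (≤∧≢⇒< v≤c q) c≤)) , ≤-refl , ≤∧≢⇒< v≤c q))))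

_<ᶜ_ : Site ℕ → Site ℕ → Set
s <ᶜ t = cut s < cut t

allPairs-split : ∀ {R : A → A → Set} pre {v post} → AllPairs R (pre ++ v ∷ post) →
  All (λ s → R s v) pre × All (R v) post × AllPairs R pre × AllPairs R post
allPairs-split [] (a ∷ p) = [] , a , [] , p
allPairs-split (x ∷ pre) (a ∷ p) with l , r , q , q′ ← allPairs-split pre p with a₁ , a₂ ∷ _ ← AllP.++⁻ pre a =
  a₂ ∷ l , r , a₁ ∷ q , q′

∈-picks⁻ : ∀ pre₀ (post₀ : List A) {pre v post} → (pre , v , post) ∈ picks pre₀ post₀ →
  pre ++ v ∷ post ≡ pre₀ ++ post₀ × v ∈ post₀
∈-picks⁻ pre₀ (_ ∷ post₀) (here refl) = refl , here refl
∈-picks⁻ pre₀ (x ∷ post₀) (there p) with e , v∈ ← ∈-picks⁻ (pre₀ ∷ʳ x) post₀ p =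
  trans e (++-assoc pre₀ (x ∷ []) post₀) , there v∈

∈-picks⁺ : ∀ pre₀ {post₀ : List A} {v} → v ∈ post₀ → ∃ λ pre → ∃ λ post → (pre , v , post) ∈ picks pre₀ post₀
∈-picks⁺ pre₀ {post₀} (here refl) = pre₀ , _ , here refl
∈-picks⁺ pre₀ {x ∷ _} (there p) with pre , post , q ← ∈-picks⁺ (pre₀ ∷ʳ x) p = pre , post , there q

picked : List A × A × List A → A
picked p = proj₁ (proj₂ p)

map-picked : ∀ pre (post : List A) → map picked (picks pre post) ≡ post
map-picked pre [] = refl
map-picked pre (v ∷ post) = cong (v ∷_) (map-picked (pre ∷ʳ v) post)

∈-choices⁻ : ∀ b (z : Zipper C) {pre v post} → (pre , v , post) ∈ choices b z →
  pre ++ v ∷ post ≡ proj₁ z ++ proj₂ z × (b ≡ true ⊎ v ∈ proj₂ z)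
∈-choices⁻ true (ls , rs) p = proj₁ (∈-picks⁻ [] (ls ++ rs) p) , inj₁ refl
∈-choices⁻ false (ls , rs) p with e , v∈ ← ∈-picks⁻ ls rs p = e , inj₂ v∈

∈-choices⁺ : ∀ b (z : Zipper C) {v} → v ∈ proj₁ z ++ proj₂ z → (b ≡ true ⊎ v ∈ proj₂ z) →
  ∃ λ pre → ∃ λ post → (pre , v , post) ∈ choices b z
∈-choices⁺ true (ls , rs) p _ = ∈-picks⁺ [] p
∈-choices⁺ false (ls , rs) _ (inj₂ p) = ∈-picks⁺ ls p

choices-picked-sorted : ∀ b (z : Zipper ℕ) → AllPairs _<ᶜ_ (proj₁ z ++ proj₂ z) →
    AllPairs _<ᶜ_ (map picked (choices b z))
choices-picked-sorted true (ls , rs) a = subst (AllPairs _<ᶜ_) (sym (map-picked [] (ls ++ rs))) a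
choices-picked-sorted false ([] , rs) a = subst (AllPairs _<ᶜ_) (sym (map-picked [] rs)) a
choices-picked-sorted false (_ ∷ ls , rs) (_ ∷ a) =
    subst (AllPairs _<ᶜ_) (trans (map-picked ls rs) (sym (map-picked (_ ∷ ls) rs)))
        (choices-picked-sorted false (ls , rs) a)

-- The default 0 lies below every cut, so all sites of the empty permutation count as being above
-- the last entry.
headOr0 : List ℕ → ℕ
headOr0 [] = 0
headOr0 (x ∷ _) = x

record Invariant (ρ : List ℕ) (z : Zipper ℕ) : Set where
  constructor invariant
  field
    valid-sites : All (Valid ρ) (proj₁ z ++ proj₂ z)
    sorted      : AllPairs _<ᶜ_ (proj₁ z ++ proj₂ z)
    complete    : ∀ {c} → 1 ≤ c → c ≤ suc (length ρ) → ¬ Forbidden ρ c → ∃ λ s → s ∈ proj₁ z ++ proj₂ z × cut s ≡ c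
    left        : All (λ s → cut s ≤ headOr0 ρ) (proj₁ z)
    right       : All (λ s → headOr0 ρ < cut s) (proj₂ z)

open Invariant

All-if : ∀ {P : A → Set} b {xs ys} → (b ≡ true → All P xs) → (b ≡ false → All P ys) → All P (if b then xs else ys)
All-if true f g = f refl
All-if false f g = g refl

∈-if : ∀ {b} {x : A} {xs ys} → b ≡ true → x ∈ xs → x ∈ (if b then xs else ys)
∈-if refl p = p

∈-lows : ∀ {x} pre {v : Site ℕ} → x ∈ pre ∷ʳ v → x ∈ pre ⊎ x ≡ v
∈-lows pre p with ∈-++⁻ pre p
... | inj₁ q = inj₁ q
... | inj₂ (here e) = inj₂ e

module _ {ρ} (range : InRange ρ) (full : Full ρ) {z} (I : Invariant ρ z)
         {pre v post} (e : pre ++ v ∷ post ≡ proj₁ z ++ proj₂ z) where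
  private
    valids : All (Valid ρ) (pre ++ v ∷ post)
    valids = subst (All (Valid ρ)) (sym e) (valid-sites I)
    validPre : All (Valid ρ) pre
    validPre = proj₁ (AllP.++⁻ pre valids)
    V : Valid ρ v
    V = All.head (proj₂ (AllP.++⁻ pre valids))
    validPost : All (Valid ρ) post
    validPost = All.tail (proj₂ (AllP.++⁻ pre valids))
    split = allPairs-split pre (subst (AllPairs _<ᶜ_) (sym e) (sorted I))
    pre< : All (λ s → cut s < cut v) pre
    pre< = proj₁ split
    post> : All (λ s → cut v < cut s) post
    post> = proj₁ (proj₂ split)
    sortedPre : AllPairs _<ᶜ_ pre
    sortedPre = proj₁ (proj₂ (proj₂ split))
    sortedPost : AllPairs _<ᶜ_ post
    sortedPost = proj₂ (proj₂ (proj₂ split))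

    low : ∀ {s} → s ∈ pre ∷ʳ v → Valid ρ s × cut s ≤ cut v
    low p with ∈-lows pre p
    ... | inj₁ q = All.lookup validPre q , <⇒≤ (All.lookup pre< q)
    ... | inj₂ refl = V , ≤-refl

    σ = insert (cut v) ρ

    low-all : ∀ {P : Site ℕ → Set} →
      (∀ {s} → s ∈ pre ∷ʳ v → hasDesc (proj₂ v) ≡ false → hasAsc (proj₂ s) ≡ false → P (lowered v s)) →
          All P (childLow pre v)
    low-all f = All-if (hasDesc (proj₂ v)) (λ _ → []) λ ¬d → AllP.map⁺ (All.tabulate λ s∈ →
      let s∈′ , ¬a = ∈-filter⁻ descending? {xs = pre ∷ʳ v} s∈ in f s∈′ ¬d ¬a)

    high-all : ∀ {P : Site ℕ → Set} → P (raised suc v v) →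
      (∀ {s} → s ∈ post → isFirst (proj₂ v) ≡ true → P (raised suc v s)) → All P (childHigh suc v post)
    high-all p f = p ∷ All-if (isFirst (proj₂ v)) (λ i → AllP.map⁺ (All.tabulate λ s∈ → f s∈ i)) (λ _ → [])

    sortedLow : AllPairs _<ᶜ_ (childLow pre v)
    sortedLow with hasDesc (proj₂ v)
    ... | true = []
    ... | false = AllPairsP.map⁺ (AllPairsP.filter⁺ descending?
        (AllPairsP.++⁺ sortedPre ([] ∷ []) (All.map (_∷ []) pre<)))

    sortedHigh : AllPairs _<ᶜ_ (childHigh suc v post)
    sortedHigh with isFirst (proj₂ v)
    ... | false = [] ∷ []
    ... | true = AllP.map⁺ (All.map s<s post>) ∷ AllPairsP.map⁺ (AllPairs.map s<s sortedPost)

    ∈-childLow : ∀ {s} → s ∈ pre ∷ʳ v → hasDesc (proj₂ v) ≡ false → hasAsc (proj₂ s) ≡ false →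
        lowered v s ∈ childLow pre v
    ∈-childLow s∈ ¬d ¬a rewrite ¬d = ∈-map⁺ (lowered v) (∈-filter⁺ descending? s∈ ¬a)

    ∈-childHigh : ∀ {s} → s ∈ post → isFirst (proj₂ v) ≡ true → raised suc v s ∈ childHigh suc v post
    ∈-childHigh s∈ f = there (∈-if f (∈-map⁺ (raised suc v) s∈))

    complete′ : ∀ {c} → 1 ≤ c → c ≤ suc (length σ) → ¬ Forbidden σ c → ∃ λ s →
        s ∈ childLow pre v ++ childHigh suc v post × cut s ≡ c
    -- A cut beyond the new entry is a raised one and stems from its predecessor, hence the pattern
    -- `suc c`.
    complete′ {suc c} 1≤c c≤ ¬f with suc c ≤? cut v
    ... | yes c≤v with ¬f′ , ¬d , ¬a ← allowed-lowered range full V c≤v ¬f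
                  with s , s∈ , refl ← complete I 1≤c (≤-trans c≤v (cut≤ V)) ¬f′ =
      lowered v s , ∈-++⁺ˡ (∈-childLow s∈pre ¬d (reflects-false⁺ (reflects-ascent S) ¬a)) , refl
      where
      S = All.lookup (valid-sites I) s∈
      s∈pre : s ∈ pre ∷ʳ v
      s∈pre with ∈-++⁻ pre (subst (s ∈_) (sym e) s∈)
      ... | inj₁ p = ∈-++⁺ˡ p
      ... | inj₂ (here refl) = ∈-++⁺ʳ pre (here refl)
      ... | inj₂ (there p) = ⊥-elim (<⇒≱ (All.lookup post> p) c≤v)
    ... | no c≰v with ¬f′ , near ← allowed-raised range full V (s≤s⁻¹ (≰⇒> c≰v))
        (s≤s⁻¹ (subst (λ m → suc c ≤ suc m) (length-insert (cut v) ρ) c≤)) ¬f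
                 with s , s∈ , refl ← complete I (≤-trans (cut≥1 V) (s≤s⁻¹ (≰⇒> c≰v)))
                     (s≤s⁻¹ (subst (λ m → suc c ≤ suc m) (length-insert (cut v) ρ) c≤)) ¬f′
                 with ∈-++⁻ pre (subst (s ∈_) (sym e) s∈)
    ...   | inj₁ p = ⊥-elim (<⇒≱ (All.lookup pre< p) (s≤s⁻¹ (≰⇒> c≰v)))
    ...   | inj₂ (here refl) = raised suc v v , ∈-++⁺ʳ (childLow pre v) (here refl) , refl
    ...   | inj₂ (there p) = raised suc v s , ∈-++⁺ʳ (childLow pre v) (∈-childHigh p isF) , refl
      where
      isF : isFirst (proj₂ v) ≡ true
      isF = Sum.[ id , (λ q → ⊥-elim (<⇒≢ (All.lookup post> p) q)) ]′ near

  -- The criteria for surviving an insertion are used in both directions: their sufficiency makes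
  -- the sites of the child valid, their necessity shows in `complete′` that no allowed cut is lost.
  invariant-child : Invariant σ (child suc (pre , v , post))
  invariant-child = record
    { valid-sites = AllP.++⁺
        (low-all λ s∈ ¬d ¬a → valid-lowered range full V (proj₁ (low s∈)) (proj₂ (low s∈)) ¬d ¬a)
        (high-all (valid-raised range full V V ≤-refl (inj₂ refl))
          (λ s∈ f → valid-raised range full V (All.lookup validPost s∈) (<⇒≤ (All.lookup post> s∈)) (inj₁ f)))
    ; sorted = AllPairsP.++⁺ sortedLow sortedHigh
        (low-all λ s∈ _ _ → high-all (s≤s (proj₂ (low s∈))) (λ t∈ _ →
            s≤s (≤-trans (proj₂ (low s∈)) (<⇒≤ (All.lookup post> t∈)))))
    ; complete = complete′
    ; left = low-all λ s∈ _ _ → proj₂ (low s∈)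
    ; right = high-all ≤-refl (λ s∈ _ → s≤s (<⇒≤ (All.lookup post> s∈)))
    }

  picked-valid : Valid ρ v
  picked-valid = V

rootSite : Zipper ℕ
rootSite = [] , (1 , label true true false false) ∷ []

invariant-root : Invariant [] rootSite
invariant-root = record
  { valid-sites = valid ≤-refl ≤-refl id (ofʸ refl) (ofʸ refl) (ofⁿ id) (ofⁿ id) ∷ []
  ; sorted = [] ∷ []
  ; complete = λ 1≤c c≤1 _ → _ , here refl , ≤-antisym 1≤c c≤1
  ; left = []
  ; right = ≤-refl ∷ []
  }

-- Words are reversed: y is the letter just before x.
strict : ℕ → List ℕ → Bool
strict x []      = true
strict x (y ∷ _) = y <ᵇ x

Ascending : List ℕ → List ℕ → Set
Ascending (v ∷ u ∷ ρ) (x ∷ y ∷ w) = (v < u → y < x) × Ascending (u ∷ ρ) (y ∷ w)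
Ascending _ _ = ⊤

ascending-map⁺ : ∀ v ρ w → Ascending ρ w → Ascending (map (raise v) ρ) w
ascending-map⁺ v [] w _ = tt
ascending-map⁺ v (_ ∷ []) [] _ = tt
ascending-map⁺ v (_ ∷ []) (_ ∷ _) _ = tt
ascending-map⁺ v (_ ∷ _ ∷ _) [] _ = tt
ascending-map⁺ v (_ ∷ _ ∷ _) (_ ∷ []) _ = tt
ascending-map⁺ v (a ∷ b ∷ ρ) (x ∷ y ∷ w) (f , r) = f ∘ raise-cancel-< v , ascending-map⁺ v (b ∷ ρ) (y ∷ w) r

ascending-map⁻ : ∀ v ρ w → Ascending (map (raise v) ρ) w → Ascending ρ w
ascending-map⁻ v [] w _ = tt
ascending-map⁻ v (_ ∷ []) [] _ = tt
ascending-map⁻ v (_ ∷ []) (_ ∷ _) _ = tt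
ascending-map⁻ v (_ ∷ _ ∷ _) [] _ = tt
ascending-map⁻ v (_ ∷ _ ∷ _) (_ ∷ []) _ = tt
ascending-map⁻ v (a ∷ b ∷ ρ) (x ∷ y ∷ w) (f , r) = f ∘ raise-mono-< v , ascending-map⁻ v (b ∷ ρ) (y ∷ w) r

-- The permutations grown along a word

record Admissible (w ρ : List ℕ) : Set where
  constructor admissible
  field
    same-length : length ρ ≡ length w
    in-range    : InRange ρ
    unique      : Unique ρ
    avoiding    : ¬ Has 4 pattern₄ ρ
    ascending   : Ascending ρ w

open Admissible

Node : Set
Node = List ℕ × Zipper ℕ

grown : List ℕ → List (Site ℕ) × Site ℕ × List (Site ℕ) → Node
grown ρ p = insert (cut (picked p)) ρ , child suc p

nodeStep : Bool → Node → List Node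
nodeStep b (ρ , z) = map (grown ρ) (choices b z)

grow : List ℕ → List Node
grow []      = ([] , rootSite) ∷ []
grow (x ∷ w) = concatMap (nodeStep (strict x w)) (grow w)

record Sound (w : List ℕ) (node : Node) : Set where
  field
    admissible-node : Admissible w (proj₁ node)
    full-node       : Full (proj₁ node)
    invariant-node  : Invariant (proj₁ node) (proj₂ node)

open Sound

insert-range : ∀ {v ρ} → 1 ≤ v → v ≤ suc (length ρ) → InRange ρ → InRange (insert v ρ)
insert-range {v} {ρ} 1≤v v≤ r = subst (λ m → All (λ x → 1 ≤ x × x ≤ m) (insert v ρ)) (sym (length-insert v ρ))
  ((1≤v , v≤) ∷ AllP.map⁺ (All.map (λ {x} → bound x) r))
  where
  bound : ∀ x → 1 ≤ x × x ≤ length ρ → 1 ≤ raise v x × raise v x ≤ suc (length ρ)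
  bound x (a , b) with x <? v
  ... | yes _ = a , m≤n⇒m≤1+n b
  ... | no _ = s≤s z≤n , s≤s b

insert-full : ∀ {v ρ} → 1 ≤ v → v ≤ suc (length ρ) → Full ρ → Full (insert v ρ)
insert-full {v} {ρ} 1≤v v≤ f {x} 1≤x x≤ with <-cmp x v
... | tri< p _ _ = there (subst (_∈ map (raise v) ρ) (raise-< p) (∈-map⁺ (raise v) (f 1≤x (s≤s⁻¹ (≤-trans p v≤)))))
... | tri≈ _ refl _ = here refl
insert-full {v} {ρ} 1≤v v≤ f {suc x} 1≤x x≤ | tri> _ _ q =
  there (subst (_∈ map (raise v) ρ) (raise-≥ (s≤s⁻¹ q))
      (∈-map⁺ (raise v) (f (≤-trans 1≤v (s≤s⁻¹ q)) (s≤s⁻¹ (subst (suc x ≤_) (length-insert v ρ) x≤)))))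

insert-unique : ∀ {v ρ} → Unique ρ → Unique (insert v ρ)
insert-unique {v} {ρ} u = AllP.map⁺ (All.tabulate λ {x} _ → raise-≢ v x ∘ sym) ∷ Uniq.map⁺ (raise-injective v) u

strict⁻ : ∀ {y x} → (y <ᵇ x) ≡ true → y < x
strict⁻ {y} {x} e = <ᵇ⇒< y x (subst T (sym e) tt)

ascending-insert : ∀ {v} ρ x w → length ρ ≡ length w → Ascending ρ w → (strict x w ≡ true ⊎ headOr0 ρ < v) →
  Ascending (insert v ρ) (x ∷ w)
ascending-insert [] x w l a c = tt
ascending-insert {v} (u ∷ ρ) x (y ∷ w) l a c =
  (λ p → Sum.[ strict⁻ , (λ q → ⊥-elim (<⇒≱ q (raise-≥-high⁻ ≤-refl p))) ]′ c) , ascending-map⁺ v (u ∷ ρ) (y ∷ w) a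

sound-child : ∀ {w node p} x → Sound w node → p ∈ choices (strict x w) (proj₂ node) →
    Sound (x ∷ w) (grown (proj₁ node) p)
sound-child {w} {ρ , z} {pre , v , post} x S p∈ with e , c ← ∈-choices⁻ (strict x w) z p∈ = record
  { admissible-node = record
    { same-length = trans (length-insert (cut v) ρ) (cong suc (same-length adm))
    ; in-range = insert-range (cut≥1 V) (cut≤ V) (in-range adm)
    ; unique = insert-unique (unique adm)
    ; avoiding = λ h → Sum.[ allowed V , avoiding adm ]′ (pattern-insert⁻ (cut v) ρ h)
    ; ascending = ascending-insert ρ x w (same-length adm) (ascending adm) (Sum.map₂ (All.lookup (right I)) c)
    }
  ; full-node = insert-full (cut≥1 V) (cut≤ V) (full-node S)
  ; invariant-node = invariant-child (in-range adm) (full-node S) I e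
  }
  where
  adm = admissible-node S
  I = invariant-node S
  V = picked-valid (in-range adm) (full-node S) I e

∈-concatMap-map⁻ : ∀ {f : A → List B} {g : A → B → C} xs {y} → y ∈ concatMap (λ x → map (g x) (f x)) xs →
  ∃ λ x → ∃ λ b → x ∈ xs × b ∈ f x × y ≡ g x b
∈-concatMap-map⁻ {f = f} {g} xs p with x , x∈ , q ← find (∈-concatMap⁻ (λ x → map (g x) (f x)) {xs = xs} p)
  with b , b∈ , e ← ∈-map⁻ (g x) q = x , b , x∈ , b∈ , e

grow-sound : ∀ w {node} → node ∈ grow w → Sound w node
grow-sound [] (here refl) = record
  { admissible-node = admissible refl [] [] id tt
  ; full-node = λ 1≤x x≤0 → ⊥-elim (<⇒≱ 1≤x x≤0)
  ; invariant-node = invariant-root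
  }
grow-sound (x ∷ w) n∈ with node , p , node∈ , p∈ , refl ← ∈-concatMap-map⁻ (grow w) n∈ =
  sound-child x (grow-sound w node∈) p∈

lower : ℕ → ℕ → ℕ
lower v x with x <? v
... | yes _ = x
... | no _  = pred x

raise-lower : ∀ {v x} → x ≢ v → raise v (lower v x) ≡ x
raise-lower {v} {x} ne with x <? v
... | yes p = raise-< p
raise-lower {v} {zero} ne | no ¬p = ⊥-elim (ne (sym (n≤0⇒n≡0 (≮⇒≥ ¬p))))
raise-lower {v} {suc x} ne | no ¬p = raise-≥ (s≤s⁻¹ (≤∧≢⇒< (≮⇒≥ ¬p) (ne ∘ sym)))

lower-range : ∀ {v x n} → 1 ≤ v → v ≤ suc n → x ≢ v → 1 ≤ x × x ≤ suc n → 1 ≤ lower v x × lower v x ≤ n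
lower-range {v} {x} 1≤v v≤ ne (a , b) with x <? v
... | yes p = a , s≤s⁻¹ (≤-trans p v≤)
lower-range {v} {suc x} 1≤v v≤ ne (a , b) | no ¬p = ≤-trans 1≤v (s≤s⁻¹ (≤∧≢⇒< (≮⇒≥ ¬p) (ne ∘ sym))) , s≤s⁻¹ b

-- The preimage is found by deleting the last entry and closing the gap that its value leaves.
insert-surjective : ∀ {v σ} → InRange (v ∷ σ) → Unique (v ∷ σ) →
  ∃ λ ρ → v ∷ σ ≡ insert v ρ × InRange ρ × Unique ρ × length ρ ≡ length σ
insert-surjective {v} {σ} ((1≤v , v≤) ∷ r) (v∉ ∷ u) = ρ , cong (v ∷_) σ≡ ,
    AllP.map⁺ (All.zipWith (λ (ne , q) → subst (λ m → _ × _ ≤ m) (sym (length-map (lower v) σ))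
        (lower-range 1≤v v≤ (ne ∘ sym) q)) (v∉ , r)) ,
    Uniq.map⁻ {f = raise v} (subst Unique σ≡ u) , length-map (lower v) σ
  where
  ρ = map (lower v) σ
  σ≡ : σ ≡ map (raise v) ρ
  σ≡ = trans (sym (map-id-local (All.map (λ ne → raise-lower (ne ∘ sym)) v∉))) (map-∘ σ)

admissible-insert⁻ : ∀ {v} ρ x w → length ρ ≡ length w → Ascending (insert v ρ) (x ∷ w) →
    Ascending ρ w × (strict x w ≡ true ⊎ headOr0 ρ < v ⊎ ρ ≡ [])
admissible-insert⁻ [] x w l a = tt , inj₂ (inj₂ refl)
admissible-insert⁻ {v} (u ∷ ρ) x (y ∷ w) l (f , a) = ascending-map⁻ v (u ∷ ρ) (y ∷ w) a , near
  where
  near : (y <ᵇ x) ≡ true ⊎ u < v ⊎ u ∷ ρ ≡ []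
  near with <-≤-connex u v
  ... | inj₁ p = inj₂ (inj₁ p)
  ... | inj₂ p = inj₁ (T⇒≡ (<⇒<ᵇ (f (raise-≥-high⁺ ≤-refl p))))
    where
    T⇒≡ : ∀ {b} → T b → b ≡ true
    T⇒≡ {true} _ = refl

right-of-head : ∀ {ρ z s} → Invariant ρ z → s ∈ proj₁ z ++ proj₂ z → headOr0 ρ < cut s → s ∈ proj₂ z
right-of-head {z = z} I s∈ p with ∈-++⁻ (proj₁ z) s∈
... | inj₁ q = ⊥-elim (<⇒≱ p (All.lookup (left I) q))
... | inj₂ q = q

-- An empty `ρ` forces an empty `w`, and the first letter of a word counts as strict.
strict-or-right : ∀ {c ρ} x w → strict x w ≡ true ⊎ headOr0 ρ < c ⊎ ρ ≡ [] → length ρ ≡ length w →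
  strict x w ≡ true ⊎ headOr0 ρ < c
strict-or-right x w (inj₁ p) _ = inj₁ p
strict-or-right x w (inj₂ (inj₁ p)) _ = inj₂ p
strict-or-right x [] (inj₂ (inj₂ refl)) _ = inj₁ refl

-- The permutation without its last entry is in the tree by induction. Since the whole permutation
-- avoids the patterns, the cut used is allowed and hence a site of that node; at a letter that is
-- not strict it lies above the last entry, so it is among the choices.
grow-complete : ∀ w {ρ} → Admissible w ρ → ∃ λ z → (ρ , z) ∈ grow w
grow-complete [] {[]} A = _ , here refl
grow-complete (x ∷ w) {v ∷ σ} A
  with ρ , refl , rng , unq , len ← insert-surjective (in-range A) (unique A)
  with lρ ← trans len (suc-injective (same-length A))
  with asc , c ← admissible-insert⁻ ρ x w lρ (ascending A)
  with z , z∈ ← grow-complete w (admissible lρ rng unq (avoiding A ∘ pattern-insert⁺ v ρ ∘ inj₂) asc)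
  with S ← grow-sound w z∈
  with I ← invariant-node S
  with (1≤v , v≤) ∷ _ ← in-range A
  with s , s∈ , refl ← complete I 1≤v (subst (v ≤_) (length-insert v ρ) v≤) (avoiding A ∘ pattern-insert⁺ v ρ ∘ inj₁)
  with pre , post , p∈ ← ∈-choices⁺ (strict x w) z s∈ (Sum.map₂ (right-of-head I s∈) (strict-or-right x w c lρ))
  = child suc (pre , s , post) , ∈-concatMap⁺ _ (lose z∈ (∈-map⁺ (grown ρ) p∈))

insert-injective : ∀ {v v′ ρ ρ′} → insert v ρ ≡ insert v′ ρ′ → v ≡ v′ × ρ ≡ ρ′
insert-injective {v} e with refl ← ∷-injectiveˡ e = refl , map-injective (raise-injective v) (∷-injectiveʳ e)

-- A permutation determines its parent and the cut of its last entry, so neither siblings nor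
-- children of different nodes coincide.
grow-unique : ∀ w → Unique (map proj₁ (grow w))
grow-unique [] = [] ∷ []
grow-unique (x ∷ w) = unique-concatMap proj₁ proj₁ (nodeStep (strict x w)) (grow w) (grow-unique w)
  (All.tabulate λ {node} node∈ → children-unique node (sorted (invariant-node (grow-sound w node∈))))
  λ {node} {node′} _ _ b∈ c∈ e → cross node node′ b∈ c∈ e
  where
  b = strict x w
  children-unique : ∀ node → AllPairs _<ᶜ_ (proj₁ (proj₂ node) ++ proj₂ (proj₂ node)) →
      Unique (map proj₁ (nodeStep b node))
  children-unique (ρ , z) s = subst Unique eq
    (Uniq.map⁺ (proj₁ ∘ insert-injective)
      (AllPairsP.map⁺ {f = cut} (AllPairs.map <⇒≢ (choices-picked-sorted b z s))))
    where
    eq : map (λ c → insert c ρ) (map cut (map picked (choices b z))) ≡ map proj₁ (nodeStep b (ρ , z))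
    eq = trans (cong (map _) (sym (map-∘ _))) (trans (sym (map-∘ _)) (map-∘ _))
  cross : ∀ node node′ {c d} → c ∈ nodeStep b node → d ∈ nodeStep b node′ → proj₁ c ≡ proj₁ d →
      proj₁ node ≡ proj₁ node′
  cross node node′ c∈ d∈ e with p , _ , refl ← ∈-map⁻ _ c∈ | q , _ , refl ← ∈-map⁻ _ d∈ = proj₂ (insert-injective e)

strictness : List ℕ → List Bool
strictness []      = []
strictness (x ∷ w) = strict x w ∷ strictness w

states : List Bool → List State
states = foldr (concatMap ∘ step) (root ∷ [])

forget : Zipper ℕ → State
forget = mapZipper (λ _ → tt) suc id (λ _ → refl)

grow-states : ∀ w → map (forget ∘ proj₂) (grow w) ≡ states (strictness w)
grow-states [] = refl
grow-states (x ∷ w) = begin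
  map (forget ∘ proj₂) (concatMap (nodeStep b) (grow w)) ≡⟨ map-concatMap _ (nodeStep b) (grow w) ⟩
  concatMap (map (forget ∘ proj₂) ∘ nodeStep b) (grow w) ≡⟨ concatMap-cong eq (grow w) ⟩
  concatMap (step b ∘ forget ∘ proj₂) (grow w) ≡⟨ concatMap-map (step b) (forget ∘ proj₂) (grow w) ⟨
  concatMap (step b) (map (forget ∘ proj₂) (grow w)) ≡⟨ cong (concatMap (step b)) (grow-states w) ⟩
  concatMap (step b) (states (strictness w)) ∎
  where
  open ≡-Reasoning
  b = strict x w
  eq : ∀ node → map (forget ∘ proj₂) (nodeStep b node) ≡ step b (forget (proj₂ node))
  eq (ρ , z) = trans (sym (map-∘ (choices b z))) (trans (map-∘ (choices b z))
      (map-moves (λ _ → tt) suc id (λ _ → refl) b z))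

-- `run` consumes the earliest letter first, whereas `grow` recurses on a reversed word and ends
-- with the latest; reversing the Booleans reconciles the two.
foldr-run : ∀ (next : Bool → A → List A) bs l → run next bs l ≡ foldr (concatMap ∘ next) l (reverse bs)
foldr-run next bs l = go bs []
  where
  go : ∀ bs acc → run next bs (foldr (concatMap ∘ next) l acc) ≡ foldr (concatMap ∘ next) l (bs ʳ++ acc)
  go [] acc = refl
  go (b ∷ bs) acc = go bs (b ∷ acc)

length-grow : ∀ w → length (grow w) ≡ length (run step (reverse (strictness w)) (root ∷ []))
length-grow w = begin
  length (grow w) ≡⟨ length-map (forget ∘ proj₂) (grow w) ⟨
  length (map (forget ∘ proj₂) (grow w)) ≡⟨ cong length (grow-states w) ⟩
  length (states (strictness w)) ≡⟨ cong (length ∘ states) (reverse-involutive (strictness w)) ⟨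
  length (states (reverse (reverse (strictness w))))
      ≡⟨ cong length (foldr-run step (reverse (strictness w)) (root ∷ [])) ⟨
  length (run step (reverse (strictness w)) (root ∷ [])) ∎
  where open ≡-Reasoning

-- Avoiding permutations

apply : ∀ {k} → Rel k → Vec ℕ k → Set
apply R []      = R
apply R (x ∷ v) = apply (R x) v

has⇒sublist : ∀ k {R} xs → Has k R xs → ∃ λ (v : Vec ℕ k) → toList v ⊆ xs × apply R v
has⇒sublist zero xs r = [] , minimum xs , r
has⇒sublist (suc k) (x ∷ xs) (inj₁ h) with v , s , r ← has⇒sublist k xs h = x ∷ v , refl ∷ s , r
has⇒sublist (suc k) (x ∷ xs) (inj₂ h) with v , s , r ← has⇒sublist (suc k) xs h = v , x skip s , r

sublist⇒has : ∀ {k} {R : Rel k} (v : Vec ℕ k) {xs} → toList v ⊆ xs → apply R v → Has k R xs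
sublist⇒has [] s r = r
sublist⇒has (x ∷ v) (y skip s) r = inj₂ (sublist⇒has (x ∷ v) s r)
sublist⇒has (x ∷ v) (refl ∷ s) r = inj₁ (sublist⇒has v s r)

lookup-map-cast : ∀ (f : ℕ → ℕ) xs i → .(eq : length (map f xs) ≡ length xs) →
    lookup (map f xs) i ≡ f (lookup xs (cast eq i))
lookup-map-cast f (x ∷ xs) zero eq = refl
lookup-map-cast f (x ∷ xs) (suc i) eq = lookup-map-cast f xs i (suc-injective eq)

orderIsomorphic-map : ∀ f π → (∀ {p q} → p ∈ π → q ∈ π → p < q → f p < f q) → OrderIsomorphic (map f π) π
orderIsomorphic-map f π mono = eq , λ i j → mk⇔
    (λ r → cancel (at i) (at j) (subst₂ _<_ (lookup-map-cast f π i eq) (lookup-map-cast f π j eq) r))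
    (λ r → subst₂ _<_ (sym (lookup-map-cast f π i eq)) (sym (lookup-map-cast f π j eq)) (mono (at i) (at j) r))
  where
  eq = length-map f π
  at : ∀ i → lookup π (cast eq i) ∈ π
  at i = ∈-lookup (cast eq i)
  cancel : ∀ {p q} → p ∈ π → q ∈ π → f p < f q → p < q
  cancel {p} {q} p∈ q∈ r with <-cmp p q
  ... | tri< l _ _ = l
  ... | tri≈ _ refl _ = ⊥-elim (<-irrefl refl r)
  ... | tri> _ _ g = ⊥-elim (<-asym r (mono q∈ p∈ g))

-- For increasing arguments, mapping this over a pattern gives its copy on the four values. The
-- default 0 is never reached by letters between 1 and 4.
place : ℕ → ℕ → ℕ → ℕ → ℕ → ℕ
place a b c d 1 = a
place a b c d 2 = b
place a b c d 3 = c
place a b c d 4 = d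
place a b c d _ = 0

place-mono : ∀ {a b c d} → a < b × b < c × c < d → ∀ {p q} → 1 ≤ p → q ≤ 4 → p < q → place a b c d p < place a b c d q
place-mono (r , s , t) {1} {2} _ _ _ = r
place-mono (r , s , t) {1} {3} _ _ _ = <-trans r s
place-mono (r , s , t) {1} {4} _ _ _ = <-trans r (<-trans s t)
place-mono (r , s , t) {2} {3} _ _ _ = s
place-mono (r , s , t) {2} {4} _ _ _ = <-trans s t
place-mono (r , s , t) {3} {4} _ _ _ = t
place-mono _ {suc p} {1} _ _ (s≤s ())
place-mono _ {suc (suc p)} {2} _ _ (s≤s (s≤s ()))
place-mono _ {suc (suc (suc p))} {3} _ _ (s≤s (s≤s (s≤s ())))
place-mono _ {suc (suc (suc (suc p)))} {4} _ _ (s≤s (s≤s (s≤s (s≤s ()))))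
place-mono _ {q = suc (suc (suc (suc (suc q))))} _ (s≤s (s≤s (s≤s (s≤s ())))) _

orderIsomorphic-place : ∀ {a b c d} → a < b × b < c × c < d → ∀ π → {True (All.all? (1 ≤?_) π)} →
    {True (All.all? (_≤? 4) π)} →
  OrderIsomorphic (map (place a b c d) π) π
orderIsomorphic-place r π {l} {u} = orderIsomorphic-map _ π λ p∈ q∈ →
  place-mono r (All.lookup (toWitness l) p∈) (All.lookup (toWitness u) q∈)

module _ {a b c d : ℕ} {π : List ℕ} where
  -- The entries of `π` are numerals in every use, so their comparison is decided by evaluation and
  -- `tt` suffices as evidence.
  orderIsomorphic-lookup : (iso : OrderIsomorphic (a ∷ b ∷ c ∷ d ∷ []) π) → ∀ i j →
    True (lookup π (cast (proj₁ iso) i) <? lookup π (cast (proj₁ iso) j)) →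
    lookup (a ∷ b ∷ c ∷ d ∷ []) i < lookup (a ∷ b ∷ c ∷ d ∷ []) j
  orderIsomorphic-lookup iso i j t = Equivalence.from (proj₂ iso i j) (toWitness t)

private
  pattern f0 = zero
  pattern f1 = suc zero
  pattern f2 = suc (suc zero)
  pattern f3 = suc (suc (suc zero))

reverse-sublist : ∀ {τ σ : List ℕ} → τ ⊆ σ → reverse τ ⊆ reverse σ
reverse-sublist = Sublist.reverse⁺

contains⇒pattern₄ : ∀ {σ π} → π ∈ Π₀ → Contains σ π → Has 4 pattern₄ (reverse σ)
contains⇒pattern₄ (here refl) (a ∷ b ∷ c ∷ d ∷ [] , s , iso) = sublist⇒has (d ∷ c ∷ b ∷ a ∷ []) (reverse-sublist s)
  (inj₁ (lt f0 f1 tt , lt f1 f3 tt , lt f3 f2 tt))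
  where lt = orderIsomorphic-lookup iso
contains⇒pattern₄ (there (here refl)) (a ∷ b ∷ c ∷ d ∷ [] , s , iso) =
    sublist⇒has (d ∷ c ∷ b ∷ a ∷ []) (reverse-sublist s)
  (inj₂ (inj₁ (lt f0 f2 tt , lt f2 f1 tt , lt f1 f3 tt)))
  where lt = orderIsomorphic-lookup iso
contains⇒pattern₄ (there (there (here refl))) (a ∷ b ∷ c ∷ d ∷ [] , s , iso) =
    sublist⇒has (d ∷ c ∷ b ∷ a ∷ []) (reverse-sublist s)
  (inj₂ (inj₂ (inj₁ (lt f1 f2 tt , lt f2 f0 tt , lt f0 f3 tt))))
  where lt = orderIsomorphic-lookup iso
contains⇒pattern₄ (there (there (there (here refl)))) (a ∷ b ∷ c ∷ d ∷ [] , s , iso) =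
    sublist⇒has (d ∷ c ∷ b ∷ a ∷ []) (reverse-sublist s)
  (inj₂ (inj₂ (inj₂ (lt f3 f2 tt , lt f2 f1 tt , lt f1 f0 tt))))
  where lt = orderIsomorphic-lookup iso

-- Each alternative is a chain of increasing values, which is just the hypothesis of
-- `orderIsomorphic-place`; mapping `place` over the pattern puts the values back into the order of
-- the sublist.
pattern₄⇒contains : ∀ {σ} → Has 4 pattern₄ (reverse σ) → ∃ λ π → π ∈ Π₀ × Contains σ π
pattern₄⇒contains {σ} h with d ∷ c ∷ b ∷ a ∷ [] , s , r ← has⇒sublist 4 (reverse σ) h
  with s′ ← subst ((a ∷ b ∷ c ∷ d ∷ []) ⊆_) (reverse-involutive σ) (reverse-sublist s) with r
... | inj₁ q = _ , here refl , _ , s′ , orderIsomorphic-place q (1 ∷ 2 ∷ 4 ∷ 3 ∷ [])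
... | inj₂ (inj₁ q) = _ , there (here refl) , _ , s′ , orderIsomorphic-place q (1 ∷ 3 ∷ 2 ∷ 4 ∷ [])
... | inj₂ (inj₂ (inj₁ q)) = _ , there (there (here refl)) , _ , s′ , orderIsomorphic-place q (3 ∷ 1 ∷ 2 ∷ 4 ∷ [])
... | inj₂ (inj₂ (inj₂ q)) = _ , there (there (there (here refl))) , _ , s′ ,
    orderIsomorphic-place q (4 ∷ 3 ∷ 2 ∷ 1 ∷ [])

avoids⇒¬pattern₄ : ∀ {σ} → Avoids Π₀ σ → ¬ Has 4 pattern₄ (reverse σ)
avoids⇒¬pattern₄ {σ} a h with π , π∈ , c ← pattern₄⇒contains {σ} h = All.lookup a π∈ c

¬pattern₄⇒avoids : ∀ {σ} → ¬ Has 4 pattern₄ (reverse σ) → Avoids Π₀ σ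
¬pattern₄⇒avoids ¬h = All.tabulate λ π∈ → ¬h ∘ contains⇒pattern₄ π∈

AscendingForward : List ℕ → List ℕ → Set
AscendingForward (a ∷ b ∷ σ) (x ∷ y ∷ w) = (b < a → x < y) × AscendingForward (b ∷ σ) (y ∷ w)
AscendingForward _ _ = ⊤

-- Reversal with an accumulator. The entry `a` and the letter `x` sit at the junction, so that the
-- comparison with the next entry passes from the forward condition to the reversed one.
ascending-ʳ++⁺ : ∀ {a x} ρ v σ w → length σ ≡ length w → Ascending (a ∷ ρ) (x ∷ v) →
    AscendingForward (a ∷ σ) (x ∷ w) →
  Ascending (σ ʳ++ a ∷ ρ) (w ʳ++ x ∷ v)
ascending-ʳ++⁺ ρ v [] [] _ p _ = p
ascending-ʳ++⁺ ρ v (b ∷ σ) (y ∷ w) e p (q , r) = ascending-ʳ++⁺ _ _ σ w (suc-injective e) (q , p) r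

ascending-ʳ++⁻ : ∀ {a x} ρ v σ w → length σ ≡ length w → Ascending (σ ʳ++ a ∷ ρ) (w ʳ++ x ∷ v) →
  Ascending (a ∷ ρ) (x ∷ v) × AscendingForward (a ∷ σ) (x ∷ w)
ascending-ʳ++⁻ ρ v [] [] _ p = p , tt
ascending-ʳ++⁻ ρ v (b ∷ σ) (y ∷ w) e h with (q , p) , r ← ascending-ʳ++⁻ _ _ σ w (suc-injective e) h = p , q , r

ascending-reverse⁺ : ∀ σ w → length σ ≡ length w → AscendingForward σ w → Ascending (reverse σ) (reverse w)
ascending-reverse⁺ [] [] _ _ = tt
ascending-reverse⁺ (a ∷ σ) (x ∷ w) e p = ascending-ʳ++⁺ [] [] σ w (suc-injective e) tt p

ascending-reverse⁻ : ∀ σ w → length σ ≡ length w → Ascending (reverse σ) (reverse w) → AscendingForward σ w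
ascending-reverse⁻ [] [] _ _ = tt
ascending-reverse⁻ (a ∷ σ) (x ∷ w) e p = proj₂ (ascending-ʳ++⁻ [] [] σ w (suc-injective e) p)

AscendingAt : List ℕ → List ℕ → Set
AscendingAt σ w = ∀ {i} → 1 ≤ i → i ≤ length σ ∸ 1 → σ ! i > σ ! suc i → w ! i < w ! suc i

ascendingAt⇒forward : ∀ σ w → AscendingAt σ w → AscendingForward σ w
ascendingAt⇒forward [] w h = tt
ascendingAt⇒forward (_ ∷ []) [] h = tt
ascendingAt⇒forward (_ ∷ []) (_ ∷ _) h = tt
ascendingAt⇒forward (_ ∷ _ ∷ _) [] h = tt
ascendingAt⇒forward (_ ∷ _ ∷ _) (_ ∷ []) h = tt
ascendingAt⇒forward (a ∷ b ∷ σ) (x ∷ y ∷ w) h = h {1} ≤-refl (s≤s z≤n) ,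
    ascendingAt⇒forward (b ∷ σ) (y ∷ w) shifted
  where
  shifted : AscendingAt (b ∷ σ) (y ∷ w)
  shifted {suc i} _ q = h {suc (suc i)} (s≤s z≤n) (s≤s q)

forward⇒ascendingAt : ∀ σ w → length σ ≡ length w → AscendingForward σ w → AscendingAt σ w
forward⇒ascendingAt (a ∷ b ∷ σ) (x ∷ y ∷ w) e (p , q) {1} _ _ = p
forward⇒ascendingAt (a ∷ b ∷ σ) (x ∷ y ∷ w) e (p , q) {suc (suc i)} _ l =
    forward⇒ascendingAt (b ∷ σ) (y ∷ w) (suc-injective e) q (s≤s z≤n) (s≤s⁻¹ l)
forward⇒ascendingAt [] w e h 1≤i i≤0 = ⊥-elim (<⇒≱ 1≤i i≤0)
forward⇒ascendingAt (_ ∷ []) w e h 1≤i i≤0 = ⊥-elim (<⇒≱ 1≤i i≤0)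

compatible⇒ascending : ∀ σ w → length σ ≡ length w → Compatible (Des σ) w → Ascending (reverse σ) (reverse w)
compatible⇒ascending σ w e (_ , a) = ascending-reverse⁺ σ w e (ascendingAt⇒forward σ w λ p q r →
  All.lookup a (∈-filter⁺ (λ i → σ ! i >? σ ! suc i) (∈[1…]⁺ p q) r))

ascending⇒compatible : ∀ σ w → length σ ≡ length w → Increasing w → Ascending (reverse σ) (reverse w) →
    Compatible (Des σ) w
ascending⇒compatible σ w e inc a = inc , All.tabulate λ i∈ →
  let i∈′ , r = ∈-filter⁻ (λ i → σ ! i >? σ ! suc i) {xs = [1… length σ ∸ 1 ]} i∈
      p , q = ∈[1…]⁻ i∈′
  in forward⇒ascendingAt σ w e (ascending-reverse⁻ σ w e a) p q r

unique-resp-↭ : ∀ {xs ys : List ℕ} → xs ↭ ys → Unique xs → Unique ys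
unique-resp-↭ p = PermS.Unique-resp-↭ (setoid ℕ) (↭⇒↭ₛ p)

compatiblePerms : ℕ → List ℕ → List (List ℕ)
compatiblePerms n w = filter (λ σ → compatible? (Des σ) w) (𝔖-avoiding n Π₀)

module _ {n} {w : List ℕ} (length-w : length w ≡ n) (inc : Increasing w) where

  ∈-compatiblePerms⁻ : ∀ {σ} → σ ∈ compatiblePerms n w → Admissible (reverse w) (reverse σ)
  ∈-compatiblePerms⁻ {σ} p
    with p₁ , comp ← ∈-filter⁻ (λ σ → compatible? (Des σ) w) {xs = 𝔖-avoiding n Π₀} p
    with p₂ , av ← ∈-filter⁻ (avoids? Π₀) {xs = 𝔖 n} p₁
    with p₃ , unq ← ∈-filter⁻ unique? {xs = words [1… n ] n} p₂
    with len , letters ← ∈-words⁻ n p₃ = record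
      { same-length = trans (length-reverse σ) (trans len (trans (sym length-w) (sym (length-reverse w))))
      ; in-range = All-resp-↭ (↭-sym (↭-reverse σ)) (All.map (λ {x} x∈ → subst (λ m → 1 ≤ x × x ≤ m)
          (sym (trans (length-reverse σ) len)) (∈[1…]⁻ x∈)) letters)
      ; unique = unique-resp-↭ (↭-sym (↭-reverse σ)) unq
      ; avoiding = avoids⇒¬pattern₄ {σ} av
      ; ascending = compatible⇒ascending σ w (trans len (sym length-w)) comp
      }

  ∈-compatiblePerms⁺ : ∀ {ρ} → Admissible (reverse w) ρ → reverse ρ ∈ compatiblePerms n w
  ∈-compatiblePerms⁺ {ρ} A =
    ∈-filter⁺ (λ σ → compatible? (Des σ) w)
      (∈-filter⁺ (avoids? Π₀)
        (∈-filter⁺ unique?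
          (∈-words⁺ n len (All.map (λ {x} (p , q) → ∈[1…]⁺ p (subst (x ≤_) lenρ q))
              (All-resp-↭ (↭-sym (↭-reverse ρ)) (in-range A))))
          (unique-resp-↭ (↭-sym (↭-reverse ρ)) (unique A)))
        (¬pattern₄⇒avoids {reverse ρ} (subst (λ z → ¬ Has 4 pattern₄ z) (sym (reverse-involutive ρ)) (avoiding A))))
      (ascending⇒compatible (reverse ρ) w (trans len (sym length-w)) inc
        (subst (λ z → Ascending z (reverse w)) (sym (reverse-involutive ρ)) (ascending A)))
    where
    open Admissible
    lenρ : length ρ ≡ n
    lenρ = trans (same-length A) (trans (length-reverse w) length-w)
    len : length (reverse ρ) ≡ n
    len = trans (length-reverse ρ) lenρ

  compatiblePerms-unique : Unique (compatiblePerms n w)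
  compatiblePerms-unique = Uniq.filter⁺ _ (Uniq.filter⁺ _ (Uniq.filter⁺ _ (words-unique n ([1…]-unique n))))

  length-compatiblePerms : length (compatiblePerms n w) ≡ length (grow (reverse w))
  length-compatiblePerms = begin
    length (compatiblePerms n w) ≡⟨ ↭-length (unique-set-↭ compatiblePerms-unique
        (Uniq.map⁺ reverse-injective (grow-unique (reverse w))) to from) ⟩
    length (map reverse (map proj₁ (grow (reverse w))))
        ≡⟨ trans (length-map reverse (map proj₁ (grow (reverse w)))) (length-map proj₁ (grow (reverse w))) ⟩
    length (grow (reverse w)) ∎
    where
    open ≡-Reasoning
    to : ∀ {σ} → σ ∈ compatiblePerms n w → σ ∈ map reverse (map proj₁ (grow (reverse w)))
    to {σ} p with z , q ← grow-complete (reverse w) (∈-compatiblePerms⁻ p) =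
      subst (_∈ _) (reverse-involutive σ) (∈-map⁺ reverse (∈-map⁺ proj₁ q))
    from : ∀ {σ} → σ ∈ map reverse (map proj₁ (grow (reverse w))) → σ ∈ compatiblePerms n w
    from p with ρ , q , refl ← ∈-map⁻ reverse p with node , r , refl ← ∈-map⁻ proj₁ q =
      ∈-compatiblePerms⁺ (Sound.admissible-node (grow-sound (reverse w) r))

-- Tableaux

Rows : Set
Rows = List ℕ × List ℕ × List ℕ

row : Row → Rows → List ℕ
row top    (r₁ , r₂ , r₃) = r₁
row middle (r₁ , r₂ , r₃) = r₂
row bottom (r₁ , r₂ , r₃) = r₃

prepend : Row → ℕ → Rows → Rows
prepend top    y (r₁ , r₂ , r₃) = y ∷ r₁ , r₂ , r₃
prepend middle y (r₁ , r₂ , r₃) = r₁ , y ∷ r₂ , r₃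
prepend bottom y (r₁ , r₂ , r₃) = r₁ , r₂ , y ∷ r₃

prepend-injective : ∀ q {y U V} → prepend q y U ≡ prepend q y V → U ≡ V
prepend-injective top refl = refl
prepend-injective middle refl = refl
prepend-injective bottom refl = refl

-- The remaining rows of all tableaux whose first letters acc, read backwards, have
-- been placed in the order in which standardisation numbers them.
tabs : List ℕ → List ℕ → RowState → List (Rows × RowState)
extend : ℕ → List ℕ → List ℕ → RowState → Row → List (Rows × RowState)
tabs acc []      x = (([] , [] , []) , x) ∷ []
tabs acc (y ∷ w) x = concatMap (extend y acc w x) (openRows (strict y acc) x)
extend y acc w x q = map (λ (U , z) → prepend q y U , z) (tabs (y ∷ acc) w (push x q))

total : ℕ → Rows → ℕ
total i (r₁ , r₂ , r₃) = multiplicity i r₁ + (multiplicity i r₂ + multiplicity i r₃)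

multiplicity-∷ : ∀ i y w → multiplicity i (y ∷ w) ≡ multiplicity i (y ∷ []) + multiplicity i w
multiplicity-∷ i y w = multiplicity-++ i (y ∷ []) w

total-prepend : ∀ q i y U → total i (prepend q y U) ≡ multiplicity i (y ∷ []) + total i U
total-prepend top i y (r₁ , r₂ , r₃) = trans (cong (_+ (multiplicity i r₂ + multiplicity i r₃))
    (multiplicity-∷ i y r₁))
  (+-assoc (multiplicity i (y ∷ [])) (multiplicity i r₁) (multiplicity i r₂ + multiplicity i r₃))
total-prepend middle i y (r₁ , r₂ , r₃) = trans
  (cong (multiplicity i r₁ +_) (trans (cong (_+ multiplicity i r₃) (multiplicity-∷ i y r₂))
    (+-assoc (multiplicity i (y ∷ [])) (multiplicity i r₂) (multiplicity i r₃))))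
  (x∙yz≈y∙xz (multiplicity i r₁) (multiplicity i (y ∷ [])) (multiplicity i r₂ + multiplicity i r₃))
total-prepend bottom i y (r₁ , r₂ , r₃) = trans
  (cong (multiplicity i r₁ +_) (trans (cong (multiplicity i r₂ +_) (multiplicity-∷ i y r₃))
    (x∙yz≈y∙xz (multiplicity i r₂) (multiplicity i (y ∷ [])) (multiplicity i r₃))))
  (x∙yz≈y∙xz (multiplicity i r₁) (multiplicity i (y ∷ [])) (multiplicity i r₂ + multiplicity i r₃))

∈-row⇒total>0 : ∀ q {i} U → i ∈ row q U → 0 < total i U
∈-row⇒total>0 top (r₁ , r₂ , r₃) p = m≤n⇒m≤n+o _ (∈⇒multiplicity>0 p)
∈-row⇒total>0 middle {i} (r₁ , r₂ , r₃) p = <-≤-trans (m≤n⇒m≤n+o _ (∈⇒multiplicity>0 p)) (m≤n+m _ (multiplicity i r₁))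
∈-row⇒total>0 bottom {i} (r₁ , r₂ , r₃) p = <-≤-trans (∈⇒multiplicity>0 p)
    (≤-trans (m≤n+m _ (multiplicity i r₂)) (m≤n+m _ (multiplicity i r₁)))

total>0⇒∈-row : ∀ {i} U → 0 < total i U → i ∈ row top U ⊎ i ∈ row middle U ⊎ i ∈ row bottom U
total>0⇒∈-row {i} (r₁ , r₂ , r₃) p with i ∈? r₁ | i ∈? r₂ | i ∈? r₃
... | yes q | _ | _ = inj₁ q
... | no _ | yes q | _ = inj₂ (inj₁ q)
... | no _ | no _ | yes q = inj₂ (inj₂ q)
... | no a | no b | no c = ⊥-elim (<⇒≢ p (sym (cong₂ _+_ (∉⇒multiplicity≡0 r₁ a)
    (cong₂ _+_ (∉⇒multiplicity≡0 r₂ b) (∉⇒multiplicity≡0 r₃ c)))))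

-- The lower row starts d columns to the left of the upper row.
Above : ℕ → List ℕ → List ℕ → Set
Above d upper lower = Prefix _>_ (drop d lower) upper

-- The entry of `lower` that comes to stand under `y`, if there is one, is at least `y` and differs
-- from it.
above-suc⁺ : ∀ d {y upper} lower → y ∉ lower → All (y ≤_) lower → Above (suc d) upper lower →
    Above d (y ∷ upper) lower
above-suc⁺ zero [] _ _ p = []
above-suc⁺ zero (x ∷ lower) y∉ (y≤x ∷ _) p = ≤∧≢⇒< y≤x (y∉ ∘ here) ∷ p
above-suc⁺ (suc d) [] _ _ p = []
above-suc⁺ (suc d) (x ∷ lower) y∉ (_ ∷ a) p = above-suc⁺ d lower (y∉ ∘ there) a p

above-suc⁻ : ∀ d {y upper} lower → Above d (y ∷ upper) lower → Above (suc d) upper lower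
above-suc⁻ zero [] p = []
above-suc⁻ zero (x ∷ lower) (_ ∷ p) = p
above-suc⁻ (suc d) [] p = []
above-suc⁻ (suc d) (x ∷ lower) p = above-suc⁻ d lower p

above-long : ∀ d {upper} lower → length lower ≤ d → Above d upper lower
above-long d {upper} lower l = subst (λ z → Prefix _>_ z upper) (sym (drop-all d lower l)) []

¬above-zero : ∀ {y upper lower} → All (y ≤_) upper → ¬ Above 0 upper (y ∷ lower)
¬above-zero (p ∷ _) (q ∷ _) = <⇒≱ q p

record WellFormed (x : RowState) : Set where
  constructor wellFormed
  field
    m₃≤m₂ : proj₁ (proj₂ (proj₂ x)) ≤ proj₁ (proj₂ x)
    m₂≤m₁ : proj₁ (proj₂ x) ≤ proj₁ x
    m₁≤2  : proj₁ x ≤ 2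

push-wellFormed : ∀ {b} x q → Open b x q → WellFormed x → WellFormed (push x q)
push-wellFormed x top o (wellFormed a b c) = wellFormed a (⊓-glb (m≤n⇒m≤1+n b) (≤-trans b c)) (m⊓n≤n _ 2)
push-wellFormed x middle (p , _) (wellFormed a b c) = wellFormed (m≤n⇒m≤1+n a) p c
push-wellFormed x bottom (p , _) (wellFormed a b c) = wellFormed p b c

-- The order of standardisation, expressed on the letters still to come: after `p` has been placed
-- in row `r`, no further `p` may go to a lower row. Rows are numbered from 0.
Tie : List ℕ → ℕ → Rows → Set
Tie []      r U              = ⊤
Tie (p ∷ _) r (r₁ , r₂ , r₃) = (r < 1 → p ∉ r₂) × (r < 2 → p ∉ r₃)

Continues : List ℕ → List ℕ → Set
Continues []      w = Increasing w
Continues (p ∷ _) w = Increasing (p ∷ w)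

-- A description of the remaining rows that does not refer to the order of placement; by `tabs-good`
-- and `good-tabs` it singles out exactly what `tabs` lists. The offsets are differences of the
-- lengths already placed, with the first row capped.
record Good (acc w : List ℕ) (x : RowState) (U : Rows) : Set where
  constructor good
  field
    increasing : ∀ q → Increasing (row q U)
    totals     : ∀ i → total i U ≡ multiplicity i w
    above₁₂    : Above (proj₁ x ∸ proj₁ (proj₂ x)) (row top U) (row middle U)
    above₂₃    : Above (proj₁ (proj₂ x) ∸ proj₁ (proj₂ (proj₂ x))) (row middle U) (row bottom U)
    short      : proj₁ (proj₂ x) + length (row middle U) ≤ 2
    tie        : Tie acc (proj₂ (proj₂ (proj₂ x))) U

continues-∷ : ∀ acc {y w} → Continues acc (y ∷ w) → Increasing (y ∷ w)
continues-∷ [] c = c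
continues-∷ (p ∷ _) c = Linked.tail c

letters-≥ : ∀ {y w U} → Increasing (y ∷ w) → (∀ i → total i U ≡ multiplicity i w) → ∀ q → All (y ≤_) (row q U)
letters-≥ {y} {w} {U} inc t q = All.tabulate λ {i} i∈ →
  increasing-head-∈ inc (there (multiplicity>0⇒∈ w (subst (0 <_) (t i) (∈-row⇒total>0 q U i∈))))

letters-≥′ : ∀ {y w U} → Increasing (y ∷ w) → (∀ i → total i U ≡ multiplicity i (y ∷ w)) → ∀ q → All (y ≤_) (row q U)
letters-≥′ {y} {w} {U} inc t q = All.tabulate λ {i} i∈ →
  increasing-head-∈ inc (multiplicity>0⇒∈ (y ∷ w) (subst (0 <_) (t i) (∈-row⇒total>0 q U i∈)))

-- If `p < y`, then `p` no longer occurs at all, the remaining letters being at least `y`. If `p`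
-- equals `y`, the step is not strict, and openness says that the chosen row is not below row `r`.
tie-prepend : ∀ acc {y w x} q U → Open (strict y acc) x q → Continues acc (y ∷ w) →
  (∀ q′ → All (y ≤_) (row q′ U)) → Tie (y ∷ acc) (proj₂ (proj₂ (proj₂ (push x q)))) U →
      Tie acc (proj₂ (proj₂ (proj₂ x))) (prepend q y U)
tie-prepend [] q U o c ≥y t = tt
tie-prepend (p ∷ acc) {y} q U o c ≥y t with p <? y
... | yes p<y = notIn middle , notIn bottom
  where
  rows-≥ : ∀ q q′ U → (∀ q′ → All (y ≤_) (row q′ U)) → All (y ≤_) (row q′ (prepend q y U))
  rows-≥ top top U a = ≤-refl ∷ a top
  rows-≥ top middle U a = a middle
  rows-≥ top bottom U a = a bottom
  rows-≥ middle top U a = a top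
  rows-≥ middle middle U a = ≤-refl ∷ a middle
  rows-≥ middle bottom U a = a bottom
  rows-≥ bottom top U a = a top
  rows-≥ bottom middle U a = a middle
  rows-≥ bottom bottom U a = ≤-refl ∷ a bottom
  notIn : ∀ q′ {A : Set} → A → p ∉ row q′ (prepend q y U)
  notIn q′ _ p∈ = <⇒≱ p<y (All.lookup (rows-≥ q q′ U ≥y) p∈)
... | no p≮y with refl ← ≤-antisym (Linked.head c) (≮⇒≥ p≮y) = same q o t
  where
  same : ∀ {r m₁ m₂ m₃} q → Open (y <ᵇ y) (m₁ , m₂ , m₃ , r) q →
      Tie (y ∷ acc) (proj₂ (proj₂ (proj₂ (push (m₁ , m₂ , m₃ , r) q)))) U →
    Tie (y ∷ acc) r (prepend q y U)
  same top _ (t₂ , t₃) = (λ _ → t₂ (s≤s z≤n)) , (λ _ → t₃ (s≤s z≤n))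
  same middle (_ , _ , inj₁ b) _ = ⊥-elim (<-irrefl refl (<ᵇ⇒< y y b))
  same middle (_ , _ , inj₂ r≥1) (_ , t₃) = (λ r<1 → ⊥-elim (<⇒≱ r<1 r≥1)) , (λ _ → t₃ ≤-refl)
  same bottom (_ , inj₁ b) _ = ⊥-elim (<-irrefl refl (<ᵇ⇒< y y b))
  same bottom (_ , inj₂ r≥2) _ = (λ r<1 → ⊥-elim (<⇒≱ (m<n⇒m<1+n r<1) r≥2)) , (λ r<2 → ⊥-elim (<⇒≱ r<2 r≥2))

increasing-prepend : ∀ q {y U} → (∀ q′ → All (y ≤_) (row q′ U)) → (∀ q′ → Increasing (row q′ U)) → ∀ q′ →
    Increasing (row q′ (prepend q y U))
increasing-prepend top a i top = increasing-∷ (a top) (i top)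
increasing-prepend top a i middle = i middle
increasing-prepend top a i bottom = i bottom
increasing-prepend middle a i top = i top
increasing-prepend middle a i middle = increasing-∷ (a middle) (i middle)
increasing-prepend middle a i bottom = i bottom
increasing-prepend bottom a i top = i top
increasing-prepend bottom a i middle = i middle
increasing-prepend bottom a i bottom = increasing-∷ (a bottom) (i bottom)

suc-∸ : ∀ {m n} → n < m → m ∸ n ≡ suc (m ∸ suc n)
suc-∸ {suc m} {n} (s≤s p) = +-∸-assoc 1 p

length≤∸ : ∀ m (xs : List ℕ) → m + length xs ≤ 2 → length xs ≤ 2 ∸ m
length≤∸ m xs p = m+n≤o⇒m≤o∸n (length xs) (subst (_≤ 2) (+-comm m (length xs)) p)

-- Capping λ₁ at 2 loses nothing because the middle row has at most two boxes.
above-push⁺ : ∀ {m₁ m₂ y upper} lower → m₂ ≤ m₁ → m₁ ≤ 2 → m₂ + length lower ≤ 2 → y ∉ lower → All (y ≤_) lower →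
  Above (suc m₁ ⊓ 2 ∸ m₂) upper lower → Above (m₁ ∸ m₂) (y ∷ upper) lower
above-push⁺ {m₁} {m₂} {upper = upper} lower m₂≤m₁ m₁≤2 l y∉ a p with m≤n⇒m<n∨m≡n m₁≤2
... | inj₂ refl = above-long (2 ∸ m₂) lower (length≤∸ m₂ lower l)
... | inj₁ m₁<2 = above-suc⁺ (m₁ ∸ m₂) lower y∉ a (subst (λ d → Above d upper lower)
    (trans (cong (_∸ m₂) (m≤n⇒m⊓n≡m m₁<2)) (+-∸-assoc 1 m₂≤m₁)) p)

above-push⁻ : ∀ {m₁ m₂ y upper} lower → m₂ ≤ m₁ → m₁ ≤ 2 → m₂ + length lower ≤ 2 →
  Above (m₁ ∸ m₂) (y ∷ upper) lower → Above (suc m₁ ⊓ 2 ∸ m₂) upper lower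
above-push⁻ {m₁} {m₂} {upper = upper} lower m₂≤m₁ m₁≤2 l p with m≤n⇒m<n∨m≡n m₁≤2
... | inj₂ refl = above-long (2 ∸ m₂) lower (length≤∸ m₂ lower l)
... | inj₁ m₁<2 = subst (λ d → Above d upper lower)
    (sym (trans (cong (_∸ m₂) (m≤n⇒m⊓n≡m m₁<2)) (+-∸-assoc 1 m₂≤m₁))) (above-suc⁻ (m₁ ∸ m₂) lower p)

good-prepend : ∀ {acc y w x U} q → WellFormed x → Continues acc (y ∷ w) → Open (strict y acc) x q →
  Good (y ∷ acc) w (push x q) U → Good acc (y ∷ w) x (prepend q y U)
good-prepend {acc} {y} {w} {x} {U} q W c o G = record
  { increasing = increasing-prepend q ≥y (Good.increasing G)
  ; totals = λ i → trans (total-prepend q i y U) (trans (cong (multiplicity i (y ∷ []) +_) (Good.totals G i))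
      (sym (multiplicity-∷ i y w)))
  ; above₁₂ = a₁₂ q o G
  ; above₂₃ = a₂₃ q o G
  ; short = sh q G
  ; tie = tie-prepend acc q U o c ≥y (Good.tie G)
  }
  where
  open WellFormed W
  ≥y : ∀ q′ → All (y ≤_) (row q′ U)
  ≥y = letters-≥ (continues-∷ acc c) (Good.totals G)
  a₁₂ : ∀ q → Open (strict y acc) x q → Good (y ∷ acc) w (push x q) U →
    Above (proj₁ x ∸ proj₁ (proj₂ x)) (row top (prepend q y U)) (row middle (prepend q y U))
  a₁₂ top o G = above-push⁺ (row middle U) m₂≤m₁ m₁≤2 (Good.short G) (proj₁ (Good.tie G) (s≤s z≤n)) (≥y middle)
      (Good.above₁₂ G)
  a₁₂ middle (p , _) G rewrite suc-∸ p = Good.above₁₂ G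
  a₁₂ bottom o G = Good.above₁₂ G
  a₂₃ : ∀ q → Open (strict y acc) x q → Good (y ∷ acc) w (push x q) U →
    Above (proj₁ (proj₂ x) ∸ proj₁ (proj₂ (proj₂ x))) (row middle (prepend q y U)) (row bottom (prepend q y U))
  a₂₃ top o G = Good.above₂₃ G
  a₂₃ middle o G = above-suc⁺ (proj₁ (proj₂ x) ∸ proj₁ (proj₂ (proj₂ x))) (row bottom U)
      (proj₂ (Good.tie G) ≤-refl) (≥y bottom)
    (subst (λ d → Above d (row middle U) (row bottom U)) (+-∸-assoc 1 m₃≤m₂) (Good.above₂₃ G))
  a₂₃ bottom (p , _) G rewrite suc-∸ p = Good.above₂₃ G
  sh : ∀ q → Good (y ∷ acc) w (push x q) U → proj₁ (proj₂ x) + length (row middle (prepend q y U)) ≤ 2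
  sh top G = Good.short G
  sh middle G = subst (_≤ 2) (sym (+-suc (proj₁ (proj₂ x)) _)) (Good.short G)
  sh bottom G = Good.short G

head-minimal : ∀ {y xs} → Increasing xs → All (y ≤_) xs → y ∈ xs → ∃ λ ys → xs ≡ y ∷ ys
head-minimal {y} {x ∷ xs} i (p ∷ _) y∈ with refl ← ≤-antisym p (increasing-head-∈ i y∈) = xs , refl

-- Among equal letters, standardisation numbers the one in the lowest row first, so this row tells
-- where the next letter has to be placed.
Lowest : Row → ℕ → Rows → Set
Lowest top    y (r₁ , r₂ , r₃) = y ∈ r₁ × y ∉ r₂ × y ∉ r₃
Lowest middle y (r₁ , r₂ , r₃) = y ∈ r₂ × y ∉ r₃
Lowest bottom y (r₁ , r₂ , r₃) = y ∈ r₃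

lowest : ∀ y U → 0 < total y U → ∃ λ q → Lowest q y U
lowest y U@(r₁ , r₂ , r₃) p with y ∈? r₃ | y ∈? r₂
... | yes q | _ = bottom , q
... | no a | yes q = middle , q , a
... | no a | no b with total>0⇒∈-row U p
...   | inj₁ q = top , q , b , a
...   | inj₂ (inj₁ q) = ⊥-elim (b q)
...   | inj₂ (inj₂ q) = ⊥-elim (a q)

totals-tail : ∀ q {y w} U → (∀ i → total i (prepend q y U) ≡ multiplicity i (y ∷ w)) → ∀ i →
    total i U ≡ multiplicity i w
totals-tail q {y} {w} U t i = +-cancelˡ-≡ (multiplicity i (y ∷ [])) _ _
  (trans (sym (total-prepend q i y U)) (trans (t i) (multiplicity-∷ i y w)))

strict-or-equal : ∀ acc {y w} → Continues acc (y ∷ w) → T (strict y acc) ⊎ ∃ λ acc′ → acc ≡ y ∷ acc′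
strict-or-equal [] c = inj₁ tt
strict-or-equal (p ∷ acc) {y} c with p <? y
... | yes q = inj₁ (<⇒<ᵇ q)
... | no ¬q with refl ← ≤-antisym (Linked.head c) (≮⇒≥ ¬q) = inj₂ (acc , refl)

Removed : List ℕ → ℕ → List ℕ → RowState → Rows → Set
Removed acc y w x U = ∃ λ q → ∃ λ V → U ≡ prepend q y V × Open (strict y acc) x q × Good (y ∷ acc) w (push x q) V

-- The lowest row containing `y` is open. Were it as long as the row above, `y` would stand under an
-- entry at least `y`, or under none; and `Tie` excludes a row below the previous one when the
-- letter repeats.
good-remove : ∀ {acc y w x U} → WellFormed x → Continues acc (y ∷ w) → Good acc (y ∷ w) x U → Removed acc y w x U
good-remove {acc} {y} {w} {m₁ , m₂ , m₃ , r} {U} W c G = go U G (lowest y U y-occurs)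
  where
  open WellFormed W
  y-occurs : 0 < total y U
  y-occurs = subst (0 <_) (sym (Good.totals G y)) (∈⇒multiplicity>0 {w = y ∷ w} (here refl))
  ties : ∀ {P : Set} {n} → (∀ {acc′} → acc ≡ y ∷ acc′ → r < n → ⊥) → T (strict y acc) ⊎ n ≤ r
  ties f with strict-or-equal acc c
  ... | inj₁ t = inj₁ t
  ... | inj₂ (acc′ , e) = inj₂ (≮⇒≥ (f e))
  tie₂ : ∀ {acc′ U} → acc ≡ y ∷ acc′ → Tie acc r U → r < 1 → y ∉ row middle U
  tie₂ refl (t , _) = t
  tie₃ : ∀ {acc′ U} → acc ≡ y ∷ acc′ → Tie acc r U → r < 2 → y ∉ row bottom U
  tie₃ refl (_ , t) = t
  go : ∀ U → Good acc (y ∷ w) (m₁ , m₂ , m₃ , r) U → (∃ λ q → Lowest q y U) → Removed acc y w (m₁ , m₂ , m₃ , r) U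
  go U@(r₁ , r₂ , r₃) G (bottom , y∈)
    with ≥y ← letters-≥′ {U = U} (continues-∷ acc c) (Good.totals G)
    with r₃′ , refl ← head-minimal (Good.increasing G bottom) (≥y bottom) y∈ =
    bottom , (r₁ , r₂ , r₃′) , refl , (m₃<m₂ , ties {⊤} (λ e r<2 → tie₃ {U = U} e (Good.tie G) r<2 (here refl)))
        , record
      { increasing = λ { top → Good.increasing G top ; middle → Good.increasing G middle ; bottom →
          Linked.tail (Good.increasing G bottom) }
      ; totals = totals-tail bottom (r₁ , r₂ , r₃′) (Good.totals G)
      ; above₁₂ = Good.above₁₂ G
      ; above₂₃ = subst (λ d → Above d r₂ (y ∷ r₃′)) (suc-∸ m₃<m₂) (Good.above₂₃ G)
      ; short = Good.short G
      ; tie = (λ { (s≤s ()) }) , (λ r<2 → ⊥-elim (<-irrefl refl r<2))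
      }
    where
    m₃<m₂ : m₃ < m₂
    m₃<m₂ with m≤n⇒m<n∨m≡n m₃≤m₂
    ... | inj₁ p = p
    ... | inj₂ refl = ⊥-elim (¬above-zero (≥y middle)
        (subst (λ d → Above d r₂ (y ∷ r₃′)) (n∸n≡0 m₃) (Good.above₂₃ G)))
  go U@(r₁ , r₂ , r₃) G (middle , y∈ , y∉)
    with ≥y ← letters-≥′ {U = U} (continues-∷ acc c) (Good.totals G)
    with r₂′ , refl ← head-minimal (Good.increasing G middle) (≥y middle) y∈ =
    middle , (r₁ , r₂′ , r₃) , refl , (m₂<m₁ , m+n≤o⇒m≤o (suc m₂) short′ ,
        ties {⊤} (λ e r<1 → tie₂ {U = U} e (Good.tie G) r<1 (here refl))) , record
      { increasing = λ { top → Good.increasing G top ; middle →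
          Linked.tail (Good.increasing G middle) ; bottom → Good.increasing G bottom }
      ; totals = totals-tail middle (r₁ , r₂′ , r₃) (Good.totals G)
      ; above₁₂ = subst (λ d → Above d r₁ (y ∷ r₂′)) (suc-∸ m₂<m₁) (Good.above₁₂ G)
      ; above₂₃ = subst (λ d → Above d r₂′ r₃) (sym (+-∸-assoc 1 m₃≤m₂)) (above-suc⁻ (m₂ ∸ m₃) r₃ (Good.above₂₃ G))
      ; short = short′
      ; tie = (λ r<1 → ⊥-elim (<-irrefl refl r<1)) , (λ _ → y∉)
      }
    where
    short′ : suc m₂ + length r₂′ ≤ 2
    short′ = subst (_≤ 2) (+-suc m₂ (length r₂′)) (Good.short G)
    m₂<m₁ : m₂ < m₁
    m₂<m₁ with m≤n⇒m<n∨m≡n m₂≤m₁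
    ... | inj₁ p = p
    ... | inj₂ refl = ⊥-elim (¬above-zero (≥y top) (subst (λ d → Above d r₁ (y ∷ r₂′)) (n∸n≡0 m₂) (Good.above₁₂ G)))
  go U@(r₁ , r₂ , r₃) G (top , y∈ , y∉₂ , y∉₃)
    with ≥y ← letters-≥′ {U = U} (continues-∷ acc c) (Good.totals G)
    with r₁′ , refl ← head-minimal (Good.increasing G top) (≥y top) y∈ =
    top , (r₁′ , r₂ , r₃) , refl , tt , record
      { increasing = λ { top → Linked.tail (Good.increasing G top) ; middle →
          Good.increasing G middle ; bottom → Good.increasing G bottom }
      ; totals = totals-tail top (r₁′ , r₂ , r₃) (Good.totals G)
      ; above₁₂ = above-push⁻ r₂ m₂≤m₁ m₁≤2 (Good.short G) (Good.above₁₂ G)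
      ; above₂₃ = Good.above₂₃ G
      ; short = Good.short G
      ; tie = (λ _ → y∉₂) , (λ _ → y∉₃)
      }

∈-openRows⁻ : ∀ {b x q} → q ∈ openRows b x → Open b x q
∈-openRows⁻ {b} {x} p = proj₂ (∈-filter⁻ (open? b x) {xs = top ∷ middle ∷ bottom ∷ []} p)

∈-openRows⁺ : ∀ {b x q} → Open b x q → q ∈ openRows b x
∈-openRows⁺ {b} {x} {q} o = ∈-filter⁺ (open? b x) (every q) o
  where
  every : ∀ q → q ∈ top ∷ middle ∷ bottom ∷ []
  every top = here refl
  every middle = there (here refl)
  every bottom = there (there (here refl))

tabs-good : ∀ acc w x {U z} → WellFormed x → Continues acc w → proj₁ (proj₂ x) ≤ 2 → (U , z) ∈ tabs acc w x →
    Good acc w x U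
tabs-good acc [] x W c m₂≤2 (here refl) = record
  { increasing = λ { top → [] ; middle → [] ; bottom → [] }
  ; totals = λ i → refl
  ; above₁₂ = above-long (proj₁ x ∸ proj₁ (proj₂ x)) [] z≤n
  ; above₂₃ = above-long (proj₁ (proj₂ x) ∸ proj₁ (proj₂ (proj₂ x))) [] z≤n
  ; short = subst (_≤ 2) (sym (+-identityʳ _)) m₂≤2
  ; tie = emptyTie acc
  }
  where
  emptyTie : ∀ acc → Tie acc (proj₂ (proj₂ (proj₂ x))) ([] , [] , [])
  emptyTie [] = tt
  emptyTie (_ ∷ _) = (λ _ ()) , (λ _ ())
tabs-good acc (y ∷ w) x W c m₂≤2 U∈ with q , (V , _) , q∈ , V∈ ,
    refl ← ∈-concatMap-map⁻ (openRows (strict y acc) x) U∈ =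
  good-prepend q W c o (tabs-good (y ∷ acc) w (push x q) W′ (continues-∷ acc c)
      (≤-trans (WellFormed.m₂≤m₁ W′) (WellFormed.m₁≤2 W′)) V∈)
  where
  o = ∈-openRows⁻ {x = x} q∈
  W′ = push-wellFormed x q o W

good-tabs : ∀ acc w x {U} → WellFormed x → Continues acc w → Good acc w x U → ∃ λ z → (U , z) ∈ tabs acc w x
good-tabs acc [] x {U} W c G with empty U (Good.totals G)
  where
  empty : ∀ U → (∀ i → total i U ≡ 0) → U ≡ ([] , [] , [])
  empty ([] , [] , []) t = refl
  empty U@(i ∷ _ , _ , _) t = ⊥-elim (<⇒≢ (∈-row⇒total>0 top U (here refl)) (sym (t i)))
  empty U@([] , i ∷ _ , _) t = ⊥-elim (<⇒≢ (∈-row⇒total>0 middle U (here refl)) (sym (t i)))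
  empty U@([] , [] , i ∷ _) t = ⊥-elim (<⇒≢ (∈-row⇒total>0 bottom U (here refl)) (sym (t i)))
... | refl = x , here refl
good-tabs acc (y ∷ w) x W c G with q , V , refl , o , G′ ← good-remove W c G
  with z , V∈ ← good-tabs (y ∷ acc) w (push x q) (push-wellFormed x q o W) (continues-∷ acc c) G′ =
  z , ∈-concatMap⁺ (extend y acc w x) (lose (∈-openRows⁺ o) (∈-map⁺ (λ (U , z) → prepend q y U , z) V∈))

-- If the same rows arose from two different choices, the remainder left by the higher choice would
-- still contain `y` in a lower row, which its `Tie` forbids.
prepend-row-unique : ∀ q q′ {acc y w x x′ U V} → Good (y ∷ acc) w (push x q) U → Good (y ∷ acc) w (push x′ q′) V →
  prepend q y U ≡ prepend q′ y V → q ≡ q′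
prepend-row-unique top top _ _ _ = refl
prepend-row-unique middle middle _ _ _ = refl
prepend-row-unique bottom bottom _ _ _ = refl
prepend-row-unique top middle G _ refl = ⊥-elim (proj₁ (Good.tie G) (s≤s z≤n) (here refl))
prepend-row-unique top bottom G _ refl = ⊥-elim (proj₂ (Good.tie G) (s≤s z≤n) (here refl))
prepend-row-unique middle top _ G refl = ⊥-elim (proj₁ (Good.tie G) (s≤s z≤n) (here refl))
prepend-row-unique middle bottom G _ refl = ⊥-elim (proj₂ (Good.tie G) ≤-refl (here refl))
prepend-row-unique bottom top _ G refl = ⊥-elim (proj₂ (Good.tie G) (s≤s z≤n) (here refl))
prepend-row-unique bottom middle _ G refl = ⊥-elim (proj₂ (Good.tie G) ≤-refl (here refl))

rows-unique : Unique (top ∷ middle ∷ bottom ∷ [])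
rows-unique = ((λ ()) ∷ (λ ()) ∷ []) ∷ ((λ ()) ∷ []) ∷ [] ∷ []

tabs-unique : ∀ acc w x → WellFormed x → Continues acc w → Unique (map proj₁ (tabs acc w x))
tabs-unique acc [] x W c = [] ∷ []
tabs-unique acc (y ∷ w) x W c = unique-concatMap id proj₁ (extend y acc w x) (openRows (strict y acc) x)
  (subst Unique (sym (map-id _)) (Uniq.filter⁺ (open? (strict y acc) x) rows-unique))
  (All.tabulate λ {q} q∈ → subst Unique (trans (sym (map-∘ (tabs (y ∷ acc) w (push x q))))
      (map-∘ (tabs (y ∷ acc) w (push x q))))
    (Uniq.map⁺ (prepend-injective q) (tabs-unique (y ∷ acc) w (push x q)
        (push-wellFormed x q (∈-openRows⁻ {x = x} q∈) W) (continues-∷ acc c))))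
  λ {q} {q′} q∈ q∈′ b∈ c∈ e → cross q q′ q∈ q∈′ b∈ c∈ e
  where
  goodAt : ∀ {q U z} → q ∈ openRows (strict y acc) x → (U , z) ∈ tabs (y ∷ acc) w (push x q) →
      Good (y ∷ acc) w (push x q) U
  goodAt {q} q∈ U∈ = tabs-good (y ∷ acc) w (push x q) W′ (continues-∷ acc c)
      (≤-trans (WellFormed.m₂≤m₁ W′) (WellFormed.m₁≤2 W′)) U∈
    where W′ = push-wellFormed x q (∈-openRows⁻ {x = x} q∈) W
  cross : ∀ q q′ {b d} → q ∈ openRows (strict y acc) x → q′ ∈ openRows (strict y acc) x →
    b ∈ extend y acc w x q → d ∈ extend y acc w x q′ → proj₁ b ≡ proj₁ d → q ≡ q′
  cross q q′ q∈ q∈′ b∈ d∈ e with (U , _) , U∈ , refl ← ∈-map⁻ _ b∈ | (V , _) , V∈ , refl ← ∈-map⁻ _ d∈ =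
    prepend-row-unique q q′ {x = x} {x′ = x} (goodAt q∈ U∈) (goodAt q∈′ V∈) e

Reaches : RowState → Rows → RowState → Set
Reaches (m₁ , m₂ , m₃ , _) (r₁ , r₂ , r₃) (k₁ , k₂ , k₃ , _) =
    k₁ ≡ (m₁ + length r₁) ⊓ 2 × k₂ ≡ m₂ + length r₂ × k₃ ≡ m₃ + length r₃

-- Capping the first row after every box agrees with capping it once at the end.
tabs-final : ∀ acc w x {U z} → proj₁ x ≤ 2 → (U , z) ∈ tabs acc w x → Reaches x U z
tabs-final acc [] (m₁ , m₂ , m₃ , r) m₁≤2 (here refl) =
  sym (trans (cong (_⊓ 2) (+-identityʳ m₁)) (m≤n⇒m⊓n≡m m₁≤2)) , sym (+-identityʳ m₂) , sym (+-identityʳ m₃)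
tabs-final acc (y ∷ w) x {z = z} m₁≤2 U∈ with q , (V , _) , q∈ , V∈ ,
    refl ← ∈-concatMap-map⁻ (openRows (strict y acc) x) U∈ =
  back x q V {z} m₁≤2 (tabs-final (y ∷ acc) w (push x q) (push≤2 x q m₁≤2) V∈)
  where
  push≤2 : ∀ x q → proj₁ x ≤ 2 → proj₁ (push x q) ≤ 2
  push≤2 x top _ = m⊓n≤n _ 2
  push≤2 x middle p = p
  push≤2 x bottom p = p
  capped : ∀ m k → (suc m ⊓ 2 + k) ⊓ 2 ≡ (m + suc k) ⊓ 2
  capped zero k = refl
  capped (suc zero) k = refl
  capped (suc (suc m)) k = cong (2 +_) (trans (⊓-zeroʳ k) (sym (⊓-zeroʳ (m + suc k))))
  back : ∀ x q V {z} → proj₁ x ≤ 2 → Reaches (push x q) V z → Reaches x (prepend q y V) z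
  back x top V _ (a , b , c) = trans a (capped (proj₁ x) _) , b , c
  back x middle V _ (a , b , c) = a , trans b (sym (+-suc _ _)) , c
  back x bottom V _ (a , b , c) = a , b , trans c (sym (+-suc _ _))

strictnessFrom : List ℕ → List ℕ → List Bool
strictnessFrom acc []      = []
strictnessFrom acc (y ∷ w) = strict y acc ∷ strictnessFrom (y ∷ acc) w

strictness-ʳ++ : ∀ acc w → strictness (w ʳ++ acc) ≡ strictnessFrom acc w ʳ++ strictness acc
strictness-ʳ++ acc [] = refl
strictness-ʳ++ acc (y ∷ w) = strictness-ʳ++ (y ∷ acc) w

strictnessFrom≡reverse : ∀ w → strictnessFrom [] w ≡ reverse (strictness (reverse w))
strictnessFrom≡reverse w = trans (sym (reverse-involutive (strictnessFrom [] w)))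
    (cong reverse (sym (strictness-ʳ++ [] w)))

tabs-finals : ∀ acc w x → map proj₂ (tabs acc w x) ≡ finals (strictnessFrom acc w) x
tabs-finals acc [] x = refl
tabs-finals acc (y ∷ w) x = trans (map-concatMap proj₂ (extend y acc w x) (openRows (strict y acc) x))
  (concatMap-cong (λ q → trans (sym (map-∘ (tabs (y ∷ acc) w (push x q)))) (tabs-finals (y ∷ acc) w (push x q)))
      (openRows (strict y acc) x))

-- Tableaux as lists of nonempty rows, and Schur functions

nonEmpty? : Decidable (λ (r : List ℕ) → 0 < length r)
nonEmpty? r = 0 <? length r

strip : Rows → Tableau
strip (r₁ , r₂ , r₃) = filter nonEmpty? (r₁ ∷ r₂ ∷ r₃ ∷ [])

pad : Tableau → Rows
pad []                     = [] , [] , []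
pad (r₁ ∷ [])              = r₁ , [] , []
pad (r₁ ∷ r₂ ∷ [])         = r₁ , r₂ , []
pad (r₁ ∷ r₂ ∷ r₃ ∷ _)     = r₁ , r₂ , r₃

concat-nonEmpty : ∀ T → concat (filter nonEmpty? T) ≡ concat T
concat-nonEmpty [] = refl
concat-nonEmpty ([] ∷ T) = concat-nonEmpty T
concat-nonEmpty (r@(_ ∷ _) ∷ T) = cong (r ++_) (concat-nonEmpty T)

multiplicity-concat : ∀ i r₁ r₂ r₃ → multiplicity i (concat (r₁ ∷ r₂ ∷ r₃ ∷ [])) ≡ total i (r₁ , r₂ , r₃)
multiplicity-concat i r₁ r₂ r₃ = trans (multiplicity-++ i r₁ (r₂ ++ r₃ ++ []))
  (cong (multiplicity i r₁ +_) (trans (multiplicity-++ i r₂ (r₃ ++ []))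
    (cong (λ r → multiplicity i r₂ + multiplicity i r) (++-identityʳ r₃))))

multiplicity-strip : ∀ i U → multiplicity i (concat (strip U)) ≡ total i U
multiplicity-strip i (r₁ , r₂ , r₃) = trans (cong (multiplicity i) (concat-nonEmpty (r₁ ∷ r₂ ∷ r₃ ∷ [])))
    (multiplicity-concat i r₁ r₂ r₃)

record Ssyt (w : List ℕ) (T : Tableau) : Set where
  constructor ssyt
  field
    semistandard   : Semistandard T
    multiplicities : ∀ i → multiplicity i (concat T) ≡ multiplicity i w
    positive       : All (0 <_) (map length T)
    three-rows     : length T ≤ 3
    second-row     : map length T ! 2 < 3

open Ssyt

-- At `origin` all offsets are 0 and `Above` is column strictness. It also excludes an empty row
-- above a nonempty one, so dropping empty rows loses no information.
good⇒ssyt : ∀ {w U} → Good [] w origin U → Ssyt w (strip U) × pad (strip U) ≡ U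
good⇒ssyt {w} {U} G = go U G (λ i → trans (multiplicity-strip i U) (Good.totals G i))
  where
  go : ∀ U → Good [] w origin U → (∀ i → multiplicity i (concat (strip U)) ≡ multiplicity i w) →
      Ssyt w (strip U) × pad (strip U) ≡ U
  go ([] , [] , []) G t = ssyt ([] , []) t [] z≤n (s≤s z≤n) , refl
  go (_ ∷ _ , [] , []) G t = ssyt (Good.increasing G top ∷ [] , [-]) t (s≤s z≤n ∷ []) (s≤s z≤n) (s≤s z≤n) , refl
  go (_ ∷ _ , _ ∷ _ , []) G t = ssyt (Good.increasing G top ∷ Good.increasing G middle ∷ [] , Good.above₁₂ G ∷ [-]) t
    (s≤s z≤n ∷ s≤s z≤n ∷ []) (s≤s (s≤s z≤n)) (s≤s (Good.short G)) , refl
  go (_ ∷ _ , _ ∷ _ , _ ∷ _) G t = ssyt (Good.increasing G top ∷ Good.increasing G middle ∷ Good.increasing G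
      bottom ∷ [] ,
      Good.above₁₂ G ∷ Good.above₂₃ G ∷ [-]) t
    (s≤s z≤n ∷ s≤s z≤n ∷ s≤s z≤n ∷ []) (s≤s (s≤s (s≤s z≤n))) (s≤s (Good.short G)) , refl
  go ([] , _ ∷ _ , _) G t with () ← Good.above₁₂ G
  go (_ , [] , _ ∷ _) G t with () ← Good.above₂₃ G

ssyt⇒good : ∀ {w T} → Ssyt w T → Good [] w origin (pad T) × strip (pad T) ≡ T
ssyt⇒good {w} {[]} S = good (λ { top → [] ; middle → [] ; bottom → [] }) (multiplicities S) [] [] z≤n tt , refl
ssyt⇒good {w} {r₁@(_ ∷ _) ∷ []} S with i₁ ∷ [] ← proj₁ (semistandard S) =
  good (λ { top → i₁ ; middle → [] ; bottom → [] }) (λ i →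
      trans (sym (multiplicity-concat i r₁ [] [])) (multiplicities S i)) [] [] z≤n tt , refl
ssyt⇒good {w} {r₁@(_ ∷ _) ∷ r₂@(_ ∷ _) ∷ []} S with i₁ ∷ i₂ ∷ [] ← proj₁ (semistandard S) | p ∷ [-] ← proj₂
    (semistandard S) =
  good (λ { top → i₁ ; middle → i₂ ; bottom → [] }) (λ i →
      trans (sym (multiplicity-concat i r₁ r₂ [])) (multiplicities S i)) p [] (s≤s⁻¹ (second-row S)) tt , refl
ssyt⇒good {w} {r₁@(_ ∷ _) ∷ r₂@(_ ∷ _) ∷ r₃@(_ ∷ _) ∷ []} S with i₁ ∷ i₂ ∷ i₃ ∷ [] ← proj₁ (semistandard S) | p
    ∷ q ∷ [-] ← proj₂ (semistandard S) =
  good (λ { top → i₁ ; middle → i₂ ; bottom → i₃ }) (λ i →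
      trans (sym (multiplicity-concat i r₁ r₂ r₃)) (multiplicities S i)) p q (s≤s⁻¹ (second-row S)) tt , refl
ssyt⇒good {w} {[] ∷ _} S with () ∷ _ ← positive S
ssyt⇒good {w} {_ ∷ [] ∷ _} S with _ ∷ () ∷ _ ← positive S
ssyt⇒good {w} {_ ∷ _ ∷ [] ∷ _} S with _ ∷ _ ∷ () ∷ _ ← positive S
ssyt⇒good {w} {_ ∷ _ ∷ _ ∷ _ ∷ _} S with s≤s (s≤s (s≤s ())) ← three-rows S

origin-wellFormed : WellFormed origin
origin-wellFormed = wellFormed z≤n z≤n z≤n

tableaux : List ℕ → List Tableau
tableaux w = map strip (map proj₁ (tabs [] w origin))

module _ {w} (inc : Increasing w) where

  tabs⇒good : ∀ {U} → U ∈ map proj₁ (tabs [] w origin) → Good [] w origin U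
  tabs⇒good U∈ with _ , p , refl ← ∈-map⁻ proj₁ U∈ = tabs-good [] w origin origin-wellFormed inc z≤n p

  tableaux⇒ssyt : ∀ {T} → T ∈ tableaux w → Ssyt w T
  tableaux⇒ssyt T∈ with _ , p , refl ← ∈-map⁻ strip T∈ = proj₁ (good⇒ssyt (tabs⇒good p))

  ssyt⇒tableaux : ∀ {T} → Ssyt w T → T ∈ tableaux w
  ssyt⇒tableaux S with G , e ← ssyt⇒good S with z , p ← good-tabs [] w origin origin-wellFormed inc G =
    subst (_∈ tableaux w) e (∈-map⁺ strip (∈-map⁺ proj₁ p))

  -- `strip` has `pad` as a left inverse on these triples, so uniqueness carries over from
  -- `tabs-unique`.
  tableaux-unique : Unique (tableaux w)
  tableaux-unique = Uniq.map⁻ {f = pad} (subst Unique (sym eq) (tabs-unique [] w origin origin-wellFormed inc))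
    where
    us = map proj₁ (tabs [] w origin)
    eq : map pad (map strip us) ≡ us
    eq = trans (sym (map-∘ us)) (map-id-local (All.tabulate λ U∈ → proj₂ (good⇒ssyt (tabs⇒good U∈))))

∈-fillings⁻ : ∀ {A} μ {T} → T ∈ fillings A μ → map length T ≡ μ × All (All (_∈ A)) T
∈-fillings⁻ [] (here refl) = refl , []
∈-fillings⁻ {A} (r ∷ μ) T∈ with u , T , u∈ , T∈′ , refl ← ∈-cartesianProductWith⁻ _∷_ (words A r) (fillings A μ) T∈
  with l , a ← ∈-words⁻ r u∈ | ls , as ← ∈-fillings⁻ μ T∈′ = cong₂ _∷_ l ls , a ∷ as

∈-fillings⁺ : ∀ {A} T → All (All (_∈ A)) T → T ∈ fillings A (map length T)
∈-fillings⁺ [] [] = here refl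
∈-fillings⁺ (r ∷ T) (a ∷ as) = ∈-cartesianProductWith⁺ _∷_ (∈-words⁺ _ refl a) (∈-fillings⁺ T as)

fillings-unique : ∀ {A} μ → Unique A → Unique (fillings A μ)
fillings-unique [] u = [] ∷ []
fillings-unique (r ∷ μ) u = Uniq.cartesianProductWith⁺ _∷_ ∷-injective (words-unique r u) (fillings-unique μ u)

letters-of-word : ∀ α T → (∀ i → multiplicity i (concat T) ≡ multiplicity i (wordOf α)) →
    All (All (_∈ [1… length α ])) T
letters-of-word α T m = All.tabulate λ r∈ → All.tabulate λ {i} i∈ →
  All.lookup (wordOf-letters α) (multiplicity>0⇒∈ (wordOf α)
      (subst (0 <_) (m i) (∈⇒multiplicity>0 (∈-concat⁺′ i∈ r∈))))

lengths? : ∀ μ → Decidable (λ (T : Tableau) → map length T ≡ μ)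
lengths? μ T = ≡-dec _≟_ (map length T) μ

-- One list, `tableaux (wordOf α)`, serves all shapes at once: each Schur coefficient is the size of
-- one fibre of the map sending a tableau to its row lengths.
s-tableaux : ∀ μ α → All (0 <_) μ → length μ ≤ 3 → μ ! 2 < 3 →
    s μ α ≡ length (filter (lengths? μ) (tableaux (wordOf α)))
s-tableaux μ α pos len sec = ↭-length (unique-set-↭
    (Uniq.filter⁺ P? (fillings-unique μ ([1…]-unique k)))
    (Uniq.filter⁺ (lengths? μ) (tableaux-unique inc))
    to from)
  where
  k = length α
  inc = wordFrom-increasing 1 α
  P? : Decidable (λ T → Semistandard T × content k (concat T) ≡ α)
  P? T = semistandard? T ×-dec ≡-dec _≟_ (content k (concat T)) α
  to : ∀ {T} → T ∈ filter P? (fillings [1… k ] μ) → T ∈ filter (lengths? μ) (tableaux (wordOf α))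
  to {T} p with T∈ , ss , c ← ∈-filter⁻ P? {xs = fillings [1… k ] μ} p with refl , a ← ∈-fillings⁻ μ T∈ =
    ∈-filter⁺ (lengths? μ) (ssyt⇒tableaux inc (ssyt ss (content⇒multiplicity α {concat T} (AllP.concat⁺ a) c) pos
      (subst (_≤ 3) (length-map length T) len) sec)) refl
  from : ∀ {T} → T ∈ filter (lengths? μ) (tableaux (wordOf α)) → T ∈ filter P? (fillings [1… k ] μ)
  from {T} p with T∈ , refl ← ∈-filter⁻ (lengths? μ) {xs = tableaux (wordOf α)} p with S ← tableaux⇒ssyt inc T∈ =
    ∈-filter⁺ P? (∈-fillings⁺ T (letters-of-word α T (multiplicities S))) (semistandard S ,
        multiplicity⇒content α {concat T} (multiplicities S))

size : Rows → ℕ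
size (r₁ , r₂ , r₃) = length r₁ + (length r₂ + length r₃)

tabs-size : ∀ acc w x {U z} → (U , z) ∈ tabs acc w x → size U ≡ length w
tabs-size acc [] x (here refl) = refl
tabs-size acc (y ∷ w) x U∈ with q , (V , _) , _ , V∈ , refl ← ∈-concatMap-map⁻ (openRows (strict y acc) x) U∈ =
  trans (grows q V) (cong suc (tabs-size (y ∷ acc) w (push x q) V∈))
  where
  grows : ∀ q V → size (prepend q y V) ≡ suc (size V)
  grows top V = refl
  grows middle (r₁ , r₂ , r₃) = +-suc (length r₁) (length r₂ + length r₃)
  grows bottom (r₁ , r₂ , r₃) = trans (cong (length r₁ +_) (+-suc (length r₂) (length r₃)))
      (+-suc (length r₁) (length r₂ + length r₃))

length-concat : ∀ (T : Tableau) → length (concat T) ≡ sum (map length T)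
length-concat [] = refl
length-concat (r ∷ T) = trans (length-++ r) (cong (length r +_) (length-concat T))

strip-size : ∀ U → sum (map length (strip U)) ≡ size U
strip-size (r₁ , r₂ , r₃) = begin
  sum (map length (strip (r₁ , r₂ , r₃))) ≡⟨ length-concat (strip (r₁ , r₂ , r₃)) ⟨
  length (concat (strip (r₁ , r₂ , r₃))) ≡⟨ cong length (concat-nonEmpty (r₁ ∷ r₂ ∷ r₃ ∷ [])) ⟩
  length (concat (r₁ ∷ r₂ ∷ r₃ ∷ [])) ≡⟨ length-concat (r₁ ∷ r₂ ∷ r₃ ∷ []) ⟩
  length r₁ + (length r₂ + (length r₃ + 0)) ≡⟨ cong (λ l → length r₁ + (length r₂ + l)) (+-identityʳ (length r₃)) ⟩
  length r₁ + (length r₂ + length r₃) ∎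
  where open ≡-Reasoning

tableaux-size : ∀ α {T} → T ∈ tableaux (wordOf α) → sum (map length T) ≡ sum α
tableaux-size α T∈ with U , p , refl ← ∈-map⁻ strip T∈ with _ , q , refl ← ∈-map⁻ proj₁ p =
  trans (strip-size U) (trans (tabs-size [] (wordOf α) origin q) (wordFrom-length 1 α))

-- The partitions in the sum, and the Schur side

shapes : ℕ → List (List ℕ)
shapes n = filter (λ μ → length μ ≤? 3) (ℋ n 3)

record Shape (n : ℕ) (μ : List ℕ) : Set where
  constructor isShape
  field
    decreasing : WeaklyDecreasing μ
    sum-μ      : sum μ ≡ n
    parts>0    : All (0 <_) μ
    μ₂<3       : μ ! 2 < 3
    length≤3   : length μ ≤ 3

open Shape

private
  partition? : ∀ n → Decidable (λ μ → WeaklyDecreasing μ × sum μ ≡ n)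
  partition? n μ = linked? _≥?_ μ ×-dec (sum μ ≟ n)

  candidates : ℕ → List (List ℕ)
  candidates n = concatMap (words [1… n ]) (upTo (suc n))

∈-shapes⁻ : ∀ {n μ} → μ ∈ shapes n → Shape n μ
∈-shapes⁻ {n} p
  with p₁ , l ← ∈-filter⁻ (λ μ → length μ ≤? 3) {xs = ℋ n 3} p
  with p₂ , h ← ∈-filter⁻ (λ μ → μ ! 2 <? 3) {xs = partitions n} p₁
  with p₃ , d , s ← ∈-filter⁻ (partition? n) {xs = candidates n} p₂
  with i , _ , q ← find (∈-concatMap⁻ (words [1… n ]) {xs = upTo (suc n)} p₃) =
  isShape d s (All.map (proj₁ ∘ ∈[1…]⁻) (proj₂ (∈-words⁻ i q))) h l

parts≤sum : ∀ μ → All (_≤ sum μ) μ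
parts≤sum [] = []
parts≤sum (a ∷ μ) = m≤m+n a (sum μ) ∷ All.map (λ p → ≤-trans p (m≤n+m (sum μ) a)) (parts≤sum μ)

length≤sum : ∀ {μ} → All (0 <_) μ → length μ ≤ sum μ
length≤sum [] = z≤n
length≤sum (p ∷ a) = +-mono-≤ p (length≤sum a)

∈-shapes⁺ : ∀ {n μ} → Shape n μ → μ ∈ shapes n
∈-shapes⁺ {n} {μ} (isShape d refl pos h l) =
  ∈-filter⁺ (λ μ → length μ ≤? 3)
    (∈-filter⁺ (λ μ → μ ! 2 <? 3)
      (∈-filter⁺ (partition? n)
        (∈-concatMap⁺ (words [1… n ]) (lose (∈-upTo⁺ (s≤s (length≤sum pos)))
          (∈-words⁺ (length μ) refl (All.zipWith (λ (p , q) → ∈[1…]⁺ p q) (pos , parts≤sum μ)))))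
        (d , refl))
      h) l

shapes-unique : ∀ n → Unique (shapes n)
shapes-unique n = Uniq.filter⁺ (λ μ → length μ ≤? 3)
    (Uniq.filter⁺ (λ μ → μ ! 2 <? 3) (Uniq.filter⁺ (partition? n) (subst Unique (map-id _)
  (unique-concatMap id id (words [1… n ]) (upTo (suc n)) (subst Unique (sym (map-id _)) (Uniq.upTo⁺ (suc n)))
    (All.tabulate λ {i} _ → subst Unique (sym (map-id _)) (words-unique i ([1…]-unique n)))
    λ {i} {j} _ _ b∈ c∈ e → trans (sym (proj₁ (∈-words⁻ i b∈))) (trans (cong length e) (proj₁ (∈-words⁻ j c∈)))))))

tableaux-shape : ∀ α {T} → T ∈ tableaux (wordOf α) → Shape (sum α) (map length T)
tableaux-shape α {T} T∈ = isShape
  (LinkedP.map⁺ (Linked.map PrefixP.length-mono (proj₂ (semistandard S))))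
  (tableaux-size α T∈) (positive S) (second-row S) (subst (_≤ 3) (sym (length-map length T)) (three-rows S))
  where S = tableaux⇒ssyt (wordFrom-increasing 1 α) T∈

module _ {A : Set} (h : A → List ℕ) (f : List ℕ → ℕ) where
  private
    fiber? : ∀ μ → Decidable (λ x → h x ≡ μ)
    fiber? μ x = ≡-dec _≟_ (h x) μ

    fiber : List A → List ℕ → ℕ
    fiber xs μ = length (filter (fiber? μ) xs)

    sum-fiber-∉ : ∀ x xs ps → h x ∉ ps → sum (map (λ μ → f μ * fiber (x ∷ xs) μ) ps) ≡ sum
        (map (λ μ → f μ * fiber xs μ) ps)
    sum-fiber-∉ x xs [] _ = refl
    sum-fiber-∉ x xs (μ ∷ ps) h∉ = cong₂ _+_ (cong (λ ys → f μ * length ys) (filter-reject (fiber? μ) (h∉ ∘ here)))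
      (sum-fiber-∉ x xs ps (h∉ ∘ there))

    sum-fiber-∈ : ∀ x xs ps → Unique ps → h x ∈ ps →
      sum (map (λ μ → f μ * fiber (x ∷ xs) μ) ps) ≡ f (h x) + sum (map (λ μ → f μ * fiber xs μ) ps)
    sum-fiber-∈ x xs (μ ∷ ps) (μ∉ ∷ _) (here refl) = begin
      f μ * fiber (x ∷ xs) μ + sum (map (λ μ → f μ * fiber (x ∷ xs) μ) ps)
        ≡⟨ cong₂ _+_ (trans (cong (λ ys → f μ * length ys) (filter-accept (fiber? μ) refl))
            (*-suc (f μ) (fiber xs μ)))
             (sum-fiber-∉ x xs ps (λ p → All.lookup μ∉ p refl)) ⟩
      f μ + f μ * fiber xs μ + sum (map (λ μ → f μ * fiber xs μ) ps) ≡⟨ +-assoc (f μ) _ _ ⟩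
      f μ + (f μ * fiber xs μ + sum (map (λ μ → f μ * fiber xs μ) ps)) ∎
      where open ≡-Reasoning
    sum-fiber-∈ x xs (μ ∷ ps) (μ∉ ∷ u) (there h∈) = begin
      f μ * fiber (x ∷ xs) μ + sum (map (λ μ → f μ * fiber (x ∷ xs) μ) ps)
        ≡⟨ cong₂ _+_ (cong (λ ys → f μ * length ys) (filter-reject (fiber? μ) (λ e → All.lookup μ∉ h∈ (sym e))))
             (sum-fiber-∈ x xs ps u h∈) ⟩
      f μ * fiber xs μ + (f (h x) + sum (map (λ μ → f μ * fiber xs μ) ps))
          ≡⟨ x∙yz≈y∙xz (f μ * fiber xs μ) (f (h x)) _ ⟩
      f (h x) + (f μ * fiber xs μ + sum (map (λ μ → f μ * fiber xs μ) ps)) ∎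
      where
      open ≡-Reasoning

  -- Turns the sum over shapes, weighted by Schur coefficients, into a sum over single tableaux.
  -- Each `x` is counted in exactly one fibre, as `ps` has no repetitions and contains `h x`.
  sum-over-fibers : ∀ {ps} → Unique ps → ∀ xs → All (λ x → h x ∈ ps) xs →
    sum (map (λ μ → f μ * fiber xs μ) ps) ≡ sum (map (f ∘ h) xs)
  sum-over-fibers {ps} u [] [] = zeros ps
    where
    zeros : ∀ ps → sum (map (λ μ → f μ * 0) ps) ≡ 0
    zeros [] = refl
    zeros (μ ∷ ps) = cong₂ _+_ (*-zeroʳ (f μ)) (zeros ps)
  sum-over-fibers {ps} u (x ∷ xs) (h∈ ∷ a) = trans (sum-fiber-∈ x xs ps u h∈)
      (cong (f (h x) +_) (sum-over-fibers u xs a))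

-- Identifies the overlined partition of the theorem with the capped lengths recorded by the
-- automaton.
overline-strip : ∀ {w U z} → Good [] w origin U → Reaches origin U z → overline (map length (strip U)) ≡ shape z
overline-strip {U = [] , [] , []} G (refl , refl , refl) = refl
overline-strip {U = _ ∷ _ , [] , []} G (refl , refl , refl) = refl
overline-strip {U = _ ∷ _ , _ ∷ _ , []} G (refl , refl , refl) = refl
overline-strip {U = _ ∷ _ , _ ∷ _ , _ ∷ _} G (refl , refl , refl) = refl
overline-strip {U = [] , _ ∷ _ , _} G _ with () ← Good.above₁₂ G
overline-strip {U = _ , [] , _ ∷ _} G _ with () ← Good.above₂₃ G

sum-cong : ∀ {A : Set} (f g : A → ℕ) xs → (∀ {x} → x ∈ xs → f x ≡ g x) → sum (map f xs) ≡ sum (map g xs)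
sum-cong f g xs e = cong sum (map-cong-local (All.tabulate e))

sum-zero : ∀ {A : Set} (f : A → ℕ) xs → (∀ {x} → x ∈ xs → f x ≡ 0) → sum (map f xs) ≡ 0
sum-zero f [] e = refl
sum-zero f (x ∷ xs) e = cong₂ _+_ (e (here refl)) (sum-zero f xs (e ∘ there))

schurSum : ℕ → Series
schurSum n = ∑[ μ ∈ shapes n ] (#SYT (overline μ) · s μ)

s-shape : ∀ n α {μ} → μ ∈ shapes n → s μ α ≡ length (filter (lengths? μ) (tableaux (wordOf α)))
s-shape n α {μ} μ∈ = s-tableaux μ α (parts>0 S) (length≤3 S) (μ₂<3 S)
  where S = ∈-shapes⁻ {n} μ∈

-- The weight of a tableau depends only on its final row state, so the sum runs over the `finals`,
-- where `length-run` converts it into the size of the tree of avoiders.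
schurSum-≡ : ∀ α → schurSum (sum α) α ≡ length (grow (reverse (wordOf α)))
schurSum-≡ α = begin
  sum (map (λ μ → #SYT (overline μ) * s μ α) (shapes (sum α)))
    ≡⟨ sum-cong _ _ (shapes (sum α)) (λ {μ} μ∈ → cong (#SYT (overline μ) *_) (s-shape (sum α) α μ∈)) ⟩
  sum (map (λ μ → #SYT (overline μ) * length (filter (lengths? μ) (tableaux w))) (shapes (sum α)))
    ≡⟨ sum-over-fibers (map length) (#SYT ∘ overline) (shapes-unique (sum α)) (tableaux w) (All.tabulate λ T∈ →
        ∈-shapes⁺ (tableaux-shape α T∈)) ⟩
  sum (map (#SYT ∘ overline ∘ map length) (map strip (map proj₁ ts)))
    ≡⟨ cong sum (trans (sym (map-∘ (map proj₁ ts))) (sym (map-∘ ts))) ⟩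
  sum (map (#SYT ∘ overline ∘ map length ∘ strip ∘ proj₁) ts)
    ≡⟨ sum-cong _ _ ts (λ {(U , z)} p →
         cong #SYT (overline-strip {z = z} (tabs-good [] w origin origin-wellFormed inc z≤n p)
             (tabs-final [] w origin z≤n p))) ⟩
  sum (map (#SYT ∘ shape ∘ proj₂) ts) ≡⟨ cong sum (map-∘ ts) ⟩
  sum (map (#SYT ∘ shape) (map proj₂ ts)) ≡⟨ cong (sum ∘ map (#SYT ∘ shape)) (tabs-finals [] w origin) ⟩
  sum (map (#SYT ∘ shape) (finals (strictnessFrom [] w) origin)) ≡⟨ length-run (strictnessFrom [] w) ⟨
  length (run step (strictnessFrom [] w) (root ∷ []))
      ≡⟨ cong (λ bs → length (run step bs (root ∷ []))) (strictnessFrom≡reverse w) ⟩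
  length (run step (reverse (strictness (reverse w))) (root ∷ [])) ≡⟨ length-grow (reverse w) ⟨
  length (grow (reverse w)) ∎
  where
  open ≡-Reasoning
  w = wordOf α
  inc = wordFrom-increasing 1 α
  ts = tabs [] w origin

-- Homogeneity: a tableau of content `α` has `sum α` boxes.
schurSum-≢ : ∀ {n} α → sum α ≢ n → schurSum n α ≡ 0
schurSum-≢ {n} α ne = sum-zero _ (shapes n) λ {μ} μ∈ → begin
  #SYT (overline μ) * s μ α ≡⟨ cong (#SYT (overline μ) *_) (s-shape n α μ∈) ⟩
  #SYT (overline μ) * length (filter (lengths? μ) (tableaux (wordOf α)))
    ≡⟨ cong (λ ts → #SYT (overline μ) * length ts) (filter-none (lengths? μ) (All.tabulate λ T∈ e →
         ne (trans (sym (tableaux-size α T∈)) (trans (cong sum e) (sum-μ (∈-shapes⁻ {n} μ∈)))))) ⟩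
  #SYT (overline μ) * 0 ≡⟨ *-zeroʳ (#SYT (overline μ)) ⟩
  0 ∎
  where open ≡-Reasoning

-- The quasisymmetric side

module _ (n : ℕ) (S : List ℕ) (α : List ℕ) where
  private
    F? : Decidable (λ w → Compatible S w × content (length α) w ≡ α)
    F? w = compatible? S w ×-dec ≡-dec _≟_ (content (length α) w) α

    only-word : ∀ {w} → w ∈ words [1… length α ] n → Compatible S w × content (length α) w ≡ α →
        w ≡ wordOf α × length w ≡ n
    only-word w∈ (c , e) with l , a ← ∈-words⁻ n w∈ =
      increasing-≡ (proj₁ c) (wordFrom-increasing 1 α) (content⇒multiplicity α a e) , l

  -- A weakly increasing word is determined by its content, so the coefficient only records whether
  -- `wordOf α` is compatible with `S`.
  F-≡ : sum α ≡ n → F n S α ≡ length (filter (compatible? S) (wordOf α ∷ []))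
  F-≡ e = length-filter-singleton F? (compatible? S) (words-unique n ([1…]-unique (length α)))
    (λ w∈ p → let q , _ = only-word w∈ p in q , subst (Compatible S) q (proj₁ p))
    (λ c → ∈-words⁺ n (trans (wordFrom-length 1 α) e) (wordOf-letters α) , c , content-wordOf α)

  F-≢ : sum α ≢ n → F n S α ≡ 0
  F-≢ ne = cong length (filter-none F? (All.tabulate λ w∈ p →
    let q , l = only-word w∈ p in ne (trans (sym (wordFrom-length 1 α)) (trans (cong length (sym q)) l))))

sum-filter-singleton : ∀ {A B : Set} {P : A → B → Set} (P? : ∀ x → Decidable (P x)) b (xs : List A) →
  sum (map (λ x → length (filter (P? x) (b ∷ []))) xs) ≡ length (filter (λ x → P? x b) xs)
sum-filter-singleton P? b [] = refl
sum-filter-singleton P? b (x ∷ xs) with P? x b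
... | yes _ = cong suc (sum-filter-singleton P? b xs)
... | no _ = sum-filter-singleton P? b xs

Q-≡ : ∀ α → Q (sum α) Π₀ α ≡ length (grow (reverse (wordOf α)))
Q-≡ α = begin
  sum (map (λ σ → F n (Des σ) α) (𝔖-avoiding n Π₀))
      ≡⟨ sum-cong _ _ (𝔖-avoiding n Π₀) (λ {σ} _ → F-≡ n (Des σ) α refl) ⟩
  sum (map (λ σ → length (filter (compatible? (Des σ)) (wordOf α ∷ []))) (𝔖-avoiding n Π₀))
    ≡⟨ sum-filter-singleton (compatible? ∘ Des) (wordOf α) (𝔖-avoiding n Π₀) ⟩
  length (compatiblePerms n (wordOf α)) ≡⟨ length-compatiblePerms (wordFrom-length 1 α) (wordFrom-increasing 1 α) ⟩
  length (grow (reverse (wordOf α))) ∎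
  where
  open ≡-Reasoning
  n = sum α

Q-≢ : ∀ {n} α → sum α ≢ n → Q n Π₀ α ≡ 0
Q-≢ {n} α ne = sum-zero _ (𝔖-avoiding n Π₀) λ {σ} _ → F-≢ n (Des σ) α ne

Q≈schurSum : ∀ n → Q n Π₀ ≈ schurSum n
Q≈schurSum n α with sum α ≟ n
... | yes refl = trans (Q-≡ α) (sym (schurSum-≡ α))
... | no ne = trans (Q-≢ α ne) (sym (schurSum-≢ α ne))

-- The explicit form for large n

longShapes : ℕ → List (List ℕ)
longShapes m = (6 + m ∷ []) ∷ (5 + m ∷ 1 ∷ []) ∷ (4 + m ∷ 2 ∷ []) ∷ (4 + m ∷ 1 ∷ 1 ∷ [])
             ∷ (3 + m ∷ 2 ∷ 1 ∷ []) ∷ (2 + m ∷ 2 ∷ 2 ∷ []) ∷ []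

-- The bounds leave six possibilities for the parts after the first, and the sum then fixes the
-- first part.
shape⇒longShapes : ∀ m {μ} → Shape (6 + m) μ → μ ∈ longShapes m
shape⇒longShapes m {[]} (isShape _ () _ _ _)
shape⇒longShapes m {a ∷ []} (isShape _ e _ _ _) = here (cong (_∷ []) (trans (sym (+-identityʳ a)) e))
shape⇒longShapes m {a ∷ 1 ∷ []} (isShape _ e _ _ _) =
  there (here (cong (_∷ 1 ∷ []) (+-cancelˡ-≡ 1 a (5 + m) (trans (+-comm 1 a) e))))
shape⇒longShapes m {a ∷ 2 ∷ []} (isShape _ e _ _ _) =
  there (there (here (cong (_∷ 2 ∷ []) (+-cancelˡ-≡ 2 a (4 + m) (trans (+-comm 2 a) e)))))
shape⇒longShapes m {a ∷ 1 ∷ 1 ∷ []} (isShape _ e _ _ _) =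
  there (there (there (here (cong (_∷ 1 ∷ 1 ∷ []) (+-cancelˡ-≡ 2 a (4 + m) (trans (+-comm 2 a) e))))))
shape⇒longShapes m {a ∷ 2 ∷ 1 ∷ []} (isShape _ e _ _ _) =
  there (there (there (there (here (cong (_∷ 2 ∷ 1 ∷ []) (+-cancelˡ-≡ 3 a (3 + m) (trans (+-comm 3 a) e)))))))
shape⇒longShapes m {a ∷ 2 ∷ 2 ∷ []} (isShape _ e _ _ _) =
  there (there (there (there (there (here (cong (_∷ 2 ∷ 2 ∷ []) (+-cancelˡ-≡ 4 a (2 + m) (trans (+-comm 4 a) e))))))))
shape⇒longShapes m {_ ∷ 0 ∷ _} (isShape _ _ (_ ∷ () ∷ _) _ _)
shape⇒longShapes m {_ ∷ suc (suc (suc _)) ∷ _} (isShape _ _ _ (s≤s (s≤s (s≤s ()))) _)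
shape⇒longShapes m {_ ∷ _ ∷ 0 ∷ _} (isShape _ _ (_ ∷ _ ∷ () ∷ _) _ _)
shape⇒longShapes m {_ ∷ 1 ∷ suc (suc _) ∷ _} (isShape (_ ∷ s≤s () ∷ _) _ _ _ _)
shape⇒longShapes m {_ ∷ 2 ∷ suc (suc (suc _)) ∷ _} (isShape (_ ∷ s≤s (s≤s ()) ∷ _) _ _ _ _)
shape⇒longShapes m {_ ∷ _ ∷ _ ∷ _ ∷ _} (isShape _ _ _ _ (s≤s (s≤s (s≤s ()))))

-- The last shape sets the bound 6: its first part `2 + m` must be at least 2.
longShapes⇒shape : ∀ m {μ} → μ ∈ longShapes m → Shape (6 + m) μ
longShapes⇒shape m (here refl) = isShape [-] (+-identityʳ (6 + m)) (s≤s z≤n ∷ []) (s≤s z≤n) (s≤s z≤n)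
longShapes⇒shape m (there (here refl)) =
  isShape (s≤s z≤n ∷ [-]) (+-comm (5 + m) 1) (s≤s z≤n ∷ s≤s z≤n ∷ []) (s≤s (s≤s z≤n)) (s≤s (s≤s z≤n))
longShapes⇒shape m (there (there (here refl))) =
  isShape (s≤s (s≤s z≤n) ∷ [-]) (+-comm (4 + m) 2) (s≤s z≤n ∷ s≤s z≤n ∷ []) ≤-refl (s≤s (s≤s z≤n))
longShapes⇒shape m (there (there (there (here refl)))) =
  isShape (s≤s z≤n ∷ ≤-refl ∷ [-]) (+-comm (4 + m) 2) (s≤s z≤n ∷ s≤s z≤n ∷ s≤s z≤n ∷ []) (s≤s (s≤s z≤n)) ≤-refl
longShapes⇒shape m (there (there (there (there (here refl))))) =
  isShape (s≤s (s≤s z≤n) ∷ s≤s z≤n ∷ [-]) (+-comm (3 + m) 3) (s≤s z≤n ∷ s≤s z≤n ∷ s≤s z≤n ∷ []) ≤-refl ≤-refl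
longShapes⇒shape m (there (there (there (there (there (here refl)))))) =
  isShape (s≤s (s≤s z≤n) ∷ ≤-refl ∷ [-]) (+-comm (2 + m) 4) (s≤s z≤n ∷ s≤s z≤n ∷ s≤s z≤n ∷ []) ≤-refl ≤-refl

longShapes-unique : ∀ m → Unique (longShapes m)
longShapes-unique m =
    ((λ ()) ∷ (λ ()) ∷ (λ ()) ∷ (λ ()) ∷ (λ ()) ∷ [])
  ∷ ((λ ()) ∷ (λ ()) ∷ (λ ()) ∷ (λ ()) ∷ [])
  ∷ ((λ ()) ∷ (λ ()) ∷ (λ ()) ∷ [])
  ∷ ((λ ()) ∷ (λ ()) ∷ [])
  ∷ ((λ ()) ∷ [])
  ∷ [] ∷ []

shapes-↭ : ∀ m → shapes (6 + m) ↭ longShapes m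
shapes-↭ m = unique-set-↭ (shapes-unique (6 + m)) (longShapes-unique m)
  (λ p → shape⇒longShapes m (∈-shapes⁻ p)) (λ p → ∈-shapes⁺ (longShapes⇒shape m p))

schurSum-long : ∀ m → schurSum (6 + m) ≈ s (6 + m ∷ []) ⊕ 2 · s (5 + m ∷ 1 ∷ []) ⊕ 2 · s (4 + m ∷ 2 ∷ [])
  ⊕ 3 · s (4 + m ∷ 1 ∷ 1 ∷ []) ⊕ 5 · s (3 + m ∷ 2 ∷ 1 ∷ []) ⊕ 5 · s (2 + m ∷ 2 ∷ 2 ∷ [])
schurSum-long m α = begin
  schurSum (6 + m) α ≡⟨ sum-↭ (map⁺ (λ μ → #SYT (overline μ) * s μ α) (shapes-↭ m)) ⟩
  1 * a + (2 * b + (2 * c + (3 * d + (5 * e + (#SYT (overline (2 + m ∷ 2 ∷ 2 ∷ [])) * f + 0)))))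
    ≡⟨ cong (λ k → 1 * a + (2 * b + (2 * c + (3 * d + (5 * e + (k * f + 0)))))) five ⟩
  1 * a + (2 * b + (2 * c + (3 * d + (5 * e + (5 * f + 0)))))
      ≡⟨ flatten (1 * a) (2 * b) (2 * c) (3 * d) (5 * e) (5 * f) ⟩
  1 * a + 2 * b + 2 * c + 3 * d + 5 * e + 5 * f ≡⟨ cong (λ x → x + 2 * b + 2 * c + 3 * d + 5 * e + 5 * f)
      (*-identityˡ a) ⟩
  a + 2 * b + 2 * c + 3 * d + 5 * e + 5 * f ∎
  where
  open ≡-Reasoning
  a = s (6 + m ∷ []) α
  b = s (5 + m ∷ 1 ∷ []) α
  c = s (4 + m ∷ 2 ∷ []) α
  d = s (4 + m ∷ 1 ∷ 1 ∷ []) α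
  e = s (3 + m ∷ 2 ∷ 1 ∷ []) α
  f = s (2 + m ∷ 2 ∷ 2 ∷ []) α
  -- The other five first parts reduce to their caps by computation. Here `(2 + m) ⊓ 2` gets stuck
  -- at `suc (suc (m ⊓ 0))`, because `_⊓_` examines its first argument first.
  five : #SYT (overline (2 + m ∷ 2 ∷ 2 ∷ [])) ≡ 5
  five = cong (λ k → #SYT (suc (suc k) ∷ 2 ∷ 2 ∷ [])) (⊓-zeroʳ m)
  flatten : ∀ a b c d e f → a + (b + (c + (d + (e + (f + 0))))) ≡ a + b + c + d + e + f
  flatten a b c d e f = begin
    a + (b + (c + (d + (e + (f + 0))))) ≡⟨ +-assoc a b _ ⟨
    a + b + (c + (d + (e + (f + 0)))) ≡⟨ +-assoc (a + b) c _ ⟨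
    a + b + c + (d + (e + (f + 0))) ≡⟨ +-assoc (a + b + c) d _ ⟨
    a + b + c + d + (e + (f + 0)) ≡⟨ +-assoc (a + b + c + d) e _ ⟨
    a + b + c + d + e + (f + 0) ≡⟨ cong (a + b + c + d + e +_) (+-identityʳ f) ⟩
    a + b + c + d + e + f ∎

theorem4p8 : ∀ (n : ℕ) → n ≥ 1 →
    (Q n Π₀ ≈ ∑[ μ ∈ filter (λ μ → length μ ≤? 3) (ℋ n 3) ] (#SYT (overline μ) · s μ))
    × (n ≥ 6 →
    Q n Π₀ ≈ s (n ∷ [])
    ⊕ 2 · s (n ∸ 1 ∷ 1 ∷ [])
    ⊕ 2 · s (n ∸ 2 ∷ 2 ∷ [])
    ⊕ 3 · s (n ∸ 2 ∷ 1 ∷ 1 ∷ [])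
    ⊕ 5 · s (n ∸ 3 ∷ 2 ∷ 1 ∷ [])
    ⊕ 5 · s (n ∸ 4 ∷ 2 ∷ 2 ∷ []))
theorem4p8 n _ = Q≈schurSum n , λ where
  (s≤s (s≤s (s≤s (s≤s (s≤s (s≤s {n = m} z≤n)))))) α → trans (Q≈schurSum n α) (schurSum-long m α)
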